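{- For every integer $n\ge1$, \[ r_{16}(n)=(-1)^{n}\frac{32}{17}\left(256\sum_{j=0}^{n-1}\sigma^{*}_{3}(j)\,\delta_{8}(n-j-1)-\sigma^{*}_{7}(n)\right). \]
   Context: For $s\ge1$ and $n\ge0$, $r_s(n)$ is the number of $(m_1,\dots,m_s)\in\mathbb{Z}^s$ with $m_1^2+\cdots+m_s^2=n$. For $n\ge0$, $\delta_8(n)$ is the number of representations of $n$ as a sum of $8$ triangular numbers, i.e. the number of $(t_1,\dots,t_8)\in\mathbb{Z}_{\ge0}^8$ with $\sum_i t_i(t_i+1)/2=n$. For $n,s\ge1$, $\sigma^{*}_{s}(n)=-\sum_{d\mid n}(-1)^{d}d^{s}$; by convention $\sigma_3^*(0)=-\frac1{16}$. -}

module Defs where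

open import Data.Nat as ℕ using (ℕ; zero; suc)
open import Data.Nat.Divisibility using (_∣?_)
open import Data.Integer as ℤ using (ℤ; +_; -[1+_])
open import Data.Rational as ℚ using (ℚ)
open import Data.List using (List; []; _∷_; map; filter; length; concatMap; upTo; applyUpTo)
import Data.List as L
open import Data.Vec using (Vec; []; _∷_; foldr)
open import Relation.Binary.PropositionalEquality using (_≡_)
open import Relation.Nullary.Decidable using (⌊_⌋)

intRange : ℕ → List ℤ
intRange k = map (λ i → + i) (upTo (suc k)) Data.List.++ map (λ i → -[1+ i ]) (upTo k)

tuples : {A : Set} → (s : ℕ) → List A → List (Vec A s)
tuples zero     xs = [] ∷ []
tuples (suc s)  xs = concatMap (λ x → map (x ∷_) (tuples s xs)) xs

sumSqℤ : {s : ℕ} → Vec ℤ s → ℤ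
sumSqℤ = foldr _ (λ m acc → m ℤ.* m ℤ.+ acc) (+ 0)

-- r_s(n) = #{ m ∈ ℤ^s : m_1²+…+m_s² = n }.
-- Any solution has |m_i| ≤ n, so enumerating the box [-n,n]^s counts all of them.
r : ℕ → ℕ → ℕ
r s n = length (filter (λ v → sumSqℤ v ℤ.≟ + n) (tuples s (intRange n)))

sumTri : {s : ℕ} → Vec ℕ s → ℕ
sumTri = foldr _ (λ t acc → (t ℕ.* suc t) ℕ./ 2 ℕ.+ acc) 0

-- δ₈(n) = #{ t ∈ ℕ^8 : Σ t_i(t_i+1)/2 = n }; any solution has t_i ≤ n.
δ₈ : ℕ → ℕ
δ₈ n = length (filter (λ v → sumTri v ℕ.≟ n) (tuples 8 (upTo (suc n))))

divisors : ℕ → List ℕ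
divisors n = filter (λ d → d ∣? n) (applyUpTo suc n)

σ* : ℕ → ℕ → ℤ
σ* s n = ℤ.- L.foldr ℤ._+_ (+ 0) (map (λ d → ((ℤ.- (+ 1)) ℤ.^ d) ℤ.* (+ (d ℕ.^ s))) (divisors n))

-- σ*_3 extended to 0 by the convention σ*_3(0) = -1/16, as a rational
σ*₃ : ℕ → ℚ
σ*₃ zero    = ℚ.- (+ 1 ℚ./ 16)
σ*₃ (suc n) = σ* 3 (suc n) ℚ./ 1

Σ< : ℕ → (ℕ → ℚ) → ℚ
Σ< zero    f = ℚ.0ℚ
Σ< (suc n) f = Σ< n f ℚ.+ f n

{-# OPTIONS --safe #-}
-- Put θ = Σ_{i∈ℤ} (-1)^i q^{i²}, ψ = Σ_{t≥0} q^{t(t+1)/2} and D = q·d/dq.  Sums over the indefinite forms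
-- i(i+ε) + yz = N cancel in pairs under the two steps along Conway's river; what remains gives the
-- logarithmic derivatives Dθ/θ and Dψ/ψ as divisor sums.  Sums over ax + by = n are transformed by
-- (a,b,x,y) ↦ (a-b,b,x,x+y) (Skoruppa); with weights of degree four this shows that the cubic divisor
-- sums satisfy the first-order equations of θ⁸ and qψ⁸, so that θ⁸ = 1 - 16 Σ σ₃*(n) qⁿ and
-- qψ⁸ = Σ (Σ_{d∣n, n/d odd} d³) qⁿ.  The weight a²b²(a+b)² evaluates the convolution of cubes as a sum of
-- seventh powers (E₄² = E₈), and this expresses θ¹⁶ = (θ⁸)² through θ⁸·qψ⁸ and σ₇*.
module Submission where

open import Data.Bool using (if_then_else_; true; false)
open import Data.Nat as ℕ using (ℕ; zero; suc; z≤n; s≤s)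
import Data.Nat.Properties as ℕ
open import Data.Integer as ℤ using (ℤ; +_; -[1+_]; 0ℤ; 1ℤ)
import Data.Integer.Properties as ℤ
open import Data.Integer.Solver using (module +-*-Solver)
open import Data.List using (List; foldr; []; _∷_; _++_; map; filter; length; concatMap; cartesianProduct; cartesianProductWith; upTo; applyUpTo)
open import Data.List.Membership.Propositional using (_∈_)
open import Data.List.Membership.Propositional.Properties using (∈-map⁺; ∈-map⁻; ∈-applyUpTo⁺; ∈-applyUpTo⁻; ∈-filter⁺; ∈-filter⁻; ∈-cartesianProduct⁺; ∈-cartesianProduct⁻; ∈-upTo⁺; ∈-upTo⁻; ∈-++⁺ˡ; ∈-++⁺ʳ; ∈-++⁻)
open import Data.List.Membership.Propositional.Properties.WithK using (unique∧set⇒bag)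
open import Data.List.Relation.Binary.BagAndSetEquality using (∼bag⇒↭)
open import Data.List.Relation.Binary.Permutation.Propositional as Perm using (_↭_)
open import Data.List.Relation.Unary.All as All using (All; []; _∷_)
import Data.List.Relation.Unary.All.Properties as All
open import Data.List.Relation.Unary.AllPairs using ([]; _∷_)
open import Data.List.Relation.Unary.Any using (here; there)
open import Data.List.Relation.Unary.Unique.Propositional using (Unique)
import Data.List.Relation.Unary.Unique.Propositional.Properties as Unique
open import Data.Product using (_×_; _,_; proj₁; proj₂; ∃)
open import Data.Product.Properties using (≡-dec)
open import Data.Sum using (_⊎_; inj₁; inj₂)
open import Function using (_∘_; id; mk⇔)
open import Relation.Binary.Definitions using (DecidableEquality; tri<; tri≈; tri>)
open import Relation.Binary.PropositionalEquality using (_≡_; refl; sym; trans; cong; cong₂; subst; module ≡-Reasoning)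
open import Relation.Nullary using (¬_; Dec; yes; no; does; contradiction; ¬?)
open import Relation.Unary using (Decidable)
open import Data.List.Properties using (upTo-∷ʳ; filter-≐)
open import Data.Nat.DivMod using (m*n/n≡m; m/n*n≡m)
open import Data.Nat.Divisibility using (_∣_; _∣?_; divides; ∣⇒≤)
import Data.Vec as Vec
open import Data.Vec using (Vec; []; _∷_)
open import Relation.Nullary.Decidable using (dec-true; dec-false)
open import Defs

-- The obstacle is to do without spaces of modular forms. Their finite dimension is replaced by
-- linear equations DF = ℓF with ℓ(0) = 0, which determine F from its constant term; an eighth power
-- then needs only a logarithmic derivative and one quadratic identity between divisor sums. Those
-- identities admit weights that are polynomial in a, b and see x, y only through parity. Hence σₛ*,
-- which is signed by the divisor d, has to be rewritten through the codivisor e = n/d: it is the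
-- sum of dˢ with weight 1 for odd e and 1 - 2^(s+1) for even e. The sign (-1)ⁿ of the theorem is
-- the substitution q ↦ -q that turns Σ q^(i²) into θ; the shift n-j-1 is the factor q of qψ⁸; the
-- value σ₃*(0) = -1/16 is what makes θ⁸ = -16 Σ σ₃*(j) q^j include its constant term. Origin of 17
-- and 32: with S = Σ_{n≥1} σ₃*(n) qⁿ and T = qψ⁸ one has 17(θ¹⁶ - 1) = 32(136S² - 17S), and the
-- convolution of cubes evaluates 136S² - 256ST; what is left over, 256ST - 16T, equals -16 θ⁸T.

-- Finite integer sums: reindexing, fibres and sign-reversing involutions.

module FiniteSums where

  open import Data.Integer using (_+_; _*_; _-_; -_)
  open +-*-Solver using (solve; _:+_; _:*_; _:-_; :-_; con; _:=_; Polynomial)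

  private variable
    A B C : Set

  sumOver : List A → (A → ℤ) → ℤ
  sumOver []       f = 0ℤ
  sumOver (x ∷ xs) f = f x + sumOver xs f

  sum-cong : ∀ (xs : List A) {f g : A → ℤ} → (∀ {x} → x ∈ xs → f x ≡ g x) → sumOver xs f ≡ sumOver xs g
  sum-cong []       eq = refl
  sum-cong (x ∷ xs) eq = cong₂ _+_ (eq (here refl)) (sum-cong xs (eq ∘ there))

  interchange : ∀ a b c d → (a + b) + (c + d) ≡ (a + c) + (b + d)
  interchange = solve 4 (λ a b c d → (a :+ b) :+ (c :+ d) := (a :+ c) :+ (b :+ d)) refl

  sum-+ : ∀ (xs : List A) (f g : A → ℤ) → sumOver xs (λ x → f x + g x) ≡ sumOver xs f + sumOver xs g
  sum-+ []       f g = refl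
  sum-+ (x ∷ xs) f g = trans (cong (_+_ (f x + g x)) (sum-+ xs f g)) (interchange (f x) (g x) _ _)

  sum-* : ∀ (xs : List A) c (f : A → ℤ) → sumOver xs (λ x → c * f x) ≡ c * sumOver xs f
  sum-* []       c f = sym (ℤ.*-zeroʳ c)
  sum-* (x ∷ xs) c f = trans (cong (_+_ (c * f x)) (sum-* xs c f)) (sym (ℤ.*-distribˡ-+ c (f x) _))

  sum-neg : ∀ (xs : List A) (f : A → ℤ) → sumOver xs (λ x → - f x) ≡ - sumOver xs f
  sum-neg []       f = refl
  sum-neg (x ∷ xs) f = trans (cong (_+_ (- f x)) (sum-neg xs f)) (sym (ℤ.neg-distrib-+ (f x) _))

  sum-map : ∀ (h : A → B) (xs : List A) (f : B → ℤ) → sumOver (map h xs) f ≡ sumOver xs (f ∘ h)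
  sum-map h []       f = refl
  sum-map h (x ∷ xs) f = cong (_+_ (f (h x))) (sum-map h xs f)

  sum-↭ : ∀ {xs ys : List A} (f : A → ℤ) → xs ↭ ys → sumOver xs f ≡ sumOver ys f
  sum-↭ f Perm.refl         = refl
  sum-↭ f (Perm.prep x p)   = cong (_+_ (f x)) (sum-↭ f p)
  sum-↭ f (Perm.swap {ys = ys} x y p) = trans (cong (λ s → f x + (f y + s)) (sum-↭ f p))
    (solve 3 (λ a b c → a :+ (b :+ c) := b :+ (a :+ c)) refl (f x) (f y) (sumOver ys f))
  sum-↭ f (Perm.trans p q)  = trans (sum-↭ f p) (sum-↭ f q)

  sum-split : ∀ {P : A → Set} (P? : Decidable P) (xs : List A) (f : A → ℤ) →
    sumOver xs f ≡ sumOver (filter P? xs) f + sumOver (filter (¬? ∘ P?) xs) f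
  sum-split P? []       f = refl
  sum-split P? (x ∷ xs) f with does (P? x)
  ... | true  = trans (cong (_+_ (f x)) (sum-split P? xs f)) (sym (ℤ.+-assoc (f x) _ _))
  ... | false = trans (cong (_+_ (f x)) (sum-split P? xs f))
    (solve 3 (λ a b c → a :+ (b :+ c) := b :+ (a :+ c)) refl (f x) (sumOver (filter P? xs) f) (sumOver (filter (¬? ∘ P?) xs) f))

  indicator : ∀ {P : Set} → Dec P → ℤ → ℤ
  indicator d c = if does d then c else 0ℤ

  sum-filter-∷ : ∀ {P : A → Set} (P? : Decidable P) x (xs : List A) (f : A → ℤ) →
    sumOver (filter P? (x ∷ xs)) f ≡ indicator (P? x) (f x) + sumOver (filter P? xs) f
  sum-filter-∷ P? x xs f with does (P? x)
  ... | true  = refl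
  ... | false = sym (ℤ.+-identityˡ _)

  sum-indicator : ∀ {P : A → Set} (P? : Decidable P) (xs : List A) (f : A → ℤ) →
    sumOver (filter P? xs) f ≡ sumOver xs (λ x → indicator (P? x) (f x))
  sum-indicator P? []       f = refl
  sum-indicator P? (x ∷ xs) f = trans (sum-filter-∷ P? x xs f) (cong (_+_ (indicator (P? x) (f x))) (sum-indicator P? xs f))

  sum-zero : ∀ (xs : List A) {f : A → ℤ} → (∀ {x} → x ∈ xs → f x ≡ 0ℤ) → sumOver xs f ≡ 0ℤ
  sum-zero []       eq = refl
  sum-zero (x ∷ xs) eq = trans (cong₂ _+_ (eq (here refl)) (sum-zero xs (eq ∘ there))) refl

  module _ (_≟_ : DecidableEquality B) where

    sum-delta : ∀ {ps : List B} → Unique ps → ∀ {q} → q ∈ ps → ∀ c → sumOver ps (λ p → indicator (q ≟ p) c) ≡ c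
    sum-delta {ps = p ∷ ps} (p∉ ∷ u) {q} (here refl) c with q ≟ q
    ... | yes _ = trans (cong (_+_ c) (sum-zero ps vanish)) (ℤ.+-identityʳ c)
      where
      vanish : ∀ {x} → x ∈ ps → indicator (q ≟ x) c ≡ 0ℤ
      vanish {x} x∈ with q ≟ x
      ... | yes refl = contradiction refl (All.lookup p∉ x∈)
      ... | no _     = refl
    ... | no ¬eq = contradiction refl ¬eq
    sum-delta {ps = p ∷ ps} (p∉ ∷ u) {q} (there q∈) c with q ≟ p
    ... | yes refl = contradiction refl (All.lookup p∉ q∈)
    ... | no _     = trans (ℤ.+-identityˡ _) (sum-delta u q∈ c)

    sum-fibre : ∀ (π : A → B) {ps : List B} → Unique ps → ∀ (xs : List A) → (∀ {x} → x ∈ xs → π x ∈ ps) →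
      ∀ (f : A → ℤ) → sumOver xs f ≡ sumOver ps (λ p → sumOver (filter (λ x → π x ≟ p) xs) f)
    sum-fibre π {ps} u []       m f = sym (sum-zero ps (λ _ → refl))
    sum-fibre π {ps} u (x ∷ xs) m f = sym (begin
      sumOver ps (λ p → sumOver (filter (λ x → π x ≟ p) (x ∷ xs)) f)
        ≡⟨ sum-cong ps (λ {p} _ → sum-filter-∷ (λ x → π x ≟ p) x xs f) ⟩
      sumOver ps (λ p → indicator (π x ≟ p) (f x) + sumOver (filter (λ x → π x ≟ p) xs) f)
        ≡⟨ sum-+ ps _ _ ⟩
      sumOver ps (λ p → indicator (π x ≟ p) (f x)) + sumOver ps (λ p → sumOver (filter (λ x → π x ≟ p) xs) f)
        ≡⟨ cong₂ _+_ (sum-delta u (m (here refl)) (f x)) (sym (sum-fibre π u xs (m ∘ there) f)) ⟩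
      f x + sumOver xs f ∎)
      where open ≡-Reasoning

  -- Two lists enumerating the same predicate are permutations of each other, so a sum depends on
  -- the predicate alone. This lets every solution set be cut out of whatever finite box is
  -- convenient.
  record Enumerates (P : A → Set) (xs : List A) : Set where
    field
      unique   : Unique xs
      sound    : ∀ {x} → x ∈ xs → P x
      complete : ∀ {x} → P x → x ∈ xs
  open Enumerates

  unique-map : ∀ {P : A → Set} {f : A → B} {xs : List A} → (∀ {x y} → P x → P y → f x ≡ f y → x ≡ y) →
    All P xs → Unique xs → Unique (map f xs)
  unique-map inj []       []       = []
  unique-map {f = f} inj (p ∷ ps) (n ∷ u) =
    All.map⁺ (All.zipWith (λ (q , x≢y) → x≢y ∘ inj p q) (ps , n)) ∷ unique-map inj ps u

  enum-filter : ∀ {P Q : A → Set} {xs} → Enumerates P xs → (Q? : Decidable Q) →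
    Enumerates (λ x → P x × Q x) (filter Q? xs)
  enum-filter e Q? .unique = Unique.filter⁺ Q? (e .unique)
  enum-filter {xs = xs} e Q? .sound x∈ with ∈-filter⁻ Q? {xs = xs} x∈
  ... | x∈xs , q = e .sound x∈xs , q
  enum-filter e Q? .complete (p , q) = ∈-filter⁺ Q? (e .complete p) q

  enum-× : ∀ {P : A → Set} {Q : B → Set} {xs ys} → Enumerates P xs → Enumerates Q ys →
    Enumerates (λ (x , y) → P x × Q y) (cartesianProduct xs ys)
  enum-× e e′ .unique = Unique.cartesianProduct⁺ (e .unique) (e′ .unique)
  enum-× {xs = xs} {ys} e e′ .sound m with ∈-cartesianProduct⁻ xs ys m
  ... | x∈ , y∈ = e .sound x∈ , e′ .sound y∈
  enum-× e e′ .complete (p , q) = ∈-cartesianProduct⁺ (e .complete p) (e′ .complete q)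

  enum-⇔ : ∀ {P Q : A → Set} {xs} → (∀ {x} → P x → Q x) → (∀ {x} → Q x → P x) → Enumerates P xs → Enumerates Q xs
  enum-⇔ f g e .unique   = e .unique
  enum-⇔ f g e .sound    = f ∘ e .sound
  enum-⇔ f g e .complete = e .complete ∘ g

  -- The image of `xs` and the list `ys` are free of repetitions and have the same members, hence
  -- are permutations. The maps are total but need to be mutually inverse only on `P` and `Q`, which
  -- suits maps such as subtraction that leave the domain elsewhere.
  sum-bij : ∀ {P : A → Set} {Q : B → Set} {xs ys} → Enumerates P xs → Enumerates Q ys →
    (to : A → B) (from : B → A) →
    (∀ {x} → P x → Q (to x)) → (∀ {y} → Q y → P (from y)) →
    (∀ {x} → P x → from (to x) ≡ x) → (∀ {y} → Q y → to (from y) ≡ y) →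
    ∀ {f g} → (∀ {x} → P x → f x ≡ g (to x)) → sumOver xs f ≡ sumOver ys g
  sum-bij {P = P} {Q} {xs} {ys} e e′ to from P⇒Q Q⇒P ft tf {f} {g} eq = begin
    sumOver xs f          ≡⟨ sum-cong xs (eq ∘ e .sound) ⟩
    sumOver xs (g ∘ to)   ≡⟨ sum-map to xs g ⟨
    sumOver (map to xs) g ≡⟨ sum-↭ g perm ⟩
    sumOver ys g          ∎
    where
    open ≡-Reasoning
    unique-to : Unique (map to xs)
    unique-to = unique-map (λ p q tx≡ty → trans (sym (ft p)) (trans (cong from tx≡ty) (ft q)))
      (All.tabulate (e .sound)) (e .unique)
    forth : ∀ {y} → y ∈ map to xs → y ∈ ys
    forth m with ∈-map⁻ to m
    ... | x , x∈ , refl = e′ .complete (P⇒Q (e .sound x∈))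
    back : ∀ {y} → y ∈ ys → y ∈ map to xs
    back y∈ = let q = e′ .sound y∈ in subst (_∈ map to xs) (tf q) (∈-map⁺ to (e .complete (Q⇒P q)))
    perm : map to xs ↭ ys
    perm = ∼bag⇒↭ (unique∧set⇒bag unique-to (e′ .unique) (mk⇔ forth back))

  sum-enum : ∀ {P : A → Set} {xs ys} → Enumerates P xs → Enumerates P ys →
    ∀ {f g} → (∀ {x} → P x → f x ≡ g x) → sumOver xs f ≡ sumOver ys g
  sum-enum e e′ eq = sum-bij e e′ id id id id (λ _ → refl) (λ _ → refl) eq

  self-neg⇒0 : ∀ {i} → i ≡ - i → i ≡ 0ℤ
  self-neg⇒0 {+ zero}    eq = refl
  self-neg⇒0 {+ suc n}   ()
  self-neg⇒0 { -[1+ n ]} ()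

  -- Reindexing by `ι` shows that the sum equals its own negative. Fixed points satisfy f x = - f x
  -- and so vanish with the rest.
  sum-involution : ∀ {P : A → Set} {xs} → Enumerates P xs → (ι : A → A) →
    (∀ {x} → P x → P (ι x)) → (∀ {x} → P x → ι (ι x) ≡ x) →
    ∀ {f : A → ℤ} → (∀ {x} → P x → f (ι x) ≡ - f x) → sumOver xs f ≡ 0ℤ
  sum-involution {xs = xs} e ι pres inv {f} anti = self-neg⇒0 (trans
    (sum-bij e e ι ι pres pres inv inv {f} {λ x → - f x}
      (λ p → trans (sym (ℤ.neg-involutive _)) (cong -_ (sym (anti p)))))
    (sum-neg xs f))

open FiniteSums

-- Formal power series over the integers, the derivation q·d/dq, and generating functions of finite
-- lists.

module PowerSeries where

  open import Data.Integer using (_+_; _*_; _-_; -_)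
  open +-*-Solver using (solve; _:+_; _:*_; _:-_; :-_; con; _:=_; Polynomial)
  open Enumerates

  private variable
    A B C : Set

  Series : Set
  Series = ℕ → ℤ

  private variable
    f f′ g g′ h : Series

  tail : Series → Series
  tail f n = f (suc n)

  infixl 7 _⊛_ _·_
  infixl 6 _⊕_

  _⊛_ : Series → Series → Series
  (f ⊛ g) zero    = f 0 * g 0
  (f ⊛ g) (suc n) = f 0 * g (suc n) + (tail f ⊛ g) n

  _⊕_ : Series → Series → Series
  (f ⊕ g) n = f n + g n

  _·_ : ℤ → Series → Series
  (c · f) n = c * f n

  one : Series
  one zero    = 1ℤ
  one (suc n) = 0ℤ

  D : Series → Series
  D f n = + n * f n

  -- A series read off from a fixed finite box has correct coefficients only up to the size of the
  -- box. Coefficient `n` of a product sees nothing beyond `n`, so agreement up to `n` is the right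
  -- hypothesis.
  ⊛-cong-≤ : ∀ n → (∀ {j} → j ℕ.≤ n → f j ≡ f′ j) → (∀ {j} → j ℕ.≤ n → g j ≡ g′ j) → (f ⊛ g) n ≡ (f′ ⊛ g′) n
  ⊛-cong-≤ zero    p q = cong₂ _*_ (p z≤n) (q z≤n)
  ⊛-cong-≤ (suc n) p q = cong₂ _+_ (cong₂ _*_ (p z≤n) (q ℕ.≤-refl)) (⊛-cong-≤ n (p ∘ s≤s) (q ∘ ℕ.m≤n⇒m≤1+n))

  ⊛-cong : (∀ j → f j ≡ f′ j) → (∀ j → g j ≡ g′ j) → ∀ n → (f ⊛ g) n ≡ (f′ ⊛ g′) n
  ⊛-cong p q n = ⊛-cong-≤ n (λ {j} _ → p j) (λ {j} _ → q j)

  ⊛-distribʳ : ∀ f g h n → ((f ⊕ g) ⊛ h) n ≡ (f ⊛ h) n + (g ⊛ h) n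
  ⊛-distribʳ f g h zero    = ℤ.*-distribʳ-+ (h 0) (f 0) (g 0)
  ⊛-distribʳ f g h (suc n) = trans (cong (_+_ ((f 0 + g 0) * h (suc n))) (⊛-distribʳ (tail f) (tail g) h n))
    (solve 5 (λ a b c d e → (a :+ b) :* c :+ (d :+ e) := (a :* c :+ d) :+ (b :* c :+ e)) refl (f 0) (g 0) (h (suc n)) _ _)

  ⊛-scaleˡ : ∀ c f g n → ((c · f) ⊛ g) n ≡ c * (f ⊛ g) n
  ⊛-scaleˡ c f g zero    = ℤ.*-assoc c (f 0) (g 0)
  ⊛-scaleˡ c f g (suc n) = trans (cong (_+_ (c * f 0 * g (suc n))) (⊛-scaleˡ c (tail f) g n))
    (solve 4 (λ c a b d → c :* a :* b :+ c :* d := c :* (a :* b :+ d)) refl c (f 0) (g (suc n)) _)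

  ⊛-sucʳ : ∀ f g n → (f ⊛ g) (suc n) ≡ f (suc n) * g 0 + (f ⊛ tail g) n
  ⊛-sucʳ f g zero    = ℤ.+-comm (f 0 * g 1) (f 1 * g 0)
  ⊛-sucʳ f g (suc n) = trans (cong (_+_ (f 0 * g (suc (suc n)))) (⊛-sucʳ (tail f) g n))
    (solve 3 (λ a b c → a :+ (b :+ c) := b :+ (a :+ c)) refl (f 0 * g (suc (suc n))) (f (suc (suc n)) * g 0) _)

  ⊛-comm : ∀ f g n → (f ⊛ g) n ≡ (g ⊛ f) n
  ⊛-comm f g zero    = ℤ.*-comm (f 0) (g 0)
  ⊛-comm f g (suc n) = trans (cong₂ _+_ (ℤ.*-comm (f 0) (g (suc n))) (⊛-comm (tail f) g n)) (sym (⊛-sucʳ g f n))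

  ⊛-assoc : ∀ f g h n → ((f ⊛ g) ⊛ h) n ≡ (f ⊛ (g ⊛ h)) n
  ⊛-assoc f g h zero    = ℤ.*-assoc (f 0) (g 0) (h 0)
  ⊛-assoc f g h (suc n) = begin
    f 0 * g 0 * h (suc n) + (((f 0 · tail g) ⊕ (tail f ⊛ g)) ⊛ h) n
      ≡⟨ cong (_+_ (f 0 * g 0 * h (suc n))) (⊛-distribʳ (f 0 · tail g) (tail f ⊛ g) h n) ⟩
    f 0 * g 0 * h (suc n) + (((f 0 · tail g) ⊛ h) n + ((tail f ⊛ g) ⊛ h) n)
      ≡⟨ cong (_+_ (f 0 * g 0 * h (suc n))) (cong₂ _+_ (⊛-scaleˡ (f 0) (tail g) h n) (⊛-assoc (tail f) g h n)) ⟩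
    f 0 * g 0 * h (suc n) + (f 0 * (tail g ⊛ h) n + (tail f ⊛ (g ⊛ h)) n)
      ≡⟨ solve 5 (λ a b c d e → a :* b :* c :+ (a :* d :+ e) := a :* (b :* c :+ d) :+ e) refl (f 0) (g 0) (h (suc n)) _ _ ⟩
    f 0 * (g 0 * h (suc n) + (tail g ⊛ h) n) + (tail f ⊛ (g ⊛ h)) n ∎
    where open ≡-Reasoning

  ⊛-distribˡ : ∀ f g h n → (f ⊛ (g ⊕ h)) n ≡ (f ⊛ g) n + (f ⊛ h) n
  ⊛-distribˡ f g h n = trans (⊛-comm f (g ⊕ h) n) (trans (⊛-distribʳ g h f n) (cong₂ _+_ (⊛-comm g f n) (⊛-comm h f n)))

  ⊛-scaleʳ : ∀ c f g n → (f ⊛ (c · g)) n ≡ c * (f ⊛ g) n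
  ⊛-scaleʳ c f g n = trans (⊛-comm f (c · g) n) (trans (⊛-scaleˡ c g f n) (cong (c *_) (⊛-comm g f n)))

  ⊛-zeroˡ : (∀ j → f j ≡ 0ℤ) → ∀ g n → (f ⊛ g) n ≡ 0ℤ
  ⊛-zeroˡ z g zero    = cong (_* g 0) (z 0)
  ⊛-zeroˡ z g (suc n) = cong₂ _+_ (cong (_* g (suc n)) (z 0)) (⊛-zeroˡ (z ∘ suc) g n)

  ⊛-identityˡ : ∀ g n → (one ⊛ g) n ≡ g n
  ⊛-identityˡ g zero    = ℤ.*-identityˡ (g 0)
  ⊛-identityˡ g (suc n) = trans (cong₂ _+_ (ℤ.*-identityˡ (g (suc n))) (⊛-zeroˡ (λ _ → refl) g n)) (ℤ.+-identityʳ _)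

  D-⊛ : ∀ f g n → D (f ⊛ g) n ≡ (D f ⊛ g) n + (f ⊛ D g) n
  D-⊛ f g zero    = solve 2 (λ a b → con 0ℤ :* (a :* b) := con 0ℤ :* a :* b :+ a :* (con 0ℤ :* b)) refl (f 0) (g 0)
  D-⊛ f g (suc n) = begin
    + suc n * (f 0 * g (suc n) + (tail f ⊛ g) n)
      ≡⟨ solve 4 (λ n a b c → (con 1ℤ :+ n) :* (a :* b :+ c) := con 0ℤ :* a :* b :+ (a :* ((con 1ℤ :+ n) :* b) :+ (n :* c :+ c)))
           refl (+ n) (f 0) (g (suc n)) _ ⟩
    D f 0 * g (suc n) + (f 0 * D g (suc n) + (D (tail f ⊛ g) n + (tail f ⊛ g) n))
      ≡⟨ cong (λ s → D f 0 * g (suc n) + (f 0 * D g (suc n) + (s + (tail f ⊛ g) n))) (D-⊛ (tail f) g n) ⟩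
    D f 0 * g (suc n) + (f 0 * D g (suc n) + ((D (tail f) ⊛ g) n + (tail f ⊛ D g) n + (tail f ⊛ g) n))
      ≡⟨ solve 5 (λ a b c d e → a :+ (b :+ (c :+ d :+ e)) := (a :+ (c :+ e)) :+ (b :+ d)) refl (D f 0 * g (suc n)) (f 0 * D g (suc n)) ((D (tail f) ⊛ g) n) ((tail f ⊛ D g) n) ((tail f ⊛ g) n) ⟩
    (D f 0 * g (suc n) + ((D (tail f) ⊛ g) n + (tail f ⊛ g) n)) + (f ⊛ D g) (suc n)
      ≡⟨ cong (λ s → D f 0 * g (suc n) + s + (f ⊛ D g) (suc n)) (sym (⊛-distribʳ (D (tail f)) (tail f) g n)) ⟩
    (D f 0 * g (suc n) + ((D (tail f) ⊕ tail f) ⊛ g) n) + (f ⊛ D g) (suc n)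
      ≡⟨ cong (λ s → D f 0 * g (suc n) + s + (f ⊛ D g) (suc n)) (⊛-cong {g = g} tail-D (λ _ → refl) n) ⟩
    (D f ⊛ g) (suc n) + (f ⊛ D g) (suc n) ∎
    where
    open ≡-Reasoning
    tail-D : ∀ j → (D (tail f) ⊕ tail f) j ≡ tail (D f) j
    tail-D j = solve 2 (λ j a → j :* a :+ a := (con 1ℤ :+ j) :* a) refl (+ j) (f (suc j))

  power : Series → ℕ → Series
  power f zero    = one
  power f (suc s) = f ⊛ power f s

  power-cong-≤ : ∀ s n → (∀ {j} → j ℕ.≤ n → f j ≡ g j) → power f s n ≡ power g s n
  power-cong-≤ zero    n eq = refl
  power-cong-≤ {f} {g} (suc s) n eq =
    ⊛-cong-≤ {f} {g} {power f s} n eq (λ j≤n → power-cong-≤ s _ (λ i≤j → eq (ℕ.≤-trans i≤j j≤n)))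

  power-+ : ∀ f s t n → power f (s ℕ.+ t) n ≡ (power f s ⊛ power f t) n
  power-+ f zero    t n = sym (⊛-identityˡ (power f t) n)
  power-+ f (suc s) t n = trans (⊛-cong {f} (λ _ → refl) (power-+ f s t) n) (sym (⊛-assoc f (power f s) (power f t) n))

  -- If ℓ is the logarithmic derivative of f, that of f^s is sℓ; the statement avoids division by
  -- writing Df = ℓf.
  D-power : ∀ {ℓ} → (∀ n → D f n ≡ (ℓ ⊛ f) n) → ∀ s n → D (power f s) n ≡ + s * (ℓ ⊛ power f s) n
  D-power eq zero    zero    = refl
  D-power eq zero    (suc n) = ℤ.*-zeroʳ (+ suc n)
  D-power {f} {ℓ} eq (suc s) n = begin
    D (f ⊛ power f s) n                                              ≡⟨ D-⊛ f (power f s) n ⟩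
    (D f ⊛ power f s) n + (f ⊛ D (power f s)) n                      ≡⟨ cong₂ _+_ left right ⟩
    (ℓ ⊛ (f ⊛ power f s)) n + + s * (ℓ ⊛ (f ⊛ power f s)) n          ≡⟨ solve 2 (λ a s → a :+ s :* a := (con 1ℤ :+ s) :* a) refl ((ℓ ⊛ (f ⊛ power f s)) n) (+ s) ⟩
    + suc s * (ℓ ⊛ (f ⊛ power f s)) n                                ∎
    where
    open ≡-Reasoning
    left : (D f ⊛ power f s) n ≡ (ℓ ⊛ (f ⊛ power f s)) n
    left = trans (⊛-cong {g = power f s} eq (λ _ → refl) n) (⊛-assoc ℓ f (power f s) n)
    right : (f ⊛ D (power f s)) n ≡ + s * (ℓ ⊛ (f ⊛ power f s)) n
    right = begin
      (f ⊛ D (power f s)) n                ≡⟨ ⊛-cong {f} (λ _ → refl) (D-power {f} {ℓ} eq s) n ⟩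
      (f ⊛ (+ s · (ℓ ⊛ power f s))) n      ≡⟨ ⊛-scaleʳ (+ s) f (ℓ ⊛ power f s) n ⟩
      + s * (f ⊛ (ℓ ⊛ power f s)) n        ≡⟨ cong (+ s *_) (sym (⊛-assoc f ℓ (power f s) n)) ⟩
      + s * ((f ⊛ ℓ) ⊛ power f s) n        ≡⟨ cong (+ s *_) (⊛-cong {g = power f s} (⊛-comm f ℓ) (λ _ → refl) n) ⟩
      + s * ((ℓ ⊛ f) ⊛ power f s) n        ≡⟨ cong (+ s *_) (⊛-assoc ℓ f (power f s) n) ⟩
      + s * (ℓ ⊛ (f ⊛ power f s)) n        ∎

  -- Because ℓ has no constant term, the equation expresses n·f(n) through the f(j) with j < n.
  -- Cancelling n > 0 gives strong induction from the common value at 0.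
  D-unique : ∀ {ℓ} c → ℓ 0 ≡ 0ℤ → f 0 ≡ g 0 →
    (∀ n → D f n ≡ c * (ℓ ⊛ f) n) → (∀ n → D g n ≡ c * (ℓ ⊛ g) n) → ∀ n → f n ≡ g n
  D-unique {f} {g} {ℓ} c ℓ₀ f₀ Df Dg n = agree n ℕ.≤-refl
    where
    agree : ∀ n {j} → j ℕ.≤ n → f j ≡ g j
    agree n       {zero}  _         = f₀
    agree (suc n) {suc j} (s≤s j≤n) = ℤ.*-cancelˡ-≡ (+ suc j) (f (suc j)) (g (suc j)) (begin
      + suc j * f (suc j)                            ≡⟨ Df (suc j) ⟩
      c * (ℓ 0 * f (suc j) + (tail ℓ ⊛ f) j)         ≡⟨ cong (λ z → c * (z * f (suc j) + (tail ℓ ⊛ f) j)) ℓ₀ ⟩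
      c * (0ℤ * f (suc j) + (tail ℓ ⊛ f) j)          ≡⟨ cong (λ s → c * (0ℤ + s)) (⊛-cong-≤ {tail ℓ} j (λ _ → refl) (λ i≤j → agree n (ℕ.≤-trans i≤j j≤n))) ⟩
      c * (0ℤ * g (suc j) + (tail ℓ ⊛ g) j)          ≡⟨ cong (λ z → c * (z * g (suc j) + (tail ℓ ⊛ g) j)) (sym ℓ₀) ⟩
      c * (ℓ 0 * g (suc j) + (tail ℓ ⊛ g) j)         ≡⟨ Dg (suc j) ⟨
      + suc j * g (suc j)                            ∎)
      where open ≡-Reasoning

  -- The substitution q ↦ -q, a ring homomorphism by `twist-⊛`.
  twist : Series → Series
  twist f n = (- 1ℤ) ℤ.^ n * f n

  twist-⊛ : ∀ f g n → twist (f ⊛ g) n ≡ (twist f ⊛ twist g) n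
  twist-⊛ f g zero    = solve 2 (λ a b → con 1ℤ :* (a :* b) := con 1ℤ :* a :* (con 1ℤ :* b)) refl (f 0) (g 0)
  twist-⊛ f g (suc n) = begin
    - 1ℤ * (- 1ℤ) ℤ.^ n * (f 0 * g (suc n) + (tail f ⊛ g) n)
      ≡⟨ solve 4 (λ s a b c → con (- 1ℤ) :* s :* (a :* b :+ c) := con 1ℤ :* a :* (con (- 1ℤ) :* s :* b) :+ con (- 1ℤ) :* (s :* c)) refl ((- 1ℤ) ℤ.^ n) (f 0) (g (suc n)) _ ⟩
    twist f 0 * twist g (suc n) + - 1ℤ * twist (tail f ⊛ g) n
      ≡⟨ cong (λ s → twist f 0 * twist g (suc n) + - 1ℤ * s) (twist-⊛ (tail f) g n) ⟩
    twist f 0 * twist g (suc n) + - 1ℤ * (twist (tail f) ⊛ twist g) n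
      ≡⟨ cong (_+_ (twist f 0 * twist g (suc n))) (sym (⊛-scaleˡ (- 1ℤ) (twist (tail f)) (twist g) n)) ⟩
    twist f 0 * twist g (suc n) + ((- 1ℤ · twist (tail f)) ⊛ twist g) n
      ≡⟨ cong (_+_ (twist f 0 * twist g (suc n))) (⊛-cong {g = twist g} (λ j → sym (ℤ.*-assoc (- 1ℤ) ((- 1ℤ) ℤ.^ j) (f (suc j)))) (λ _ → refl) n) ⟩
    (twist f ⊛ twist g) (suc n) ∎
    where open ≡-Reasoning

  twist-power : ∀ f s n → twist (power f s) n ≡ power (twist f) s n
  twist-power f zero    zero    = refl
  twist-power f zero    (suc n) = ℤ.*-zeroʳ ((- 1ℤ) ℤ.^ suc n)
  twist-power f (suc s) n = trans (twist-⊛ f (power f s) n) (⊛-cong {twist f} (λ _ → refl) (twist-power f s) n)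

  mono : ℕ → ℤ → Series
  mono w c n = indicator (w ℕ.≟ n) c

  mono-⊛ : ∀ w c v d n → (mono w c ⊛ mono v d) n ≡ mono (w ℕ.+ v) (c * d) n
  mono-⊛ zero c zero    d zero = refl
  mono-⊛ zero c (suc v) d zero = ℤ.*-zeroʳ c
  mono-⊛ zero c v d (suc n) = trans (cong₂ _+_ (scale v (suc n)) (⊛-zeroˡ (λ _ → refl) (mono v d) n)) (ℤ.+-identityʳ _)
    where
    scale : ∀ v n → c * mono v d n ≡ mono v (c * d) n
    scale v n with does (v ℕ.≟ n)
    ... | true  = refl
    ... | false = ℤ.*-zeroʳ c
  mono-⊛ (suc w) c v d zero    = refl
  mono-⊛ (suc w) c v d (suc n) = trans (ℤ.+-identityˡ _) (mono-⊛ w c v d n)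

  -- The coefficient of qⁿ in Σ f(x) q^{w(x)} over the list; concatenation becomes addition and
  -- cartesian product becomes `⊛`.
  gf : (A → ℕ) → (A → ℤ) → List A → Series
  gf w f xs n = sumOver (filter (λ x → w x ℕ.≟ n) xs) f

  gf-∷ : ∀ (w : A → ℕ) f x xs n → gf w f (x ∷ xs) n ≡ (mono (w x) (f x) ⊕ gf w f xs) n
  gf-∷ w f x xs n = sum-filter-∷ (λ x → w x ℕ.≟ n) x xs f

  gf-++ : ∀ (w : A → ℕ) f xs ys n → gf w f (xs ++ ys) n ≡ gf w f xs n + gf w f ys n
  gf-++ w f []       ys n = sym (ℤ.+-identityˡ _)
  gf-++ w f (x ∷ xs) ys n = begin
    gf w f (x ∷ xs ++ ys) n                            ≡⟨ gf-∷ w f x (xs ++ ys) n ⟩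
    mono (w x) (f x) n + gf w f (xs ++ ys) n           ≡⟨ cong (_+_ (mono (w x) (f x) n)) (gf-++ w f xs ys n) ⟩
    mono (w x) (f x) n + (gf w f xs n + gf w f ys n)   ≡⟨ ℤ.+-assoc (mono (w x) (f x) n) _ _ ⟨
    mono (w x) (f x) n + gf w f xs n + gf w f ys n     ≡⟨ cong (_+ gf w f ys n) (sym (gf-∷ w f x xs n)) ⟩
    gf w f (x ∷ xs) n + gf w f ys n                    ∎
    where open ≡-Reasoning

  module _ (_∙_ : A → B → C)
           {w : A → ℕ} {v : B → ℕ} {u : C → ℕ} (weight : ∀ x y → u (x ∙ y) ≡ w x ℕ.+ v y)
           {f : A → ℤ} {g : B → ℤ} {k : C → ℤ} (value : ∀ x y → k (x ∙ y) ≡ f x * g y) where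

    gf-map-∙ : ∀ x ys n → gf u k (map (x ∙_) ys) n ≡ (mono (w x) (f x) ⊛ gf v g ys) n
    gf-map-∙ x []       n = sym (trans (⊛-comm (mono (w x) (f x)) (gf v g []) n) (⊛-zeroˡ (λ _ → refl) (mono (w x) (f x)) n))
    gf-map-∙ x (y ∷ ys) n = begin
      gf u k (x ∙ y ∷ map (x ∙_) ys) n
        ≡⟨ gf-∷ u k (x ∙ y) (map (x ∙_) ys) n ⟩
      mono (u (x ∙ y)) (k (x ∙ y)) n + gf u k (map (x ∙_) ys) n
        ≡⟨ cong₂ _+_ (cong₂ (λ i j → mono i j n) (weight x y) (value x y)) (gf-map-∙ x ys n) ⟩
      mono (w x ℕ.+ v y) (f x * g y) n + (mono (w x) (f x) ⊛ gf v g ys) n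
        ≡⟨ cong (_+ (mono (w x) (f x) ⊛ gf v g ys) n) (sym (mono-⊛ (w x) (f x) (v y) (g y) n)) ⟩
      (mono (w x) (f x) ⊛ mono (v y) (g y)) n + (mono (w x) (f x) ⊛ gf v g ys) n
        ≡⟨ ⊛-distribˡ (mono (w x) (f x)) (mono (v y) (g y)) (gf v g ys) n ⟨
      (mono (w x) (f x) ⊛ (mono (v y) (g y) ⊕ gf v g ys)) n
        ≡⟨ ⊛-cong {mono (w x) (f x)} (λ _ → refl) (λ j → sym (gf-∷ v g y ys j)) n ⟩
      (mono (w x) (f x) ⊛ gf v g (y ∷ ys)) n ∎
      where open ≡-Reasoning

    gf-product : ∀ xs ys n → gf u k (cartesianProductWith _∙_ xs ys) n ≡ (gf w f xs ⊛ gf v g ys) n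
    gf-product []       ys n = sym (⊛-zeroˡ (λ _ → refl) (gf v g ys) n)
    gf-product (x ∷ xs) ys n = begin
      gf u k (map (x ∙_) ys ++ cartesianProductWith _∙_ xs ys) n
        ≡⟨ gf-++ u k (map (x ∙_) ys) (cartesianProductWith _∙_ xs ys) n ⟩
      gf u k (map (x ∙_) ys) n + gf u k (cartesianProductWith _∙_ xs ys) n
        ≡⟨ cong₂ _+_ (gf-map-∙ x ys n) (gf-product xs ys n) ⟩
      (mono (w x) (f x) ⊛ gf v g ys) n + (gf w f xs ⊛ gf v g ys) n
        ≡⟨ ⊛-distribʳ (mono (w x) (f x)) (gf w f xs) (gf v g ys) n ⟨
      ((mono (w x) (f x) ⊕ gf w f xs) ⊛ gf v g ys) n
        ≡⟨ ⊛-cong {g = gf v g ys} (λ j → sym (gf-∷ w f x xs j)) (λ _ → refl) n ⟩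
      (gf w f (x ∷ xs) ⊛ gf v g ys) n ∎
      where open ≡-Reasoning

  concatMap≡cartesianProductWith : ∀ (_∙_ : A → B → C) xs ys →
    concatMap (λ x → map (x ∙_) ys) xs ≡ cartesianProductWith _∙_ xs ys
  concatMap≡cartesianProductWith _∙_ []       ys = refl
  concatMap≡cartesianProductWith _∙_ (x ∷ xs) ys = cong (map (x ∙_) ys ++_) (concatMap≡cartesianProductWith _∙_ xs ys)

  weightSum : (A → ℕ) → ∀ {s} → Vec A s → ℕ
  weightSum w = Vec.foldr _ (λ x acc → w x ℕ.+ acc) 0

  gf-tuples : ∀ (w : A → ℕ) s xs n →
    gf (weightSum w) (λ _ → 1ℤ) (tuples s xs) n ≡ power (gf w (λ _ → 1ℤ) xs) s n
  gf-tuples w zero    xs zero    = refl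
  gf-tuples w zero    xs (suc n) = refl
  gf-tuples w (suc s) xs n = begin
    gf (weightSum w) (λ _ → 1ℤ) (tuples (suc s) xs) n
      ≡⟨ cong (λ l → gf (weightSum w) (λ _ → 1ℤ) l n) (concatMap≡cartesianProductWith _∷_ xs (tuples s xs)) ⟩
    gf (weightSum w) (λ _ → 1ℤ) (cartesianProductWith _∷_ xs (tuples s xs)) n
      ≡⟨ gf-product _∷_ {w} {weightSum w} (λ _ _ → refl) {λ _ → 1ℤ} {λ _ → 1ℤ} (λ _ _ → refl) xs (tuples s xs) n ⟩
    (gf w (λ _ → 1ℤ) xs ⊛ gf (weightSum w) (λ _ → 1ℤ) (tuples s xs)) n
      ≡⟨ ⊛-cong {gf w (λ _ → 1ℤ) xs} (λ _ → refl) (gf-tuples w s xs) n ⟩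
    power (gf w (λ _ → 1ℤ) xs) (suc s) n ∎
    where open ≡-Reasoning

  length-as-sum : ∀ (xs : List A) → + length xs ≡ sumOver xs (λ _ → 1ℤ)
  length-as-sum []       = refl
  length-as-sum (x ∷ xs) = cong (_+_ 1ℤ) (length-as-sum xs)

open PowerSeries

-- Parities, divisor sums, and Skoruppa's transformation of sums over ax + by = n.

module DivisorSums where

  open import Data.Integer using (_+_; _*_; _-_; -_)
  open +-*-Solver using (solve; _:+_; _:*_; _:-_; :-_; con; _:=_; Polynomial)
  open Enumerates

  private variable
    A B C : Set

  parityℕ : ℕ → ℤ
  parityℕ 0             = 0ℤ
  parityℕ 1             = 1ℤ
  parityℕ (suc (suc n)) = parityℕ n

  -- Parity is an integer 0 or 1, so that weights depending on parity are polynomials in it and,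
  -- after a case split on its value, come within reach of the ring solver. Addition of parities is
  -- s + t - 2st.
  o : ℤ → ℤ
  o i = parityℕ ℤ.∣ i ∣

  parityℕ-suc : ∀ n → parityℕ (suc n) ≡ 1ℤ - parityℕ n
  parityℕ-suc 0             = refl
  parityℕ-suc 1             = refl
  parityℕ-suc (suc (suc n)) = parityℕ-suc n

  o-suc : ∀ i → o (1ℤ + i) ≡ 1ℤ - o i
  o-suc (+ n)          = parityℕ-suc n
  o-suc -[1+ zero ]    = refl
  o-suc -[1+ suc n ]   = trans (solve 1 (λ p → p := con 1ℤ :- (con 1ℤ :- p)) refl (parityℕ (suc n))) (cong (_-_ 1ℤ) (sym (parityℕ-suc (suc n))))

  o-neg : ∀ i → o (- i) ≡ o i
  o-neg i = cong parityℕ (ℤ.∣-i∣≡∣i∣ i)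

  o-+ℕ : ∀ i n → o (+ n + i) ≡ o (+ n) + o i - + 2 * (o (+ n) * o i)
  o-+ℕ i zero    = trans (cong o (ℤ.+-identityˡ i)) (solve 1 (λ p → p := con 0ℤ :+ p :- con (+ 2) :* (con 0ℤ :* p)) refl (o i))
  o-+ℕ i (suc n) = begin
    o (+ suc n + i)                ≡⟨ cong o (ℤ.+-assoc 1ℤ (+ n) i) ⟩
    o (1ℤ + (+ n + i))             ≡⟨ o-suc (+ n + i) ⟩
    1ℤ - o (+ n + i)               ≡⟨ cong (_-_ 1ℤ) (o-+ℕ i n) ⟩
    1ℤ - (o (+ n) + o i - + 2 * (o (+ n) * o i))
      ≡⟨ solve 2 (λ p q → con 1ℤ :- (p :+ q :- con (+ 2) :* (p :* q)) := (con 1ℤ :- p) :+ q :- con (+ 2) :* ((con 1ℤ :- p) :* q)) refl (o (+ n)) (o i) ⟩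
    (1ℤ - o (+ n)) + o i - + 2 * ((1ℤ - o (+ n)) * o i)
      ≡⟨ cong (λ p → p + o i - + 2 * (p * o i)) (sym (o-suc (+ n))) ⟩
    o (+ suc n) + o i - + 2 * (o (+ suc n) * o i) ∎
    where open ≡-Reasoning

  o-+ : ∀ i j → o (i + j) ≡ o i + o j - + 2 * (o i * o j)
  o-+ (+ n)     j = o-+ℕ j n
  o-+ -[1+ n ]  j = begin
    o (-[1+ n ] + j)                                   ≡⟨ o-neg (-[1+ n ] + j) ⟨
    o (- (-[1+ n ] + j))                               ≡⟨ cong o (ℤ.neg-distrib-+ -[1+ n ] j) ⟩
    o (+ suc n + - j)                                  ≡⟨ o-+ℕ (- j) (suc n) ⟩
    o (+ suc n) + o (- j) - + 2 * (o (+ suc n) * o (- j)) ≡⟨ cong (λ q → o (+ suc n) + q - + 2 * (o (+ suc n) * q)) (o-neg j) ⟩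
    o (+ suc n) + o j - + 2 * (o (+ suc n) * o j) ∎
    where open ≡-Reasoning

  o-- : ∀ i j → o (i - j) ≡ o i + o j - + 2 * (o i * o j)
  o-- i j = trans (o-+ i (- j)) (cong (λ q → o i + q - + 2 * (o i * q)) (o-neg j))

  parityℕ-01 : ∀ n → parityℕ n ≡ 0ℤ ⊎ parityℕ n ≡ 1ℤ
  parityℕ-01 0             = inj₁ refl
  parityℕ-01 1             = inj₂ refl
  parityℕ-01 (suc (suc n)) = parityℕ-01 n

  o-01 : ∀ i → o i ≡ 0ℤ ⊎ o i ≡ 1ℤ
  o-01 i = parityℕ-01 ℤ.∣ i ∣

  Pos : ℤ → Set
  Pos i = 0ℤ ℤ.< i

  pos-+ : ∀ {i j} → Pos i → Pos j → Pos (i + j)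
  pos-+ = ℤ.+-mono-<

  pos-- : ∀ {i j} → j ℤ.< i → Pos (i - j)
  pos-- {i} {j} j<i = subst (ℤ._< i - j) (ℤ.+-inverseʳ j) (ℤ.+-monoˡ-< (- j) j<i)

  <-by : ∀ {i j k} → Pos k → j ≡ i + k → i ℤ.< j
  <-by {i} {j} {k} p refl = subst (ℤ._< i + k) (ℤ.+-identityʳ i) (ℤ.+-monoʳ-< i p)

  i-j+j≡i : ∀ i j → i - j + j ≡ i
  i-j+j≡i = solve 2 (λ i j → i :- j :+ j := i) refl

  i+j-i≡j : ∀ i j → i + j - i ≡ j
  i+j-i≡j = solve 2 (λ i j → i :+ j :- i := j) refl

  i+j-j≡i : ∀ i j → i + j - j ≡ i
  i+j-j≡i = solve 2 (λ i j → i :+ j :- j := i) refl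

  i+[j-i]≡j : ∀ i j → i + (j - i) ≡ j
  i+[j-i]≡j = solve 2 (λ i j → i :+ (j :- i) := j) refl

  posRange : ℕ → List ℤ
  posRange m = map (λ i → + suc i) (upTo m)

  enum-posRange : ∀ m → Enumerates (λ i → Pos i × i ℤ.≤ + m) (posRange m)
  enum-posRange m .unique = Unique.map⁺ (λ { refl → refl }) (Unique.upTo⁺ m)
  enum-posRange m .sound i∈ with ∈-map⁻ (λ i → + suc i) i∈
  ... | j , j∈ , refl = ℤ.+<+ (s≤s z≤n) , ℤ.+≤+ (∈-upTo⁻ j∈)
  enum-posRange m .complete {+ suc j} (_ , ℤ.+≤+ j≤m) = ∈-map⁺ (λ i → + suc i) (∈-upTo⁺ j≤m)
  enum-posRange m .complete {+ zero} (ℤ.+<+ () , _)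

  sum-upTo-suc : ∀ m (f : ℕ → ℤ) → sumOver (upTo (suc m)) f ≡ sumOver (upTo m) f + f m
  sum-upTo-suc m f = trans (cong (λ l → sumOver l f) (sym (upTo-∷ʳ m))) (snoc (upTo m))
    where
    snoc : ∀ ms → sumOver (ms ++ m ∷ []) f ≡ sumOver ms f + f m
    snoc []       = ℤ.+-comm (f m) 0ℤ
    snoc (k ∷ ms) = trans (cong (_+_ (f k)) (snoc ms)) (sym (ℤ.+-assoc (f k) _ _))

  -- `posRange m` is 1, ..., m. The boundary sums run over 1, ..., e-1 with e = m+1, so the upper
  -- value is Q(e) itself.
  telescope : ∀ {g : ℤ → ℤ} (Q : ℤ → ℤ) → (∀ i → g i ≡ Q (1ℤ + i) - Q i) →
    ∀ m → sumOver (posRange m) g ≡ Q (+ suc m) - Q 1ℤ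
  telescope {g} Q step m = trans (sum-map (λ i → + suc i) (upTo m) g) (go m)
    where
    go : ∀ m → sumOver (upTo m) (λ i → g (+ suc i)) ≡ Q (+ suc m) - Q 1ℤ
    go zero    = sym (ℤ.+-inverseʳ (Q 1ℤ))
    go (suc m) = trans (sum-upTo-suc m _) (trans (cong₂ _+_ (go m) (step (+ suc m)))
      (solve 3 (λ a b c → (b :- a) :+ (c :- b) := c :- a) refl (Q 1ℤ) (Q (+ suc m)) (Q (+ suc (suc m)))))

  trisect : ∀ (p q : A → ℤ) (xs : List A) f → sumOver xs f ≡
    sumOver (filter (λ x → p x ℤ.<? q x) xs) f + sumOver (filter (λ x → q x ℤ.<? p x) xs) f
      + sumOver (filter (λ x → p x ℤ.≟ q x) xs) f
  trisect {A} p q xs f = begin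
    sumOver xs f
      ≡⟨ sum-cong xs (λ {x} _ → pointwise x) ⟩
    sumOver xs (λ x → indicator (p x ℤ.<? q x) (f x) + indicator (q x ℤ.<? p x) (f x) + indicator (p x ℤ.≟ q x) (f x))
      ≡⟨ sum-+ xs _ _ ⟩
    sumOver xs (λ x → indicator (p x ℤ.<? q x) (f x) + indicator (q x ℤ.<? p x) (f x)) + sumOver xs (λ x → indicator (p x ℤ.≟ q x) (f x))
      ≡⟨ cong₂ _+_ (sum-+ xs _ _) (sym (sum-indicator _ xs f)) ⟩
    sumOver xs (λ x → indicator (p x ℤ.<? q x) (f x)) + sumOver xs (λ x → indicator (q x ℤ.<? p x) (f x)) + sumOver (filter (λ x → p x ℤ.≟ q x) xs) f
      ≡⟨ cong (_+ sumOver (filter (λ x → p x ℤ.≟ q x) xs) f) (cong₂ _+_ (sym (sum-indicator _ xs f)) (sym (sum-indicator _ xs f))) ⟩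
    _ ∎
    where
    open ≡-Reasoning
    pointwise : ∀ x → f x ≡ indicator (p x ℤ.<? q x) (f x) + indicator (q x ℤ.<? p x) (f x) + indicator (p x ℤ.≟ q x) (f x)
    pointwise x with ℤ.<-cmp (p x) (q x)
    ... | tri< lt ne gt rewrite dec-true (p x ℤ.<? q x) lt | dec-false (q x ℤ.<? p x) gt | dec-false (p x ℤ.≟ q x) ne =
          solve 1 (λ a → a := a :+ con 0ℤ :+ con 0ℤ) refl (f x)
    ... | tri≈ lt eq gt rewrite dec-false (p x ℤ.<? q x) lt | dec-false (q x ℤ.<? p x) gt | dec-true (p x ℤ.≟ q x) eq =
          sym (ℤ.+-identityˡ (f x))
    ... | tri> lt ne gt rewrite dec-false (p x ℤ.<? q x) lt | dec-true (q x ℤ.<? p x) gt | dec-false (p x ℤ.≟ q x) ne =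
          solve 1 (λ a → a := con 0ℤ :+ a :+ con 0ℤ) refl (f x)

  area : ℤ × ℤ → ℕ
  area (d , e) = ℤ.∣ d ∣ ℕ.* ℤ.∣ e ∣

  pairs : ℕ → List (ℤ × ℤ)
  pairs m = cartesianProduct (posRange m) (posRange m)

  divisorPairs : ℕ → List (ℤ × ℤ)
  divisorPairs n = filter (λ p → area p ℕ.≟ n) (pairs n)

  IsDivisorPair : ℕ → ℤ × ℤ → Set
  IsDivisorPair n (d , e) = Pos d × Pos e × d * e ≡ + n

  -- E f is the Lambert-type series Σ_{d,e ≥ 1} f(d,e) q^{de}.
  E : (ℤ → ℤ → ℤ) → Series
  E f n = sumOver (divisorPairs n) (λ (d , e) → f d e)

  area-pos : ∀ {d e} → Pos d → Pos e → + area (d , e) ≡ d * e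
  area-pos (ℤ.+<+ (s≤s _)) (ℤ.+<+ (s≤s _)) = refl

  pos-≤-product : ∀ {d e} → Pos d → Pos e → d ℤ.≤ d * e × e ℤ.≤ d * e
  pos-≤-product (ℤ.+<+ {n = suc d} (s≤s _)) (ℤ.+<+ {n = suc e} (s≤s _)) =
    ℤ.+≤+ (ℕ.m≤m*n (suc d) (suc e)) , ℤ.+≤+ (ℕ.m≤n*m (suc e) (suc d))

  enum-divisorPairs : ∀ {n m} → n ℕ.≤ m → Enumerates (IsDivisorPair n) (filter (λ p → area p ℕ.≟ n) (pairs m))
  enum-divisorPairs {n} {m} n≤m = enum-⇔
    (λ { (((d>0 , _) , (e>0 , _)) , eq) → d>0 , e>0 , trans (sym (area-pos d>0 e>0)) (cong +_ eq) })
    (λ { (d>0 , e>0 , eq) → ((d>0 , ℤ.≤-trans (ℤ.≤-trans (proj₁ (pos-≤-product d>0 e>0)) (ℤ.≤-reflexive eq)) (ℤ.+≤+ n≤m))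
                          , (e>0 , ℤ.≤-trans (ℤ.≤-trans (proj₂ (pos-≤-product d>0 e>0)) (ℤ.≤-reflexive eq)) (ℤ.+≤+ n≤m)))
                          , ℤ.+-injective (trans (area-pos d>0 e>0) eq) })
    (enum-filter (enum-× (enum-posRange m) (enum-posRange m)) (λ p → area p ℕ.≟ n))

  -- `E f n` draws its pairs from a box that grows with `n`; a convolution needs all coefficients up
  -- to its index from one common box.
  E-box : ∀ f {n m} → n ℕ.≤ m → E f n ≡ gf area (λ (d , e) → f d e) (pairs m) n
  E-box f n≤m = sum-enum (enum-divisorPairs ℕ.≤-refl) (enum-divisorPairs n≤m) (λ _ → refl)

  E-cong : ∀ {f g} → (∀ {d e} → Pos d → Pos e → f d e ≡ g d e) → ∀ n → E f n ≡ E g n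
  E-cong eq n = sum-cong (divisorPairs n)
    (λ m → let d>0 , e>0 , _ = enum-divisorPairs {n} ℕ.≤-refl .sound m in eq d>0 e>0)

  E-+ : ∀ f g n → E (λ d e → f d e + g d e) n ≡ E f n + E g n
  E-+ f g n = sum-+ (divisorPairs n) _ _

  E-* : ∀ c f n → E (λ d e → c * f d e) n ≡ c * E f n
  E-* c f n = sum-* (divisorPairs n) c _

  E-sub : ∀ f g n → E f n - E g n ≡ E (λ d e → f d e - g d e) n
  E-sub f g n = sym (trans (E-+ f (λ d e → - g d e) n) (cong (_+_ (E f n)) (sum-neg (divisorPairs n) _)))

  E-D : ∀ f n → E (λ d e → d * e * f d e) n ≡ D (E f) n
  E-D f n = trans (sum-cong (divisorPairs n)
    (λ {(d , e)} m → let _ , _ , eq = enum-divisorPairs {n} ℕ.≤-refl .sound m in cong (_* f d e) eq))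
    (sum-* (divisorPairs n) (+ n) _)

  Quad : Set
  Quad = (ℤ × ℤ) × (ℤ × ℤ)

  quads : ℕ → List Quad
  quads n = filter (λ (p , q) → area p ℕ.+ area q ℕ.≟ n) (cartesianProduct (pairs n) (pairs n))

  IsQuad : ℕ → Quad → Set
  IsQuad n ((a , x) , (b , y)) = Pos a × Pos x × Pos b × Pos y × a * x + b * y ≡ + n

  enum-quads : ∀ n → Enumerates (IsQuad n) (quads n)
  enum-quads n = enum-⇔
    (λ { ((((a>0 , _) , (x>0 , _)) , ((b>0 , _) , (y>0 , _))) , eq) →
         a>0 , x>0 , b>0 , y>0 , trans (sym (total a>0 x>0 b>0 y>0)) (cong +_ eq) })
    (λ { {(a , x) , (b , y)} (a>0 , x>0 , b>0 , y>0 , eq) →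
         let sum≡n = ℤ.+-injective (trans (total a>0 x>0 b>0 y>0) eq)
             ax≤n = subst (ℤ._≤ + n) (area-pos a>0 x>0) (ℤ.+≤+ (subst (area (a , x) ℕ.≤_) sum≡n (ℕ.m≤m+n (area (a , x)) (area (b , y)))))
             by≤n = subst (ℤ._≤ + n) (area-pos b>0 y>0) (ℤ.+≤+ (subst (area (b , y) ℕ.≤_) sum≡n (ℕ.m≤n+m (area (b , y)) (area (a , x)))))
         in (((a>0 , ℤ.≤-trans (proj₁ (pos-≤-product a>0 x>0)) ax≤n) , (x>0 , ℤ.≤-trans (proj₂ (pos-≤-product a>0 x>0)) ax≤n))
          , ((b>0 , ℤ.≤-trans (proj₁ (pos-≤-product b>0 y>0)) by≤n) , (y>0 , ℤ.≤-trans (proj₂ (pos-≤-product b>0 y>0)) by≤n)))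
          , sum≡n })
    (enum-filter (enum-× (enum-× (enum-posRange n) (enum-posRange n)) (enum-× (enum-posRange n) (enum-posRange n)))
       (λ (p , q) → area p ℕ.+ area q ℕ.≟ n))
    where
    total : ∀ {a x b y} → Pos a → Pos x → Pos b → Pos y → + (area (a , x) ℕ.+ area (b , y)) ≡ a * x + b * y
    total {a} {x} {b} {y} a>0 x>0 b>0 y>0 = trans (ℤ.pos-+ (area (a , x)) (area (b , y))) (cong₂ _+_ (area-pos a>0 x>0) (area-pos b>0 y>0))

  E-⊛ : ∀ f g n → (E f ⊛ E g) n ≡ sumOver (quads n) (λ ((a , x) , (b , y)) → f a x * g b y)
  E-⊛ f g n = trans (⊛-cong-≤ n (E-box f) (E-box g))
    (sym (gf-product _,_ {area} {area} (λ _ _ → refl) {λ (a , x) → f a x} {λ (b , y) → g b y} (λ _ _ → refl) (pairs n) (pairs n) n))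

  _≟²_ : DecidableEquality (ℤ × ℤ)
  _≟²_ = ≡-dec ℤ._≟_ ℤ._≟_

  -- For a = b the equation reads a(x+y) = n, so the diagonal fibres over the divisor pairs (d , e)
  -- = (a , x+y), with x running over 1, ..., e-1.
  diagonal-ab : ∀ (F : Quad → ℤ) n → sumOver (filter (λ ((a , x) , (b , y)) → b ℤ.≟ a) (quads n)) F ≡
    sumOver (divisorPairs n) (λ (d , e) → sumOver (posRange (ℤ.∣ e ∣ ℕ.∸ 1)) (λ x → F ((d , x) , (d , e - x))))
  diagonal-ab F n = trans
    (sum-fibre _≟²_ π (enum-divisorPairs {n} ℕ.≤-refl .unique) diag
      (λ m → enum-divisorPairs {n} ℕ.≤-refl .complete (π-sound (enum-diag .sound m))) F)
    (sum-cong (divisorPairs n) (λ m → fibre (enum-divisorPairs {n} ℕ.≤-refl .sound m)))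
    where
    diag : List Quad
    diag = filter (λ ((a , x) , (b , y)) → b ℤ.≟ a) (quads n)
    enum-diag : Enumerates (λ q@((a , x) , (b , y)) → IsQuad n q × b ≡ a) diag
    enum-diag = enum-filter (enum-quads n) _
    π : Quad → ℤ × ℤ
    π ((a , x) , (b , y)) = a , x + y
    π-sound : ∀ {q} → IsQuad n q × (proj₁ (proj₂ q) ≡ proj₁ (proj₁ q)) → IsDivisorPair n (π q)
    π-sound {(a , x) , (.a , y)} ((a>0 , x>0 , _ , y>0 , eq) , refl) = a>0 , pos-+ x>0 y>0 , trans (ℤ.*-distribˡ-+ a x y) eq
    fibre : ∀ {p} → IsDivisorPair n p → sumOver (filter (λ q → π q ≟² p) diag) F ≡
      sumOver (posRange (ℤ.∣ proj₂ p ∣ ℕ.∸ 1)) (λ x → F ((proj₁ p , x) , (proj₁ p , proj₂ p - x)))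
    fibre {d , + zero} (_ , ℤ.+<+ () , _)
    fibre {d , + suc m} (d>0 , e>0 , eq) = sum-bij (enum-filter enum-diag _) (enum-posRange m)
      (λ ((a , x) , (b , y)) → x)
      (λ x → (d , x) , (d , + suc m - x))
      (λ { {(a , x) , (b , y)} (((a>0 , x>0 , b>0 , y>0 , _) , _) , π≡) →
           x>0 , ℤ.i<j⇒i≤pred[j] (<-by y>0 (sym (cong proj₂ π≡))) })
      (λ { {x} (x>0 , x≤m) → ((d>0 , x>0 , d>0 , pos-- {+ suc m} (ℤ.i≤pred[j]⇒i<j x≤m) ,
           trans (solve 3 (λ d x e → d :* x :+ d :* (e :- x) := d :* e) refl d x (+ suc m)) eq) , refl) ,
           cong (d ,_) (i+[j-i]≡j x (+ suc m)) })
      (λ { {(a , x) , (.a , y)} ((_ , refl) , π≡) → recover a x y π≡ })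
      (λ _ → refl)
      (λ { {(a , x) , (.a , y)} ((_ , refl) , π≡) → cong F (sym (recover a x y π≡)) })
      where
      recover : ∀ a x y → (a , x + y) ≡ (d , + suc m) → ((d , x) , (d , + suc m - x)) ≡ ((a , x) , (a , y))
      recover a x y π≡ = cong₂ (λ i j → (i , x) , (i , j)) (sym (cong proj₁ π≡))
        (trans (cong (_- x) (sym (cong proj₂ π≡))) (i+j-i≡j x y))

  transpose-quad : Quad → Quad
  transpose-quad ((a , x) , (b , y)) = (x , a) , (y , b)

  diagonal-xy : ∀ (F : Quad → ℤ) n → sumOver (filter (λ ((a , x) , (b , y)) → x ℤ.≟ y) (quads n)) F ≡
    sumOver (divisorPairs n) (λ (d , e) → sumOver (posRange (ℤ.∣ d ∣ ℕ.∸ 1)) (λ a → F ((a , e) , (d - a , e))))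
  diagonal-xy F n = begin
    sumOver (filter (λ ((a , x) , (b , y)) → x ℤ.≟ y) (quads n)) F
      ≡⟨ sum-bij (enum-filter (enum-quads n) _) (enum-filter (enum-quads n) _) transpose-quad transpose-quad
           (λ (q , eq) → flip q , sym eq) (λ (q , eq) → flip q , sym eq) (λ _ → refl) (λ _ → refl) (λ _ → refl) ⟩
    sumOver (filter (λ ((a , x) , (b , y)) → b ℤ.≟ a) (quads n)) (F ∘ transpose-quad)
      ≡⟨ diagonal-ab (F ∘ transpose-quad) n ⟩
    sumOver (divisorPairs n) (λ (d , e) → sumOver (posRange (ℤ.∣ e ∣ ℕ.∸ 1)) (λ x → F ((x , d) , (e - x , d))))
      ≡⟨ sum-bij (enum-divisorPairs {n} ℕ.≤-refl) (enum-divisorPairs {n} ℕ.≤-refl) (λ (d , e) → e , d) (λ (d , e) → e , d)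
           flip² flip² (λ _ → refl) (λ _ → refl) (λ _ → refl) ⟩
    sumOver (divisorPairs n) (λ (d , e) → sumOver (posRange (ℤ.∣ d ∣ ℕ.∸ 1)) (λ a → F ((a , e) , (d - a , e)))) ∎
    where
    open ≡-Reasoning
    flip : ∀ {q} → IsQuad n q → IsQuad n (transpose-quad q)
    flip {(a , x) , (b , y)} (a>0 , x>0 , b>0 , y>0 , eq) = x>0 , a>0 , y>0 , b>0 , trans (cong₂ _+_ (ℤ.*-comm x a) (ℤ.*-comm y b)) eq
    flip² : ∀ {p} → IsDivisorPair n p → IsDivisorPair n (proj₂ p , proj₁ p)
    flip² {d , e} (d>0 , e>0 , eq) = e>0 , d>0 , trans (ℤ.*-comm e d) eq

  module Convolution (h k : ℤ → ℤ → ℤ → ℤ → ℤ)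
    (h-left  : ∀ a b x y → h a b x y ≡ k (a - b) b x (x + y))
    (h-right : ∀ a b x y → h a b x y ≡ k a (b - a) (x + y) y) where

    hᵠ kᵠ : Quad → ℤ
    hᵠ ((a , x) , (b , y)) = h a b x y
    kᵠ ((a , x) , (b , y)) = k a b x y

    lower : ∀ n → sumOver (filter (λ ((a , x) , (b , y)) → b ℤ.<? a) (quads n)) hᵠ
                ≡ sumOver (filter (λ ((a , x) , (b , y)) → x ℤ.<? y) (quads n)) kᵠ
    lower n = sum-bij (enum-filter (enum-quads n) _) (enum-filter (enum-quads n) _)
      (λ ((a , x) , (b , y)) → (a - b , x) , (b , x + y))
      (λ ((a , x) , (b , y)) → (a + b , x) , (b , y - x))
      (λ { {(a , x) , (b , y)} ((a>0 , x>0 , b>0 , y>0 , eq) , b<a) →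
           (pos-- b<a , x>0 , b>0 , pos-+ x>0 y>0 ,
            trans (solve 4 (λ a b x y → (a :- b) :* x :+ b :* (x :+ y) := a :* x :+ b :* y) refl a b x y) eq) , <-by y>0 refl })
      (λ { {(a , x) , (b , y)} ((a>0 , x>0 , b>0 , y>0 , eq) , x<y) →
           (pos-+ a>0 b>0 , x>0 , b>0 , pos-- x<y ,
            trans (solve 4 (λ a b x y → (a :+ b) :* x :+ b :* (y :- x) := a :* x :+ b :* y) refl a b x y) eq) , <-by a>0 (ℤ.+-comm a b) })
      (λ { {(a , x) , (b , y)} _ → cong₂ (λ i j → (i , x) , (b , j)) (i-j+j≡i a b) (i+j-i≡j x y) })
      (λ { {(a , x) , (b , y)} _ → cong₂ (λ i j → (i , x) , (b , j)) (i+j-j≡i a b) (i+[j-i]≡j x y) })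
      (λ { {(a , x) , (b , y)} _ → h-left a b x y })


    upper : ∀ n → sumOver (filter (λ ((a , x) , (b , y)) → a ℤ.<? b) (quads n)) hᵠ
                ≡ sumOver (filter (λ ((a , x) , (b , y)) → y ℤ.<? x) (quads n)) kᵠ
    upper n = sum-bij (enum-filter (enum-quads n) _) (enum-filter (enum-quads n) _)
      (λ ((a , x) , (b , y)) → (a , x + y) , (b - a , y))
      (λ ((a , x) , (b , y)) → (a , x - y) , (a + b , y))
      (λ { {(a , x) , (b , y)} ((a>0 , x>0 , b>0 , y>0 , eq) , a<b) →
           (a>0 , pos-+ x>0 y>0 , pos-- a<b , y>0 ,
            trans (solve 4 (λ a b x y → a :* (x :+ y) :+ (b :- a) :* y := a :* x :+ b :* y) refl a b x y) eq) , <-by x>0 (ℤ.+-comm x y) })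
      (λ { {(a , x) , (b , y)} ((a>0 , x>0 , b>0 , y>0 , eq) , y<x) →
           (a>0 , pos-- y<x , pos-+ a>0 b>0 , y>0 ,
            trans (solve 4 (λ a b x y → a :* (x :- y) :+ (a :+ b) :* y := a :* x :+ b :* y) refl a b x y) eq) , <-by b>0 refl })
      (λ { {(a , x) , (b , y)} _ → cong₂ (λ i j → (a , i) , (j , y)) (i+j-j≡i x y) (i+[j-i]≡j a b) })
      (λ { {(a , x) , (b , y)} _ → cong₂ (λ i j → (a , i) , (j , y)) (i-j+j≡i x y) (i+j-i≡j a b) })
      (λ { {(a , x) , (b , y)} _ → h-right a b x y })

    -- The two substitutions carry b < a onto x < y and a < b onto y < x, turning h into k. Thus the
    -- sums of h and k agree off the diagonals, and what survives is h on a = b and k on x = y, both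
    -- ordinary divisor sums.
    convolution : ∀ {u v : ℤ → ℤ → ℤ} →
      (∀ d m → sumOver (posRange m) (λ x → h d d x (+ suc m - x)) ≡ u d (+ suc m)) →
      (∀ m e → sumOver (posRange m) (λ a → k a (+ suc m - a) e e) ≡ v (+ suc m) e) →
      ∀ n → sumOver (quads n) (λ q → hᵠ q - kᵠ q) ≡ E u n - E v n
    convolution {u} {v} u-sum v-sum n = begin
      sumOver (quads n) (λ q → hᵠ q - kᵠ q)
        ≡⟨ sum-+ (quads n) hᵠ (λ q → - kᵠ q) ⟩
      sumOver (quads n) hᵠ + sumOver (quads n) (λ q → - kᵠ q)
        ≡⟨ cong (_+_ (sumOver (quads n) hᵠ)) (sum-neg (quads n) kᵠ) ⟩
      sumOver (quads n) hᵠ - sumOver (quads n) kᵠ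
        ≡⟨ cong₂ _-_ (trisect (λ ((a , x) , (b , y)) → b) (λ ((a , x) , (b , y)) → a) (quads n) hᵠ)
                     (trisect (λ ((a , x) , (b , y)) → x) (λ ((a , x) , (b , y)) → y) (quads n) kᵠ) ⟩
      (h₁ + h₂ + hᵈ) - (k₁ + k₂ + kᵈ)
        ≡⟨ cong₂ (λ i j → (i + j + hᵈ) - (k₁ + k₂ + kᵈ)) (lower n) (upper n) ⟩
      (k₁ + k₂ + hᵈ) - (k₁ + k₂ + kᵈ)
        ≡⟨ solve 4 (λ i j c d → (i :+ j :+ c) :- (i :+ j :+ d) := c :- d) refl k₁ k₂ hᵈ kᵈ ⟩
      hᵈ - kᵈ
        ≡⟨ cong₂ _-_ h-diagonal k-diagonal ⟩
      E u n - E v n ∎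
      where
      open ≡-Reasoning
      h₁ h₂ k₁ k₂ hᵈ kᵈ : ℤ
      h₁ = sumOver (filter (λ ((a , x) , (b , y)) → b ℤ.<? a) (quads n)) hᵠ
      h₂ = sumOver (filter (λ ((a , x) , (b , y)) → a ℤ.<? b) (quads n)) hᵠ
      k₁ = sumOver (filter (λ ((a , x) , (b , y)) → x ℤ.<? y) (quads n)) kᵠ
      k₂ = sumOver (filter (λ ((a , x) , (b , y)) → y ℤ.<? x) (quads n)) kᵠ
      hᵈ = sumOver (filter (λ ((a , x) , (b , y)) → b ℤ.≟ a) (quads n)) hᵠ
      kᵈ = sumOver (filter (λ ((a , x) , (b , y)) → x ℤ.≟ y) (quads n)) kᵠ
      u-at : ∀ {d e} → IsDivisorPair n (d , e) → sumOver (posRange (ℤ.∣ e ∣ ℕ.∸ 1)) (λ x → h d d x (e - x)) ≡ u d e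
      u-at {d} {+ suc m} _ = u-sum d m
      u-at {d} {+ zero} (_ , ℤ.+<+ () , _)
      v-at : ∀ {d e} → IsDivisorPair n (d , e) → sumOver (posRange (ℤ.∣ d ∣ ℕ.∸ 1)) (λ a → k a (d - a) e e) ≡ v d e
      v-at {+ suc m} {e} _ = v-sum m e
      v-at {+ zero} (ℤ.+<+ () , _)
      h-diagonal : hᵈ ≡ E u n
      h-diagonal = trans (diagonal-ab hᵠ n) (sum-cong (divisorPairs n) (λ m → u-at (enum-divisorPairs {n} ℕ.≤-refl .sound m)))
      k-diagonal : kᵈ ≡ E v n
      k-diagonal = trans (diagonal-xy kᵠ n) (sum-cong (divisorPairs n) (λ m → v-at (enum-divisorPairs {n} ℕ.≤-refl .sound m)))

open DivisorSums

-- Quadratic identities between divisor sums: first-order equations for the cubic sums, and the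
-- convolution of cubes.

module EisensteinIdentities where

  open import Data.Integer using (_+_; _*_; _-_; -_)
  open +-*-Solver using (solve; _:+_; _:*_; _:-_; :-_; con; _:=_; Polynomial)
  open Enumerates

  -- The weights depend on the parities of x and y only, and the three odd classes of (x , y) are
  -- permuted by the substitutions of Convolution; p is the polynomial attached to the class (1 , 1).
  module LevelTwo (α β γ κ : ℤ) (κ-eq : β - + 2 * α + + 2 * γ ≡ + 2 * κ) where

    p : ℤ → ℤ → ℤ
    p a b = α * (a * b * (a * a + b * b)) + β * (a * a * (b * b)) + γ * (a * a * (a * a) + b * b * (b * b))

    k′ : ℤ → ℤ → ℤ → ℤ → ℤ
    k′ s t a b = s * t * p a b + (1ℤ - s) * t * p a (- (a + b)) + s * (1ℤ - t) * p b (- (a + b))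

    k h : ℤ → ℤ → ℤ → ℤ → ℤ
    k a b x y = k′ (o x) (o y) a b
    h a b x y = k (a - b) b x (x + y)

    private
      P : ∀ {n} → (α β γ a b : Polynomial n) → Polynomial n
      P α β γ a b = α :* (a :* b :* (a :* a :+ b :* b)) :+ β :* (a :* a :* (b :* b)) :+ γ :* (a :* a :* (a :* a) :+ b :* b :* (b :* b))

      K′ : ∀ {n} → (α β γ s t a b : Polynomial n) → Polynomial n
      K′ α β γ s t a b = s :* t :* P α β γ a b :+ (con 1ℤ :- s) :* t :* P α β γ a (:- (a :+ b))
        :+ s :* (con 1ℤ :- t) :* P α β γ b (:- (a :+ b))

      xor : ∀ {n} → Polynomial n → Polynomial n → Polynomial n
      xor s t = s :+ t :- con (+ 2) :* (s :* t)

    -- The three odd classes carry `p` evaluated at two of the three linear forms a, b, -(a+b). Both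
    -- substitutions permute these forms up to sign, and `p` is symmetric and of even degree. The
    -- proof splits on the parities since s² = s holds only for their values.
    k′-right : ∀ {s t} → s ≡ 0ℤ ⊎ s ≡ 1ℤ → t ≡ 0ℤ ⊎ t ≡ 1ℤ → ∀ a b →
      k′ s (s + t - + 2 * (s * t)) (a - b) b ≡ k′ (s + t - + 2 * (s * t)) t a (b - a)
    k′-right (inj₁ refl) (inj₁ refl) = solve 5 (λ α β γ a b → let s = con 0ℤ; t = con 0ℤ in
      K′ α β γ s (xor s t) (a :- b) b := K′ α β γ (xor s t) t a (b :- a)) refl α β γ
    k′-right (inj₁ refl) (inj₂ refl) = solve 5 (λ α β γ a b → let s = con 0ℤ; t = con 1ℤ in
      K′ α β γ s (xor s t) (a :- b) b := K′ α β γ (xor s t) t a (b :- a)) refl α β γ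
    k′-right (inj₂ refl) (inj₁ refl) = solve 5 (λ α β γ a b → let s = con 1ℤ; t = con 0ℤ in
      K′ α β γ s (xor s t) (a :- b) b := K′ α β γ (xor s t) t a (b :- a)) refl α β γ
    k′-right (inj₂ refl) (inj₂ refl) = solve 5 (λ α β γ a b → let s = con 1ℤ; t = con 1ℤ in
      K′ α β γ s (xor s t) (a :- b) b := K′ α β γ (xor s t) t a (b :- a)) refl α β γ

    h-right : ∀ a b x y → h a b x y ≡ k a (b - a) (x + y) y
    h-right a b x y rewrite o-+ x y = k′-right (o-01 x) (o-01 y) a b

    -- In every parity class h(a,b) = k(a,-b), so h - k is minus twice the part of k odd in b. In
    -- degree four only a³b and ab³ are left, that is, products of a linear and a cubic divisor sum.
    difference : ℤ → ℤ → ℤ → ℤ → ℤ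
    difference s t a b = s * t * (- + 2 * α * (a * a * a * b + a * (b * b * b)))
      + (1ℤ - s) * t * ((+ 8 * α - + 4 * β - + 8 * γ) * (a * a * a * b) + (+ 2 * α - + 8 * γ) * (a * (b * b * b)))
      + s * (1ℤ - t) * ((+ 8 * α - + 4 * β - + 8 * γ) * (a * (b * b * b)) + (+ 2 * α - + 8 * γ) * (a * a * a * b))

    private
      Diff : ∀ {n} → (α β γ s t a b : Polynomial n) → Polynomial n
      Diff α β γ s t a b = s :* t :* (:- con (+ 2) :* α :* (a :* a :* a :* b :+ a :* (b :* b :* b)))
        :+ (con 1ℤ :- s) :* t :* ((con (+ 8) :* α :- con (+ 4) :* β :- con (+ 8) :* γ) :* (a :* a :* a :* b) :+ (con (+ 2) :* α :- con (+ 8) :* γ) :* (a :* (b :* b :* b)))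
        :+ s :* (con 1ℤ :- t) :* ((con (+ 8) :* α :- con (+ 4) :* β :- con (+ 8) :* γ) :* (a :* (b :* b :* b)) :+ (con (+ 2) :* α :- con (+ 8) :* γ) :* (a :* a :* a :* b))

    k′-difference : ∀ {s t} → s ≡ 0ℤ ⊎ s ≡ 1ℤ → t ≡ 0ℤ ⊎ t ≡ 1ℤ → ∀ a b →
      k′ s (s + t - + 2 * (s * t)) (a - b) b - k′ s t a b ≡ difference s t a b
    k′-difference (inj₁ refl) (inj₁ refl) = solve 5 (λ α β γ a b → let s = con 0ℤ; t = con 0ℤ in
      K′ α β γ s (xor s t) (a :- b) b :- K′ α β γ s t a b := Diff α β γ s t a b) refl α β γ
    k′-difference (inj₁ refl) (inj₂ refl) = solve 5 (λ α β γ a b → let s = con 0ℤ; t = con 1ℤ in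
      K′ α β γ s (xor s t) (a :- b) b :- K′ α β γ s t a b := Diff α β γ s t a b) refl α β γ
    k′-difference (inj₂ refl) (inj₁ refl) = solve 5 (λ α β γ a b → let s = con 1ℤ; t = con 0ℤ in
      K′ α β γ s (xor s t) (a :- b) b :- K′ α β γ s t a b := Diff α β γ s t a b) refl α β γ
    k′-difference (inj₂ refl) (inj₂ refl) = solve 5 (λ α β γ a b → let s = con 1ℤ; t = con 1ℤ in
      K′ α β γ s (xor s t) (a :- b) b :- K′ α β γ s t a b := Diff α β γ s t a b) refl α β γ

    h-k : ∀ a b x y → h a b x y - k a b x y ≡ difference (o x) (o y) a b
    h-k a b x y rewrite o-+ x y = k′-difference (o-01 x) (o-01 y) a b

    -- On a = b = d the weight is k(0 , d , x , e) with e = x + y. For odd e it is γd⁴ at each of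
    -- the e-1 values of x. For even e only the e/2 odd values of x count, each with p(d,-d) = (β -
    -- 2α + 2γ)d⁴ = 2κd⁴.
    u : ℤ → ℤ → ℤ
    u d e = o e * γ * (d * d * (d * d)) * (e - 1ℤ) + (1ℤ - o e) * κ * (d * d * (d * d)) * e

    k′-zero : ∀ s t d → k′ s t (d - d) d ≡ t * γ * (d * d * (d * d)) + s * (1ℤ - t) * (+ 2 * κ) * (d * d * (d * d))
    k′-zero s t d = trans
      (solve 6 (λ α β γ s t d → K′ α β γ s t (d :- d) d := t :* γ :* (d :* d :* (d :* d))
        :+ s :* (con 1ℤ :- t) :* (β :- con (+ 2) :* α :+ con (+ 2) :* γ) :* (d :* d :* (d :* d))) refl α β γ s t d)
      (cong (λ c → t * γ * (d * d * (d * d)) + s * (1ℤ - t) * c * (d * d * (d * d))) κ-eq)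

    u-sum : ∀ d m → sumOver (posRange m) (λ x → h d d x (+ suc m - x)) ≡ u d (+ suc m)
    u-sum d m = trans (telescope Q step m) (evaluate (o-01 e) (d * d * (d * d)))
      where
      e = + suc m
      Q : ℤ → ℤ
      -- `x - o x` grows by 2 at odd x and not at all at even x: it counts odd x twice, which
      -- absorbs the 2 in 2κ without a division.
      Q x = o e * γ * (d * d * (d * d)) * x + (1ℤ - o e) * κ * (d * d * (d * d)) * (x - o x)
      step : ∀ x → h d d x (e - x) ≡ Q (1ℤ + x) - Q x
      step x rewrite i+[j-i]≡j x e | o-suc x = trans (k′-zero (o x) (o e) d)
        (solve 6 (λ γ κ s t D x → t :* γ :* D :+ s :* (con 1ℤ :- t) :* (con (+ 2) :* κ) :* D
          := (t :* γ :* D :* (con 1ℤ :+ x) :+ (con 1ℤ :- t) :* κ :* D :* (con 1ℤ :+ x :- (con 1ℤ :- s)))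
             :- (t :* γ :* D :* x :+ (con 1ℤ :- t) :* κ :* D :* (x :- s))) refl γ κ (o x) (o e) (d * d * (d * d)) x)
      evaluate : ∀ {t} → t ≡ 0ℤ ⊎ t ≡ 1ℤ → ∀ D →
        (t * γ * D * e + (1ℤ - t) * κ * D * (e - t)) - (t * γ * D * 1ℤ + (1ℤ - t) * κ * D * (1ℤ - 1ℤ))
          ≡ t * γ * D * (e - 1ℤ) + (1ℤ - t) * κ * D * e
      evaluate (inj₁ refl) D = solve 4 (λ γ κ D e → let t = con 0ℤ in
        (t :* γ :* D :* e :+ (con 1ℤ :- t) :* κ :* D :* (e :- t)) :- (t :* γ :* D :* con 1ℤ :+ (con 1ℤ :- t) :* κ :* D :* (con 1ℤ :- con 1ℤ))
          := t :* γ :* D :* (e :- con 1ℤ) :+ (con 1ℤ :- t) :* κ :* D :* e) refl γ κ D e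
      evaluate (inj₂ refl) D = solve 4 (λ γ κ D e → let t = con 1ℤ in
        (t :* γ :* D :* e :+ (con 1ℤ :- t) :* κ :* D :* (e :- t)) :- (t :* γ :* D :* con 1ℤ :+ (con 1ℤ :- t) :* κ :* D :* (con 1ℤ :- con 1ℤ))
          := t :* γ :* D :* (e :- con 1ℤ) :+ (con 1ℤ :- t) :* κ :* D :* e) refl γ κ D e

    module _ (Q : ℤ → ℤ → ℤ) (Q-step : ∀ s a → p a (s - a) ≡ Q s (1ℤ + a) - Q s a) where

      v : ℤ → ℤ → ℤ
      v d e = o e * (Q d d - Q d 1ℤ)

      v-sum : ∀ m e → sumOver (posRange m) (λ a → k a (+ suc m - a) e e) ≡ v (+ suc m) e
      v-sum m e = trans (telescope (λ a → o e * Q d a) step m)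
        (solve 3 (λ t q r → t :* q :- t :* r := t :* (q :- r)) refl (o e) (Q d d) (Q d 1ℤ))
        where
        d = + suc m
        diagonal : ∀ {t} → t ≡ 0ℤ ⊎ t ≡ 1ℤ → ∀ i j l → t * t * i + (1ℤ - t) * t * j + t * (1ℤ - t) * l ≡ t * i
        diagonal (inj₁ refl) i j l = refl
        diagonal (inj₂ refl) = solve 3 (λ i j l → con 1ℤ :* con 1ℤ :* i :+ (con 1ℤ :- con 1ℤ) :* con 1ℤ :* j :+ con 1ℤ :* (con 1ℤ :- con 1ℤ) :* l := con 1ℤ :* i) refl
        step : ∀ a → k a (d - a) e e ≡ o e * Q d (1ℤ + a) - o e * Q d a
        step a = trans (diagonal (o-01 e) (p a (d - a)) (p a (- (a + (d - a)))) (p (d - a) (- (a + (d - a))))) (trans (cong (o e *_) (Q-step d a))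
          (solve 3 (λ t q r → t :* (q :- r) := t :* q :- t :* r) refl (o e) (Q d (1ℤ + a)) (Q d a)))

      identity : ∀ n → sumOver (quads n) (λ ((a , x) , (b , y)) → difference (o x) (o y) a b) ≡ E u n - E v n
      identity n = trans (sum-cong (quads n) (λ { {(a , x) , (b , y)} _ → sym (h-k a b x y) }))
        (Convolution.convolution h k (λ _ _ _ _ → refl) h-right u-sum v-sum n)

  -- The values of `difference` are symmetric in (a,x) and (b,y), so they match the symmetrised
  -- product, which counts the convolution twice.
  sym-⊛ : ∀ c f g n → + 2 * c * (E f ⊛ E g) n ≡ sumOver (quads n) (λ ((a , x) , (b , y)) → c * (f a x * g b y + g a x * f b y))
  sym-⊛ c f g n = sym (begin
    sumOver (quads n) (λ ((a , x) , (b , y)) → c * (f a x * g b y + g a x * f b y))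
      ≡⟨ sum-* (quads n) c _ ⟩
    c * sumOver (quads n) (λ ((a , x) , (b , y)) → f a x * g b y + g a x * f b y)
      ≡⟨ cong (c *_) (sum-+ (quads n) _ _) ⟩
    c * (sumOver (quads n) (λ ((a , x) , (b , y)) → f a x * g b y) + sumOver (quads n) (λ ((a , x) , (b , y)) → g a x * f b y))
      ≡⟨ cong (c *_) (cong₂ _+_ (sym (E-⊛ f g n)) (trans (sym (E-⊛ g f n)) (⊛-comm (E g) (E f) n))) ⟩
    c * ((E f ⊛ E g) n + (E f ⊛ E g) n)
      ≡⟨ solve 2 (λ c z → c :* (z :+ z) := con (+ 2) :* c :* z) refl c ((E f ⊛ E g) n) ⟩
    + 2 * c * (E f ⊛ E g) n ∎)
    where open ≡-Reasoning

  cube : ℤ → ℤ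
  cube d = d * d * d

  -- The starred weights are 1 - 2^(s+1)[e even] times d^s. Moving a factor 2 from e to d turns them
  -- into -(-1)^d d^s, so these are σ₁* and σ₃* in the form to which `Convolution` applies; `s₇*`
  -- below is built likewise, with 256 = 2⁸.
  s₁ s₁* s₃ s₃* : ℤ → ℤ → ℤ
  s₁  d e = o e * d
  s₁* d e = (+ 4 * o e - + 3) * d
  s₃  d e = o e * cube d
  s₃* d e = (+ 16 * o e - + 15) * cube d

  -- This is the equation DF = F + 8F·(Dψ/ψ) satisfied by F = qψ⁸; the first term is the derivative
  -- of the factor q.
  E-s₃ : ∀ n → + n * E s₃ n ≡ E s₃ n + + 8 * (E s₁* ⊛ E s₃) n
  E-s₃ n = begin
    + n * E s₃ n
      ≡⟨ solve 2 (λ z w → z := w :- (w :- z)) refl (D (E s₃) n) (E s₃ n) ⟩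
    E s₃ n - (E s₃ n - D (E s₃) n)
      ≡⟨ cong (_-_ (E s₃ n)) (sym boundary) ⟩
    E s₃ n - (E u n - E (v Q Q-step) n)
      ≡⟨ cong (_-_ (E s₃ n)) (sym (identity Q Q-step n)) ⟩
    E s₃ n - sumOver (quads n) (λ ((a , x) , (b , y)) → difference (o x) (o y) a b)
      ≡⟨ cong (_-_ (E s₃ n)) (sum-cong (quads n) (λ { {(a , x) , (b , y)} _ → split (o x) (o y) a b })) ⟩
    E s₃ n - sumOver (quads n) (λ ((a , x) , (b , y)) → - + 4 * (s₁* a x * s₃ b y + s₃ a x * s₁* b y))
      ≡⟨ cong (_-_ (E s₃ n)) (sym (sym-⊛ (- + 4) s₁* s₃ n)) ⟩
    E s₃ n - + 2 * (- + 4) * (E s₁* ⊛ E s₃) n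
      ≡⟨ solve 2 (λ z w → z :- con (+ 2) :* con (- + 4) :* w := z :+ con (+ 8) :* w) refl (E s₃ n) ((E s₁* ⊛ E s₃) n) ⟩
    E s₃ n + + 8 * (E s₁* ⊛ E s₃) n ∎
    where
    open ≡-Reasoning
    -- Forced up to scale: in class (0,1) the coefficient of a³b must vanish and that of ab³ must be
    -- -3 times the one in class (1,1), to match the weight 4·o - 3. With s = a + b the polynomial
    -- becomes 6s²ab - s⁴, whence `Q`.
    open LevelTwo (+ 2) (+ 6) (- + 1) 0ℤ refl
    Q : ℤ → ℤ → ℤ
    Q s a = s * s * (+ 3 * a * (a - 1ℤ) * s - a * (a - 1ℤ) * (+ 2 * a - 1ℤ)) - s * s * (s * s) * a
    Q-step : ∀ s a → p a (s - a) ≡ Q s (1ℤ + a) - Q s a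
    Q-step = solve 2 (λ s a → let b = s :- a; Q′ = λ s a → s :* s :* (con (+ 3) :* a :* (a :- con 1ℤ) :* s :- a :* (a :- con 1ℤ) :* (con (+ 2) :* a :- con 1ℤ)) :- s :* s :* (s :* s) :* a in
      con (+ 2) :* (a :* b :* (a :* a :+ b :* b)) :+ con (+ 6) :* (a :* a :* (b :* b)) :+ con (- + 1) :* (a :* a :* (a :* a) :+ b :* b :* (b :* b))
        := Q′ s (con 1ℤ :+ a) :- Q′ s a) refl
    split : ∀ s t a b → difference s t a b ≡ - + 4 * ((+ 4 * s - + 3) * a * (t * cube b) + s * cube a * ((+ 4 * t - + 3) * b))
    split = solve 4 (λ s t a b →
        s :* t :* (con (- + 4) :* (a :* a :* a :* b :+ a :* (b :* b :* b)))
        :+ (con 1ℤ :- s) :* t :* (con 0ℤ :* (a :* a :* a :* b) :+ con (+ 12) :* (a :* (b :* b :* b)))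
        :+ s :* (con 1ℤ :- t) :* (con 0ℤ :* (a :* (b :* b :* b)) :+ con (+ 12) :* (a :* a :* a :* b))
        := con (- + 4) :* ((con (+ 4) :* s :- con (+ 3)) :* a :* (t :* (b :* b :* b)) :+ s :* (a :* a :* a) :* ((con (+ 4) :* t :- con (+ 3)) :* b))) refl
    boundary : E u n - E (v Q Q-step) n ≡ E s₃ n - D (E s₃) n
    boundary = begin
      E u n - E (v Q Q-step) n                                ≡⟨ E-sub u (v Q Q-step) n ⟩
      E (λ d e → u d e - v Q Q-step d e) n                    ≡⟨ E-cong (λ {d} {e} _ _ → pointwise (o e) d e) n ⟩
      E (λ d e → s₃ d e - d * e * s₃ d e) n                   ≡⟨ E-sub s₃ (λ d e → d * e * s₃ d e) n ⟨
      E s₃ n - E (λ d e → d * e * s₃ d e) n                   ≡⟨ cong (_-_ (E s₃ n)) (E-D s₃ n) ⟩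
      E s₃ n - D (E s₃) n ∎
      where
      pointwise : ∀ t d e → (t * (- + 1) * (d * d * (d * d)) * (e - 1ℤ) + (1ℤ - t) * 0ℤ * (d * d * (d * d)) * e) - t * (Q d d - Q d 1ℤ)
        ≡ t * cube d - d * e * (t * cube d)
      pointwise = solve 3 (λ t d e → let Q′ = λ s a → s :* s :* (con (+ 3) :* a :* (a :- con 1ℤ) :* s :- a :* (a :- con 1ℤ) :* (con (+ 2) :* a :- con 1ℤ)) :- s :* s :* (s :* s) :* a in
        (t :* con (- + 1) :* (d :* d :* (d :* d)) :* (e :- con 1ℤ) :+ (con 1ℤ :- t) :* con 0ℤ :* (d :* d :* (d :* d)) :* e) :- t :* (Q′ d d :- Q′ d (con 1ℤ))
        := t :* (d :* d :* d) :- d :* e :* (t :* (d :* d :* d))) refl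

  -- Q₃₀ s is an antidifference of 30 a²(s - a)², with Q₃₀ s s = s⁵ - s and Q₃₀ s 1 = 0.
  Q₃₀ : ℤ → ℤ → ℤ
  Q₃₀ s a = + 5 * (s * s) * (a * (a - 1ℤ) * (+ 2 * a - 1ℤ)) - + 15 * s * (a * a * ((a - 1ℤ) * (a - 1ℤ)))
    + a * (a - 1ℤ) * (+ 2 * a - 1ℤ) * (+ 3 * (a * a) - + 3 * a - 1ℤ)

  Q₃₀ᵖ : ∀ {n} → Polynomial n → Polynomial n → Polynomial n
  Q₃₀ᵖ s a = con (+ 5) :* (s :* s) :* (a :* (a :- con 1ℤ) :* (con (+ 2) :* a :- con 1ℤ)) :- con (+ 15) :* s :* (a :* a :* ((a :- con 1ℤ) :* (a :- con 1ℤ)))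
    :+ a :* (a :- con 1ℤ) :* (con (+ 2) :* a :- con 1ℤ) :* (con (+ 3) :* (a :* a) :- con (+ 3) :* a :- con 1ℤ)

  -- This is DF = 8F·(Dθ/θ) for F = 1 - 16 `E s₃*`, divided by -16, where Dθ/θ = -2 `E s₁`.
  E-s₃* : ∀ n → + n * E s₃* n ≡ E s₁ n - + 16 * (E s₁ ⊛ E s₃*) n
  E-s₃* n = begin
    + n * E s₃* n
      ≡⟨ solve 2 (λ z w → z := w :+ (z :- w)) refl (D (E s₃*) n) (E s₁ n) ⟩
    E s₁ n + (D (E s₃*) n - E s₁ n)
      ≡⟨ cong (_+_ (E s₁ n)) (sym boundary) ⟩
    E s₁ n + (E u n - E (v Q Q-step) n)
      ≡⟨ cong (_+_ (E s₁ n)) (sym (identity Q Q-step n)) ⟩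
    E s₁ n + sumOver (quads n) (λ ((a , x) , (b , y)) → difference (o x) (o y) a b)
      ≡⟨ cong (_+_ (E s₁ n)) (sum-cong (quads n) (λ { {(a , x) , (b , y)} _ → split (o x) (o y) a b })) ⟩
    E s₁ n + sumOver (quads n) (λ ((a , x) , (b , y)) → - + 8 * (s₁ a x * s₃* b y + s₃* a x * s₁ b y))
      ≡⟨ cong (_+_ (E s₁ n)) (sym (sym-⊛ (- + 8) s₁ s₃* n)) ⟩
    E s₁ n + + 2 * (- + 8) * (E s₁ ⊛ E s₃*) n
      ≡⟨ solve 2 (λ z w → z :+ con (+ 2) :* con (- + 8) :* w := z :- con (+ 16) :* w) refl (E s₁ n) ((E s₁ ⊛ E s₃*) n) ⟩
    E s₁ n - + 16 * (E s₁ ⊛ E s₃*) n ∎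
    where
    open ≡-Reasoning
    -- Here class (0,1) must have no ab³, and a³b with -15 times the coefficient in class (1,1), to
    -- match 16·o - 15. With s = a + b the polynomial is s⁴ - 30a²b², which brings in `Q₃₀`.
    open LevelTwo (+ 4) (- + 24) (+ 1) (- + 15) refl
    Q : ℤ → ℤ → ℤ
    Q s a = s * s * (s * s) * a - Q₃₀ s a
    Q-step : ∀ s a → p a (s - a) ≡ Q s (1ℤ + a) - Q s a
    Q-step = solve 2 (λ s a → let b = s :- a; Q′ = λ s a → s :* s :* (s :* s) :* a :- Q₃₀ᵖ s a in
      con (+ 4) :* (a :* b :* (a :* a :+ b :* b)) :+ con (- + 24) :* (a :* a :* (b :* b)) :+ con (+ 1) :* (a :* a :* (a :* a) :+ b :* b :* (b :* b))
        := Q′ s (con 1ℤ :+ a) :- Q′ s a) refl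
    split : ∀ s t a b → difference s t a b ≡ - + 8 * (s * a * ((+ 16 * t - + 15) * cube b) + (+ 16 * s - + 15) * cube a * (t * b))
    split = solve 4 (λ s t a b →
        s :* t :* (con (- + 8) :* (a :* a :* a :* b :+ a :* (b :* b :* b)))
        :+ (con 1ℤ :- s) :* t :* (con (+ 120) :* (a :* a :* a :* b) :+ con 0ℤ :* (a :* (b :* b :* b)))
        :+ s :* (con 1ℤ :- t) :* (con (+ 120) :* (a :* (b :* b :* b)) :+ con 0ℤ :* (a :* a :* a :* b))
        := con (- + 8) :* (s :* a :* ((con (+ 16) :* t :- con (+ 15)) :* (b :* b :* b)) :+ (con (+ 16) :* s :- con (+ 15)) :* (a :* a :* a) :* (t :* b))) refl
    boundary : E u n - E (v Q Q-step) n ≡ D (E s₃*) n - E s₁ n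
    boundary = begin
      E u n - E (v Q Q-step) n                                ≡⟨ E-sub u (v Q Q-step) n ⟩
      E (λ d e → u d e - v Q Q-step d e) n                    ≡⟨ E-cong (λ {d} {e} _ _ → pointwise (o e) d e) n ⟩
      E (λ d e → d * e * s₃* d e - s₁ d e) n                  ≡⟨ E-sub (λ d e → d * e * s₃* d e) s₁ n ⟨
      E (λ d e → d * e * s₃* d e) n - E s₁ n                  ≡⟨ cong (_- E s₁ n) (E-D s₃* n) ⟩
      D (E s₃*) n - E s₁ n ∎
      where
      pointwise : ∀ t d e → (t * (+ 1) * (d * d * (d * d)) * (e - 1ℤ) + (1ℤ - t) * (- + 15) * (d * d * (d * d)) * e) - t * (Q d d - Q d 1ℤ)
        ≡ d * e * ((+ 16 * t - + 15) * cube d) - t * d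
      pointwise = solve 3 (λ t d e → let Q′ = λ s a → s :* s :* (s :* s) :* a :- Q₃₀ᵖ s a in
        (t :* con (+ 1) :* (d :* d :* (d :* d)) :* (e :- con 1ℤ) :+ (con 1ℤ :- t) :* con (- + 15) :* (d :* d :* (d :* d)) :* e) :- t :* (Q′ d d :- Q′ d (con 1ℤ))
        := d :* e :* ((con (+ 16) :* t :- con (+ 15)) :* (d :* d :* d)) :- t :* d) refl

  seventh : ℤ → ℤ
  seventh d = cube d * cube d * d

  bothEven : ℤ → ℤ → ℤ
  bothEven s t = (1ℤ - s) * (1ℤ - t)

  s₇* : ℤ → ℤ → ℤ
  s₇* d e = (1ℤ - + 256 * (1ℤ - o e)) * seventh d

  module CubeConvolution (c : ℤ) where

    -- a²b²(a+b)² is invariant under the substitutions of Convolution, and its odd part is 2a³b³.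
    k′ : ℤ → ℤ → ℤ → ℤ → ℤ
    k′ s t a b = (1ℤ - c * bothEven s t) * (+ 30 * (a * a * (b * b) * ((a + b) * (a + b))))

    k h : ℤ → ℤ → ℤ → ℤ → ℤ
    k a b x y = k′ (o x) (o y) a b
    h a b x y = k (a - b) b x (x + y)

    private
      K′ : ∀ {m} → (c s t a b : Polynomial m) → Polynomial m
      K′ c s t a b = (con 1ℤ :- c :* ((con 1ℤ :- s) :* (con 1ℤ :- t))) :* (con (+ 30) :* (a :* a :* (b :* b) :* ((a :+ b) :* (a :+ b))))
      xor : ∀ {m} → Polynomial m → Polynomial m → Polynomial m
      xor s t = s :+ t :- con (+ 2) :* (s :* t)
      Diff : ∀ {m} → (c s t a b : Polynomial m) → Polynomial m
      Diff c s t a b = con (- + 120) :* ((con 1ℤ :- c :* ((con 1ℤ :- s) :* (con 1ℤ :- t))) :* (a :* a :* a :* (b :* b :* b)))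

    k′-right : ∀ {s t} → s ≡ 0ℤ ⊎ s ≡ 1ℤ → t ≡ 0ℤ ⊎ t ≡ 1ℤ → ∀ a b →
      k′ s (s + t - + 2 * (s * t)) (a - b) b ≡ k′ (s + t - + 2 * (s * t)) t a (b - a)
    k′-right (inj₁ refl) (inj₁ refl) = solve 3 (λ c a b → let s = con 0ℤ; t = con 0ℤ in K′ c s (xor s t) (a :- b) b := K′ c (xor s t) t a (b :- a)) refl c
    k′-right (inj₁ refl) (inj₂ refl) = solve 3 (λ c a b → let s = con 0ℤ; t = con 1ℤ in K′ c s (xor s t) (a :- b) b := K′ c (xor s t) t a (b :- a)) refl c
    k′-right (inj₂ refl) (inj₁ refl) = solve 3 (λ c a b → let s = con 1ℤ; t = con 0ℤ in K′ c s (xor s t) (a :- b) b := K′ c (xor s t) t a (b :- a)) refl c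
    k′-right (inj₂ refl) (inj₂ refl) = solve 3 (λ c a b → let s = con 1ℤ; t = con 1ℤ in K′ c s (xor s t) (a :- b) b := K′ c (xor s t) t a (b :- a)) refl c

    h-right : ∀ a b x y → h a b x y ≡ k a (b - a) (x + y) y
    h-right a b x y rewrite o-+ x y = k′-right (o-01 x) (o-01 y) a b

    k′-difference : ∀ {s t} → s ≡ 0ℤ ⊎ s ≡ 1ℤ → t ≡ 0ℤ ⊎ t ≡ 1ℤ → ∀ a b →
      k′ s (s + t - + 2 * (s * t)) (a - b) b - k′ s t a b ≡ - + 120 * ((1ℤ - c * bothEven s t) * (cube a * cube b))
    k′-difference (inj₁ refl) (inj₁ refl) = solve 3 (λ c a b → let s = con 0ℤ; t = con 0ℤ in K′ c s (xor s t) (a :- b) b :- K′ c s t a b := Diff c s t a b) refl c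
    k′-difference (inj₁ refl) (inj₂ refl) = solve 3 (λ c a b → let s = con 0ℤ; t = con 1ℤ in K′ c s (xor s t) (a :- b) b :- K′ c s t a b := Diff c s t a b) refl c
    k′-difference (inj₂ refl) (inj₁ refl) = solve 3 (λ c a b → let s = con 1ℤ; t = con 0ℤ in K′ c s (xor s t) (a :- b) b :- K′ c s t a b := Diff c s t a b) refl c
    k′-difference (inj₂ refl) (inj₂ refl) = solve 3 (λ c a b → let s = con 1ℤ; t = con 1ℤ in K′ c s (xor s t) (a :- b) b :- K′ c s t a b := Diff c s t a b) refl c

    h-k : ∀ a b x y → h a b x y - k a b x y ≡ - + 120 * ((1ℤ - c * bothEven (o x) (o y)) * (cube a * cube b))
    h-k a b x y rewrite o-+ x y = k′-difference (o-01 x) (o-01 y) a b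

    u-sum : ∀ d m → sumOver (posRange m) (λ x → h d d x (+ suc m - x)) ≡ 0ℤ
    u-sum d m = sum-zero (posRange m) (λ {x} _ →
      solve 2 (λ w d → w :* (con (+ 30) :* ((d :- d) :* (d :- d) :* (d :* d) :* ((d :- d :+ d) :* (d :- d :+ d)))) := con 0ℤ) refl
        (1ℤ - c * bothEven (o x) (o (x + (+ suc m - x)))) d)

    v : ℤ → ℤ → ℤ
    v d e = (1ℤ - c * (1ℤ - o e)) * (d * d * (Q₃₀ d d - Q₃₀ d 1ℤ))

    k′-diagonal : ∀ {t} → t ≡ 0ℤ ⊎ t ≡ 1ℤ → ∀ d a →
      k′ t t a (d - a) ≡ (1ℤ - c * (1ℤ - t)) * (d * d) * Q₃₀ d (1ℤ + a) - (1ℤ - c * (1ℤ - t)) * (d * d) * Q₃₀ d a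
    k′-diagonal (inj₁ refl) = solve 3 (λ c d a → let t = con 0ℤ; W = (con 1ℤ :- c :* (con 1ℤ :- t)) :* (d :* d) in
      K′ c t t a (d :- a) := W :* Q₃₀ᵖ d (con 1ℤ :+ a) :- W :* Q₃₀ᵖ d a) refl c
    k′-diagonal (inj₂ refl) = solve 3 (λ c d a → let t = con 1ℤ; W = (con 1ℤ :- c :* (con 1ℤ :- t)) :* (d :* d) in
      K′ c t t a (d :- a) := W :* Q₃₀ᵖ d (con 1ℤ :+ a) :- W :* Q₃₀ᵖ d a) refl c

    v-sum : ∀ m e → sumOver (posRange m) (λ a → k a (+ suc m - a) e e) ≡ v (+ suc m) e
    v-sum m e = trans (telescope (λ a → (1ℤ - c * (1ℤ - o e)) * (d * d) * Q₃₀ d a) (k′-diagonal (o-01 e) d) m)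
      (solve 4 (λ w D q r → w :* D :* q :- w :* D :* r := w :* (D :* (q :- r))) refl (1ℤ - c * (1ℤ - o e)) (d * d) (Q₃₀ d d) (Q₃₀ d 1ℤ))
      where d = + suc m

    v≡ : ∀ d e → v d e ≡ (1ℤ - c * (1ℤ - o e)) * seventh d - (1ℤ - c * (1ℤ - o e)) * cube d
    v≡ d e = solve 2 (λ w d → w :* (d :* d :* (Q₃₀ᵖ d d :- Q₃₀ᵖ d (con 1ℤ)))
      := w :* (d :* d :* d :* (d :* d :* d) :* d) :- w :* (d :* d :* d)) refl (1ℤ - c * (1ℤ - o e)) d

    -- The weight has the factor a², so h vanishes for a = b and only the boundary x = y survives,
    -- where d²(d⁵ - d) = d⁷ - d³. The parameter c subtracts the same convolution in q², that is,
    -- the pairs with x and y both even; this class is stable under the substitutions.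
    cube-convolution : ∀ n → sumOver (quads n) (λ ((a , x) , (b , y)) → - + 120 * ((1ℤ - c * bothEven (o x) (o y)) * (cube a * cube b)))
      ≡ E (λ d e → (1ℤ - c * (1ℤ - o e)) * cube d) n - E (λ d e → (1ℤ - c * (1ℤ - o e)) * seventh d) n
    cube-convolution n = begin
      sumOver (quads n) (λ ((a , x) , (b , y)) → - + 120 * ((1ℤ - c * bothEven (o x) (o y)) * (cube a * cube b)))
        ≡⟨ sum-cong (quads n) (λ { {(a , x) , (b , y)} _ → sym (h-k a b x y) }) ⟩
      sumOver (quads n) (λ ((a , x) , (b , y)) → h a b x y - k a b x y)
        ≡⟨ Convolution.convolution h k (λ _ _ _ _ → refl) h-right {λ _ _ → 0ℤ} {v} u-sum v-sum n ⟩
      E (λ _ _ → 0ℤ) n - E v n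
        ≡⟨ cong₂ _-_ (sum-zero (divisorPairs n) (λ _ → refl))
             (trans (E-cong (λ {d} {e} _ _ → v≡ d e) n) (sym (E-sub (λ d e → (1ℤ - c * (1ℤ - o e)) * seventh d) (λ d e → (1ℤ - c * (1ℤ - o e)) * cube d) n))) ⟩
      0ℤ - (E (λ d e → (1ℤ - c * (1ℤ - o e)) * seventh d) n - E (λ d e → (1ℤ - c * (1ℤ - o e)) * cube d) n)
        ≡⟨ solve 2 (λ x y → con 0ℤ :- (x :- y) := y :- x) refl (E (λ d e → (1ℤ - c * (1ℤ - o e)) * seventh d) n) (E (λ d e → (1ℤ - c * (1ℤ - o e)) * cube d) n) ⟩
      _ ∎
      where open ≡-Reasoning

  -- Reduces an identity between products of cubic sums to its coefficients at the four values of
  -- the parities (s , t).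
  weighted-cubes : ∀ (φ ψ : ℤ → ℤ) i j (χ : ℤ → ℤ → ℤ) l →
    (∀ {s t} → s ≡ 0ℤ ⊎ s ≡ 1ℤ → t ≡ 0ℤ ⊎ t ≡ 1ℤ → i * (φ s * φ t + φ s * φ t) + j * (φ s * ψ t + ψ s * φ t) ≡ l * χ s t) →
    ∀ n → let f = λ d e → φ (o e) * cube d; g = λ d e → ψ (o e) * cube d in
    + 2 * i * (E f ⊛ E f) n + + 2 * j * (E f ⊛ E g) n ≡
    sumOver (quads n) (λ ((a , x) , (b , y)) → l * (χ (o x) (o y) * (cube a * cube b)))
  weighted-cubes φ ψ i j χ l coefficient n = trans (cong₂ _+_ (sym-⊛ i _ _ n) (sym-⊛ j _ _ n)) (trans (sym (sum-+ (quads n) _ _))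
    (sum-cong (quads n) (λ { {(a , x) , (b , y)} _ →
      trans (factor i j (φ (o x)) (φ (o y)) (ψ (o x)) (ψ (o y)) (cube a) (cube b))
        (trans (cong (_* (cube a * cube b)) (coefficient (o-01 x) (o-01 y))) (ℤ.*-assoc l (χ (o x) (o y)) (cube a * cube b))) })))
    where
    factor : ∀ i j S T s t c d → i * (S * c * (T * d) + S * c * (T * d)) + j * (S * c * (t * d) + s * c * (T * d))
      ≡ (i * (S * T + S * T) + j * (S * t + s * T)) * (c * d)
    factor = solve 8 (λ i j S T s t c d → i :* (S :* c :* (T :* d) :+ S :* c :* (T :* d)) :+ j :* (S :* c :* (t :* d) :+ s :* c :* (T :* d))
      := (i :* (S :* T :+ S :* T) :+ j :* (S :* t :+ s :* T)) :* (c :* d)) refl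

  -- In the combination 136 s₃*⊛s₃* - 256 s₃*⊛s₃ the products mixing Σd³q^{de} with Σd³q^{2de} cancel.
  eisenstein : ∀ n → + 136 * (E s₃* ⊛ E s₃*) n - + 256 * (E s₃* ⊛ E s₃) n + + 16 * E s₃ n ≡ + 17 * E s₃* n - E s₇* n
  eisenstein n = begin
    + 136 * (E s₃* ⊛ E s₃*) n - + 256 * (E s₃* ⊛ E s₃) n + + 16 * E s₃ n
      ≡⟨ cong (_+ + 16 * E s₃ n) products ⟩
    E (λ d e → (1ℤ - + 256 * (1ℤ - o e)) * cube d) n - E s₇* n + + 16 * E s₃ n
      ≡⟨ cong (λ z → z - E s₇* n + + 16 * E s₃ n) linear ⟩
    + 17 * E s₃* n + - + 16 * E s₃ n - E s₇* n + + 16 * E s₃ n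
      ≡⟨ solve 3 (λ x y z → con (+ 17) :* y :+ con (- + 16) :* z :- x :+ con (+ 16) :* z := con (+ 17) :* y :- x) refl (E s₇* n) (E s₃* n) (E s₃ n) ⟩
    + 17 * E s₃* n - E s₇* n ∎
    where
    open ≡-Reasoning
    linear-pointwise : ∀ t c → (1ℤ - + 256 * (1ℤ - t)) * c ≡ + 17 * ((+ 16 * t - + 15) * c) + - + 16 * (t * c)
    linear-pointwise = solve 2 (λ t c → (con 1ℤ :- con (+ 256) :* (con 1ℤ :- t)) :* c := con (+ 17) :* ((con (+ 16) :* t :- con (+ 15)) :* c) :+ con (- + 16) :* (t :* c)) refl
    linear : E (λ d e → (1ℤ - + 256 * (1ℤ - o e)) * cube d) n ≡ + 17 * E s₃* n + - + 16 * E s₃ n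
    linear = begin
      E (λ d e → (1ℤ - + 256 * (1ℤ - o e)) * cube d) n
        ≡⟨ E-cong (λ {d} {e} _ _ → linear-pointwise (o e) (cube d)) n ⟩
      E (λ d e → + 17 * s₃* d e + - + 16 * s₃ d e) n
        ≡⟨ E-+ (λ d e → + 17 * s₃* d e) (λ d e → - + 16 * s₃ d e) n ⟩
      E (λ d e → + 17 * s₃* d e) n + E (λ d e → - + 16 * s₃ d e) n
        ≡⟨ cong₂ _+_ (E-* (+ 17) s₃* n) (E-* (- + 16) s₃ n) ⟩
      + 17 * E s₃* n + - + 16 * E s₃ n ∎
    -- Equal weights on (1,1) and (0,1) mean 2i + 2j = -30i - 15j, that is 32i = -17j: here 17
    -- arises. The scale 68, -128 makes this common value -120, the constant of `CubeConvolution`;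
    -- the class (0,0) then requires c = 256.
    coefficient : ∀ {s t} → s ≡ 0ℤ ⊎ s ≡ 1ℤ → t ≡ 0ℤ ⊎ t ≡ 1ℤ →
      + 68 * ((+ 16 * s - + 15) * (+ 16 * t - + 15) + (+ 16 * s - + 15) * (+ 16 * t - + 15))
        + - + 128 * ((+ 16 * s - + 15) * t + s * (+ 16 * t - + 15)) ≡ - + 120 * (1ℤ - + 256 * bothEven s t)
    coefficient (inj₁ refl) (inj₁ refl) = refl
    coefficient (inj₁ refl) (inj₂ refl) = refl
    coefficient (inj₂ refl) (inj₁ refl) = refl
    coefficient (inj₂ refl) (inj₂ refl) = refl
    products : + 136 * (E s₃* ⊛ E s₃*) n - + 256 * (E s₃* ⊛ E s₃) n
      ≡ E (λ d e → (1ℤ - + 256 * (1ℤ - o e)) * cube d) n - E s₇* n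
    products = begin
      + 136 * (E s₃* ⊛ E s₃*) n - + 256 * (E s₃* ⊛ E s₃) n
        ≡⟨ cong (_+_ (+ 136 * (E s₃* ⊛ E s₃*) n)) (ℤ.neg-distribˡ-* (+ 256) ((E s₃* ⊛ E s₃) n)) ⟩
      + 2 * + 68 * (E s₃* ⊛ E s₃*) n + + 2 * - + 128 * (E s₃* ⊛ E s₃) n
        ≡⟨ weighted-cubes (λ t → + 16 * t - + 15) id (+ 68) (- + 128) (λ s t → 1ℤ - + 256 * bothEven s t) (- + 120) coefficient n ⟩
      sumOver (quads n) (λ ((a , x) , (b , y)) → - + 120 * ((1ℤ - + 256 * bothEven (o x) (o y)) * (cube a * cube b)))
        ≡⟨ CubeConvolution.cube-convolution (+ 256) n ⟩
      E (λ d e → (1ℤ - + 256 * (1ℤ - o e)) * cube d) n - E s₇* n ∎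

open EisensteinIdentities

-- Cancellation along Conway's river for indefinite binary forms.

module River where

  open import Data.Integer using (_+_; _*_; _-_; -_)
  open +-*-Solver using (solve; _:+_; _:*_; _:-_; :-_; con; _:=_; Polynomial)
  open Enumerates

  private variable
    A : Set

  2*-cancel : ∀ {i j} → + 2 * i ≡ + 2 * j → i ≡ j
  2*-cancel {i} {j} = ℤ.*-cancelˡ-≡ (+ 2) i j

  sum-symmetrize : ∀ {P : A → Set} {xs} → Enumerates P xs → (ι : A → A) →
    (∀ {x} → P x → P (ι x)) → (∀ {x} → P x → ι (ι x) ≡ x) →
    ∀ {f g : A → ℤ} → (∀ {x} → P x → f x + f (ι x) ≡ g x + g (ι x)) → sumOver xs f ≡ sumOver xs g
  sum-symmetrize {xs = xs} e ι pres inv {f} {g} eq = 2*-cancel (begin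
    + 2 * sumOver xs f                       ≡⟨ double f ⟩
    sumOver xs (λ x → f x + f (ι x))         ≡⟨ sum-cong xs (eq ∘ e .sound) ⟩
    sumOver xs (λ x → g x + g (ι x))         ≡⟨ double g ⟨
    + 2 * sumOver xs g                       ∎)
    where
    open ≡-Reasoning
    double : ∀ f → + 2 * sumOver xs f ≡ sumOver xs (λ x → f x + f (ι x))
    double f = sym (trans (sum-+ xs f (f ∘ ι))
      (trans (cong (_+_ (sumOver xs f)) (sum-bij e e ι ι pres pres inv inv (λ _ → refl)))
        (solve 1 (λ z → z :+ z := con (+ 2) :* z) refl (sumOver xs f))))

  parityℕ-* : ∀ m n → parityℕ (m ℕ.* n) ≡ parityℕ m * parityℕ n
  parityℕ-* zero    n = refl
  parityℕ-* (suc m) n = begin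
    o (+ (n ℕ.+ m ℕ.* n))                                      ≡⟨ cong o (ℤ.pos-+ n (m ℕ.* n)) ⟩
    o (+ n + + (m ℕ.* n))                                      ≡⟨ o-+ (+ n) (+ (m ℕ.* n)) ⟩
    parityℕ n + parityℕ (m ℕ.* n) - + 2 * (parityℕ n * parityℕ (m ℕ.* n))
      ≡⟨ cong (λ q → parityℕ n + q - + 2 * (parityℕ n * q)) (parityℕ-* m n) ⟩
    parityℕ n + parityℕ m * parityℕ n - + 2 * (parityℕ n * (parityℕ m * parityℕ n))
      ≡⟨ idempotent (parityℕ-01 n) (parityℕ m) ⟩
    (1ℤ - parityℕ m) * parityℕ n                               ≡⟨ cong (_* parityℕ n) (sym (parityℕ-suc m)) ⟩
    parityℕ (suc m) * parityℕ n                                ∎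
    where
    open ≡-Reasoning
    idempotent : ∀ {t} → t ≡ 0ℤ ⊎ t ≡ 1ℤ → ∀ s → t + s * t - + 2 * (t * (s * t)) ≡ (1ℤ - s) * t
    idempotent (inj₁ refl) = solve 1 (λ s → let t = con 0ℤ in t :+ s :* t :- con (+ 2) :* (t :* (s :* t)) := (con 1ℤ :- s) :* t) refl
    idempotent (inj₂ refl) = solve 1 (λ s → let t = con 1ℤ in t :+ s :* t :- con (+ 2) :* (t :* (s :* t)) := (con 1ℤ :- s) :* t) refl

  o-* : ∀ i j → o (i * j) ≡ o i * o j
  o-* i j = trans (cong parityℕ (ℤ.abs-* i j)) (parityℕ-* ℤ.∣ i ∣ ℤ.∣ j ∣)

  o-double : ∀ i → o (i + i) ≡ 0ℤ
  o-double i = trans (o-+ i i) (vanish (o-01 i))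
    where
    vanish : ∀ {t} → t ≡ 0ℤ ⊎ t ≡ 1ℤ → t + t - + 2 * (t * t) ≡ 0ℤ
    vanish (inj₁ refl) = refl
    vanish (inj₂ refl) = refl

  Form : Set
  Form = ℤ × (ℤ × ℤ)

  -- (i , y , z) stands for the binary form f = yX² + (2i+ε)XY - zY², so that f(1,1) = f₁₁ - z.  The involutions
  -- left and right are the two steps along Conway's river; together they pair up all f with f(1,1) ≠ 0.
  IsForm : ℤ → ℤ → Form → Set
  IsForm ε N (i , (y , z)) = Pos y × Pos z × i * (i + ε) + y * z ≡ N

  f₁₁ : ℤ → Form → ℤ
  f₁₁ ε (i , (y , z)) = y + (i + i + ε)

  left right : ℤ → Form → Form
  left  ε (i , (y , z)) = z - i - ε , (y + (i + i + ε) - z , z)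
  right ε (i , (y , z)) = - (i + y + ε) , (y , z - (y + (i + i + ε)))

  form-≡ : ∀ {i j y y′ z z′ : ℤ} → i ≡ j → y ≡ y′ → z ≡ z′ → (i , (y , z)) ≡ (j , (y′ , z′))
  form-≡ refl refl refl = refl

  -- `left` exchanges the values y = f(1,0) and f(1,1); `right` exchanges z = -f(0,1) and -f(1,1).
  -- So `left` preserves the forms with f(1,1) > 0 and `right` those with f(1,1) < 0, and an R odd
  -- under both is supported on f(1,1) = 0.
  river : ∀ {ε N xs} → Enumerates (IsForm ε N) xs → ∀ {R : Form → ℤ} →
    (∀ f → R (left ε f) ≡ - R f) → (∀ f → R (right ε f) ≡ - R f) →
    sumOver xs R ≡ sumOver (filter (λ f@(i , (y , z)) → z ℤ.≟ f₁₁ ε f) xs) R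
  river {ε} {N} {xs} en {R} anti-left anti-right = begin
    sumOver xs R ≡⟨ trisect (λ (i , (y , z)) → z) (f₁₁ ε) xs R ⟩
    sumOver (filter (λ f@(i , (y , z)) → z ℤ.<? f₁₁ ε f) xs) R + sumOver (filter (λ f@(i , (y , z)) → f₁₁ ε f ℤ.<? z) xs) R + rest
      ≡⟨ cong₂ (λ a b → a + b + rest)
           (sum-involution (enum-filter en _) (left ε) (λ {f} → left-pres {f}) (λ {f} → left-inv {f}) (λ {f} _ → anti-left f))
           (sum-involution (enum-filter en _) (right ε) (λ {f} → right-pres {f}) (λ {f} → right-inv {f}) (λ {f} _ → anti-right f)) ⟩
    0ℤ + 0ℤ + rest ≡⟨ ℤ.+-identityˡ rest ⟩
    rest ∎
    where
    open ≡-Reasoning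
    rest = sumOver (filter (λ f@(i , (y , z)) → z ℤ.≟ f₁₁ ε f) xs) R
    left-pres : ∀ {f} → IsForm ε N f × (proj₂ (proj₂ f) ℤ.< f₁₁ ε f) →
      IsForm ε N (left ε f) × (proj₂ (proj₂ (left ε f)) ℤ.< f₁₁ ε (left ε f))
    left-pres {i , (y , z)} ((y>0 , z>0 , eq) , z<t) = (pos-- z<t , z>0 , trans
      (solve 4 (λ i y z ε → (z :- i :- ε) :* (z :- i :- ε :+ ε) :+ (y :+ (i :+ i :+ ε) :- z) :* z := i :* (i :+ ε) :+ y :* z) refl i y z ε) eq)
      , <-by y>0 (solve 4 (λ i y z ε → y :+ (i :+ i :+ ε) :- z :+ (z :- i :- ε :+ (z :- i :- ε) :+ ε) := z :+ y) refl i y z ε)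
    left-inv : ∀ {f} → IsForm ε N f × (proj₂ (proj₂ f) ℤ.< f₁₁ ε f) → left ε (left ε f) ≡ f
    left-inv {i , (y , z)} _ = form-≡ (solve 3 (λ i z ε → z :- (z :- i :- ε) :- ε := i) refl i z ε)
      (solve 4 (λ i y z ε → y :+ (i :+ i :+ ε) :- z :+ (z :- i :- ε :+ (z :- i :- ε) :+ ε) :- z := y) refl i y z ε) refl
    right-pres : ∀ {f} → IsForm ε N f × (f₁₁ ε f ℤ.< proj₂ (proj₂ f)) →
      IsForm ε N (right ε f) × (f₁₁ ε (right ε f) ℤ.< proj₂ (proj₂ (right ε f)))
    right-pres {i , (y , z)} ((y>0 , z>0 , eq) , t<z) = (y>0 , pos-- t<z , trans
      (solve 4 (λ i y z ε → (:- (i :+ y :+ ε)) :* (:- (i :+ y :+ ε) :+ ε) :+ y :* (z :- (y :+ (i :+ i :+ ε))) := i :* (i :+ ε) :+ y :* z) refl i y z ε) eq)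
      , <-by z>0 (solve 4 (λ i y z ε → z :- (y :+ (i :+ i :+ ε)) := y :+ (:- (i :+ y :+ ε) :+ :- (i :+ y :+ ε) :+ ε) :+ z) refl i y z ε)
    right-inv : ∀ {f} → IsForm ε N f × (f₁₁ ε f ℤ.< proj₂ (proj₂ f)) → right ε (right ε f) ≡ f
    right-inv {i , (y , z)} _ = form-≡ (solve 3 (λ i y ε → :- (:- (i :+ y :+ ε) :+ y :+ ε) := i) refl i y ε) refl
      (solve 4 (λ i y z ε → z :- (y :+ (i :+ i :+ ε)) :- (y :+ (:- (i :+ y :+ ε) :+ :- (i :+ y :+ ε) :+ ε)) := z) refl i y z ε)

  reflect : ℤ → Form → Form
  reflect ε (i , p) = - (i + ε) , p

  swap-form : Form → Form
  swap-form (i , (y , z)) = i , (z , y)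

  reflect-pres : ∀ {ε N f} → IsForm ε N f → IsForm ε N (reflect ε f)
  reflect-pres {ε} {f = i , (y , z)} (y>0 , z>0 , eq) = y>0 , z>0 ,
    trans (solve 4 (λ i y z ε → (:- (i :+ ε)) :* (:- (i :+ ε) :+ ε) :+ y :* z := i :* (i :+ ε) :+ y :* z) refl i y z ε) eq

  reflect-inv : ∀ {ε} f → reflect ε (reflect ε f) ≡ f
  reflect-inv {ε} (i , p) = cong (_, p) (solve 2 (λ i ε → :- (:- (i :+ ε) :+ ε) := i) refl i ε)

  swap-pres : ∀ {ε N f} → IsForm ε N f → IsForm ε N (swap-form f)
  swap-pres {ε} {f = i , (y , z)} (y>0 , z>0 , eq) = z>0 , y>0 , trans (cong (_+_ (i * (i + ε))) (ℤ.*-comm z y)) eq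

  -- Averaging over the sign of the middle coefficient removes the terms linear in it; averaging
  -- over y ↔ z merges the two remaining halves. What is left of R is a product weight H, hence a
  -- convolution of series.
  symmetrized : ∀ {ε N xs} → Enumerates (IsForm ε N) xs → ∀ {R H : Form → ℤ} →
    (∀ {f} → IsForm ε N f → R f + R (reflect ε f) ≡ + 2 * (H f + H (swap-form f))) →
    sumOver xs R ≡ + 2 * sumOver xs H
  symmetrized {ε} {N} {xs} en {R} {H} eq = begin
    sumOver xs R ≡⟨ 2*-cancel (trans double (trans (sum-cong xs (eq ∘ en .sound)) (sum-* xs (+ 2) _))) ⟩
    sumOver xs (λ f → H f + H (swap-form f)) ≡⟨ sum-+ xs H (H ∘ swap-form) ⟩
    sumOver xs H + sumOver xs (H ∘ swap-form)
      ≡⟨ cong (_+_ (sumOver xs H)) (sum-bij en en swap-form swap-form (λ {f} → swap-pres {ε} {N} {f}) (λ {f} → swap-pres {ε} {N} {f}) (λ _ → refl) (λ _ → refl) (λ _ → refl)) ⟩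
    sumOver xs H + sumOver xs H ≡⟨ solve 1 (λ z → z :+ z := con (+ 2) :* z) refl (sumOver xs H) ⟩
    + 2 * sumOver xs H ∎
    where
    open ≡-Reasoning
    double : + 2 * sumOver xs R ≡ sumOver xs (λ f → R f + R (reflect ε f))
    double = sym (trans (sum-+ xs R (R ∘ reflect ε))
      (trans (cong (_+_ (sumOver xs R)) (sum-bij en en (reflect ε) (reflect ε) (λ {f} → reflect-pres {ε} {N} {f}) (λ {f} → reflect-pres {ε} {N} {f}) (λ {f} _ → reflect-inv f) (λ {f} _ → reflect-inv f) (λ _ → refl)))
        (solve 1 (λ z → z :+ z := con (+ 2) :* z) refl (sumOver xs R))))

open River

-- The logarithmic derivative of θ.

module ThetaSeries where

  open import Data.Integer using (_+_; _*_; _-_; -_)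
  open +-*-Solver using (solve; _:+_; _:*_; _:-_; :-_; con; _:=_; Polynomial)
  open Enumerates

  infixl 6 _⊻_
  _⊻_ : ℤ → ℤ → ℤ
  s ⊻ t = s + t - + 2 * (s * t)

  xorᵖ : ∀ {n} → Polynomial n → Polynomial n → Polynomial n
  xorᵖ s t = s :+ t :- con (+ 2) :* (s :* t)

  o-f₁₁ : ∀ ε i y → o (y + (i + i + ε)) ≡ o y ⊻ o ε
  o-f₁₁ ε i y = trans (o-+ y (i + i + ε)) (cong (o y ⊻_) (trans (o-+ (i + i) ε)
    (trans (cong (_⊻ o ε) (o-double i)) (solve 1 (λ t → xorᵖ (con 0ℤ) t := t) refl (o ε)))))

  o-f₁₁-z : ∀ ε i y z → o (y + (i + i + ε) - z) ≡ (o y ⊻ o ε) ⊻ o z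
  o-f₁₁-z ε i y z = trans (o-- (y + (i + i + ε)) z) (cong (_⊻ o z) (o-f₁₁ ε i y))

  o-z-f₁₁ : ∀ ε i y z → o (z - (y + (i + i + ε))) ≡ o z ⊻ (o y ⊻ o ε)
  o-z-f₁₁ ε i y z = trans (o-- z (y + (i + i + ε))) (cong (o z ⊻_) (o-f₁₁ ε i y))

  enum-intRange : ∀ m → Enumerates (λ i → ℤ.∣ i ∣ ℕ.≤ m) (intRange m)
  enum-intRange m .unique = Unique.++⁺ (Unique.map⁺ (λ { refl → refl }) (Unique.upTo⁺ (suc m)))
    (Unique.map⁺ (λ { refl → refl }) (Unique.upTo⁺ m)) disjoint
    where
    disjoint : ∀ {i} → ¬ (i ∈ map (λ i → + i) (upTo (suc m)) × i ∈ map (λ i → -[1+ i ]) (upTo m))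
    disjoint (p , q) with ∈-map⁻ (λ i → + i) p | ∈-map⁻ (λ i → -[1+ i ]) q
    ... | _ , _ , refl | _ , _ , ()
  enum-intRange m .sound i∈ with ∈-++⁻ (map (λ i → + i) (upTo (suc m))) i∈
  ... | inj₁ p with ∈-map⁻ (λ i → + i) p
  ...   | _ , j∈ , refl = ℕ.s≤s⁻¹ (∈-upTo⁻ j∈)
  enum-intRange m .sound i∈ | inj₂ q with ∈-map⁻ (λ i → -[1+ i ]) q
  ...   | _ , j∈ , refl = ∈-upTo⁻ j∈
  enum-intRange m .complete {+ j}      j≤m = ∈-++⁺ˡ (∈-map⁺ (λ i → + i) (∈-upTo⁺ (s≤s j≤m)))
  enum-intRange m .complete { -[1+ j ]} j<m = ∈-++⁺ʳ (map (λ i → + i) (upTo (suc m))) (∈-map⁺ (λ i → -[1+ i ]) (∈-upTo⁺ j<m))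

  sq : ℤ → ℕ
  sq i = ℤ.∣ i ∣ ℕ.* ℤ.∣ i ∣

  +sq : ∀ i → + sq i ≡ i * i
  +sq (+ n)     = ℤ.pos-* n n
  +sq -[1+ n ]  = refl

  ∣i∣≤sq : ∀ i → ℤ.∣ i ∣ ℕ.≤ sq i
  ∣i∣≤sq (+ zero)  = z≤n
  ∣i∣≤sq (+ suc n) = ℕ.m≤m*n (suc n) (suc n)
  ∣i∣≤sq -[1+ n ]  = ℕ.m≤m*n (suc n) (suc n)

  enum-roots : ∀ {n m} → n ℕ.≤ m → Enumerates (λ i → i * i ≡ + n) (filter (λ i → sq i ℕ.≟ n) (intRange m))
  enum-roots {n} {m} n≤m = enum-⇔
    (λ { {i} (_ , eq) → trans (sym (+sq i)) (cong +_ eq) })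
    (λ { {i} eq → let sq≡n = ℤ.+-injective (trans (+sq i) eq) in
         ℕ.≤-trans (∣i∣≤sq i) (ℕ.≤-trans (ℕ.≤-reflexive sq≡n) n≤m) , sq≡n })
    (enum-filter (enum-intRange m) (λ i → sq i ℕ.≟ n))

  θ : Series
  θ n = gf sq (λ i → 1ℤ - + 2 * o i) (intRange n) n

  module ThetaDerivative (n : ℕ) where

    forms : List Form
    forms = filter (λ (i , p) → sq i ℕ.+ area p ℕ.≟ n) (cartesianProduct (intRange n) (pairs n))

    enum-forms : Enumerates (IsForm 0ℤ (+ n)) forms
    enum-forms = enum-⇔
      (λ { {i , (y , z)} ((_ , ((y>0 , _) , (z>0 , _))) , eq) → y>0 , z>0 , trans (sym (total {i} y>0 z>0)) (cong +_ eq) })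
      (λ { {i , (y , z)} (y>0 , z>0 , eq) →
           let sum≡n = ℤ.+-injective (trans (total {i} y>0 z>0) eq)
               yz≤n = subst (ℤ._≤ + n) (area-pos y>0 z>0) (ℤ.+≤+ (subst (area (y , z) ℕ.≤_) sum≡n (ℕ.m≤n+m (area (y , z)) (sq i))))
           in (ℕ.≤-trans (∣i∣≤sq i) (subst (sq i ℕ.≤_) sum≡n (ℕ.m≤m+n (sq i) (area (y , z)))) ,
               ((y>0 , ℤ.≤-trans (proj₁ (pos-≤-product y>0 z>0)) yz≤n) , (z>0 , ℤ.≤-trans (proj₂ (pos-≤-product y>0 z>0)) yz≤n))) , sum≡n })
      (enum-filter (enum-× (enum-intRange n) (enum-× (enum-posRange n) (enum-posRange n))) (λ (i , p) → sq i ℕ.+ area p ℕ.≟ n))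
      where
      total : ∀ {i y z} → Pos y → Pos z → + (sq i ℕ.+ area (y , z)) ≡ i * (i + 0ℤ) + y * z
      total {i} {y} {z} y>0 z>0 = trans (ℤ.pos-+ (sq i) (area (y , z)))
        (cong₂ _+_ (trans (+sq i) (cong (i *_) (sym (ℤ.+-identityʳ i)))) (area-pos y>0 z>0))

    H : Form → ℤ
    H (i , (y , z)) = (1ℤ - + 2 * o i) * s₁ y z

    θ⊛s₁ : (θ ⊛ E s₁) n ≡ sumOver forms H
    θ⊛s₁ = trans (⊛-cong-≤ {θ} {gf sq (λ i → 1ℤ - + 2 * o i) (intRange n)} n
        (λ {j} j≤n → sum-enum (enum-roots {j} {j} ℕ.≤-refl) (enum-roots {j} {n} j≤n) (λ _ → refl)) (E-box s₁))
      (sym (gf-product _,_ {sq} {area} (λ _ _ → refl) {λ i → 1ℤ - + 2 * o i} {λ (y , z) → s₁ y z} (λ _ _ → refl) (intRange n) (pairs n) n))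

    -- The difference of the two odd ones among the values f(1,0) = y, f(1,1) = y + x - z, f(0,1) =
    -- -z, where x is the middle coefficient; zero if all are even. Each river step either reverses
    -- this difference and keeps (-1)^i, or keeps the difference and flips (-1)^i.
    ρ : ℤ → ℤ → ℤ → ℤ → ℤ → ℤ
    ρ s t x y z = (1ℤ - s) * t * (y + x) + s * (1ℤ - t) * (z - x) + s * t * (y + z)

    R : Form → ℤ
    R (i , (y , z)) = (1ℤ - + 2 * o i) * ρ (o y) (o z) (i + i + 0ℤ) y z

    private
      Rᵖ : ∀ {m} → (r s t i y z : Polynomial m) → Polynomial m
      Rᵖ r s t i y z = (con 1ℤ :- con (+ 2) :* r) :* ((con 1ℤ :- s) :* t :* (y :+ (i :+ i :+ con 0ℤ))
        :+ s :* (con 1ℤ :- t) :* (z :- (i :+ i :+ con 0ℤ)) :+ s :* t :* (y :+ z))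

      Lᵖ : ∀ {m} → (r s t i y z : Polynomial m) → Polynomial m
      Lᵖ r s t i y z = Rᵖ (xorᵖ (xorᵖ t r) (con 0ℤ)) (xorᵖ (xorᵖ s (con 0ℤ)) t) t (z :- i :- con 0ℤ) (y :+ (i :+ i :+ con 0ℤ) :- z) z

      Kᵖ : ∀ {m} → (r s t i y z : Polynomial m) → Polynomial m
      Kᵖ r s t i y z = Rᵖ (xorᵖ (xorᵖ r s) (con 0ℤ)) s (xorᵖ t (xorᵖ s (con 0ℤ))) (:- (i :+ y :+ con 0ℤ)) y (z :- (y :+ (i :+ i :+ con 0ℤ)))

    anti-left : ∀ f → R (left 0ℤ f) ≡ - R f
    anti-left (i , (y , z)) rewrite o-- (z - i) 0ℤ | o-- z i | o-f₁₁-z 0ℤ i y z = go (o-01 y) (o-01 z) (o i) i y z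
      where
      go : ∀ {s t} → s ≡ 0ℤ ⊎ s ≡ 1ℤ → t ≡ 0ℤ ⊎ t ≡ 1ℤ → ∀ r i y z →
        (1ℤ - + 2 * ((t ⊻ r) ⊻ 0ℤ)) * ρ ((s ⊻ 0ℤ) ⊻ t) t (z - i - 0ℤ + (z - i - 0ℤ) + 0ℤ) (y + (i + i + 0ℤ) - z) z
          ≡ - ((1ℤ - + 2 * r) * ρ s t (i + i + 0ℤ) y z)
      go (inj₁ refl) (inj₁ refl) = solve 4 (λ r i y z → let s = con 0ℤ; t = con 0ℤ in Lᵖ r s t i y z := :- Rᵖ r s t i y z) refl
      go (inj₁ refl) (inj₂ refl) = solve 4 (λ r i y z → let s = con 0ℤ; t = con 1ℤ in Lᵖ r s t i y z := :- Rᵖ r s t i y z) refl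
      go (inj₂ refl) (inj₁ refl) = solve 4 (λ r i y z → let s = con 1ℤ; t = con 0ℤ in Lᵖ r s t i y z := :- Rᵖ r s t i y z) refl
      go (inj₂ refl) (inj₂ refl) = solve 4 (λ r i y z → let s = con 1ℤ; t = con 1ℤ in Lᵖ r s t i y z := :- Rᵖ r s t i y z) refl

    anti-right : ∀ f → R (right 0ℤ f) ≡ - R f
    anti-right (i , (y , z)) rewrite o-neg (i + y + 0ℤ) | o-+ (i + y) 0ℤ | o-+ i y | o-z-f₁₁ 0ℤ i y z = go (o-01 y) (o-01 z) (o i) i y z
      where
      go : ∀ {s t} → s ≡ 0ℤ ⊎ s ≡ 1ℤ → t ≡ 0ℤ ⊎ t ≡ 1ℤ → ∀ r i y z →
        (1ℤ - + 2 * ((r ⊻ s) ⊻ 0ℤ)) * ρ s (t ⊻ (s ⊻ 0ℤ)) (- (i + y + 0ℤ) + - (i + y + 0ℤ) + 0ℤ) y (z - (y + (i + i + 0ℤ)))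
          ≡ - ((1ℤ - + 2 * r) * ρ s t (i + i + 0ℤ) y z)
      go (inj₁ refl) (inj₁ refl) = solve 4 (λ r i y z → let s = con 0ℤ; t = con 0ℤ in Kᵖ r s t i y z := :- Rᵖ r s t i y z) refl
      go (inj₁ refl) (inj₂ refl) = solve 4 (λ r i y z → let s = con 0ℤ; t = con 1ℤ in Kᵖ r s t i y z := :- Rᵖ r s t i y z) refl
      go (inj₂ refl) (inj₁ refl) = solve 4 (λ r i y z → let s = con 1ℤ; t = con 0ℤ in Kᵖ r s t i y z := :- Rᵖ r s t i y z) refl
      go (inj₂ refl) (inj₂ refl) = solve 4 (λ r i y z → let s = con 1ℤ; t = con 1ℤ in Kᵖ r s t i y z := :- Rᵖ r s t i y z) refl

    R+Rʳ : ∀ {f} → IsForm 0ℤ (+ n) f → R f + R (reflect 0ℤ f) ≡ + 2 * (H f + H (swap-form f))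
    R+Rʳ {i , (y , z)} _ rewrite o-neg (i + 0ℤ) | ℤ.+-identityʳ i = solve 6 (λ r s t i y z →
      (con 1ℤ :- con (+ 2) :* r) :* ((con 1ℤ :- s) :* t :* (y :+ (i :+ i :+ con 0ℤ)) :+ s :* (con 1ℤ :- t) :* (z :- (i :+ i :+ con 0ℤ)) :+ s :* t :* (y :+ z))
      :+ (con 1ℤ :- con (+ 2) :* r) :* ((con 1ℤ :- s) :* t :* (y :+ (:- i :+ :- i :+ con 0ℤ)) :+ s :* (con 1ℤ :- t) :* (z :- (:- i :+ :- i :+ con 0ℤ)) :+ s :* t :* (y :+ z))
      := con (+ 2) :* ((con 1ℤ :- con (+ 2) :* r) :* (t :* y) :+ (con 1ℤ :- con (+ 2) :* r) :* (s :* z))) refl (o i) (o y) (o z) i y z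

    diagonal : List Form
    diagonal = filter (λ f@(i , (y , z)) → z ℤ.≟ f₁₁ 0ℤ f) forms

    enum-diagonal : Enumerates (λ f@(i , (y , z)) → IsForm 0ℤ (+ n) f × z ≡ f₁₁ 0ℤ f) diagonal
    enum-diagonal = enum-filter enum-forms _

    π : Form → ℤ
    π (i , (y , z)) = y + i

    roots : List ℤ
    roots = filter (λ i → sq i ℕ.≟ n) (intRange n)

    fibre : ℤ → ℤ
    fibre k = sumOver (filter (λ f → π f ℤ.≟ k) diagonal) R

    -- On the diagonal y + z = 2(y+i) = 2k, and this must be positive.
    no-fibre : ∀ {k} → ¬ (Pos (k + k)) → fibre k ≡ 0ℤ
    no-fibre {k} k≤0 = sum-zero (filter (λ f → π f ℤ.≟ k) diagonal) (λ m → absurd (enum-filter enum-diagonal (λ f → π f ℤ.≟ k) .sound m))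
      where
      absurd : ∀ {f} → (IsForm 0ℤ (+ n) f × proj₂ (proj₂ f) ≡ f₁₁ 0ℤ f) × π f ≡ k → R f ≡ 0ℤ
      absurd {i , (y , z)} (((y>0 , z>0 , _) , z≡) , refl) = contradiction
        (subst Pos (trans (cong (_+_ y) z≡) (solve 2 (λ y i → y :+ (y :+ (i :+ i :+ con 0ℤ)) := y :+ i :+ (y :+ i)) refl y i)) (pos-+ y>0 z>0)) k≤0

    -- On the diagonal i² + yz = (y+i)², so k = y + i is a square root of n and y ranges over 1,
    -- ..., 2k-1 with z = 2k - y. Only odd y contribute; there are k of them, each giving
    -- -(-1)^k·2k.
    fibre-value : ∀ {m} → let k = + suc m in k * k ≡ + n → fibre k ≡ - ((1ℤ - + 2 * o k) * k * (k + k))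
    fibre-value {m} eq = trans (sum-bij (enum-filter enum-diagonal _) (enum-posRange (m ℕ.+ suc m))
        (λ (i , (y , z)) → y)
        (λ y → k - y , (y , k + k - y))
        (λ { {i , (y , z)} (((y>0 , z>0 , _) , z≡) , π≡) → y>0 , ℤ.i<j⇒i≤pred[j] (<-by z>0 (sym (y+z y i z z≡ π≡))) })
        (λ { {y} (y>0 , y≤) → ((y>0 , pos-- {k + k} (ℤ.i≤pred[j]⇒i<j y≤) ,
             trans (solve 2 (λ k y → (k :- y) :* (k :- y :+ con 0ℤ) :+ y :* (k :+ k :- y) := k :* k) refl k y) eq) ,
             solve 2 (λ k y → k :+ k :- y := y :+ (k :- y :+ (k :- y) :+ con 0ℤ)) refl k y) , i+[j-i]≡j y k })
        (λ { {i , (y , z)} ((_ , z≡) , π≡) → recover y i z z≡ π≡ })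
        (λ _ → refl)
        (λ { {i , (y , z)} ((_ , z≡) , π≡) → cong R (sym (recover y i z z≡ π≡)) }))
      (trans (telescope Q step (m ℕ.+ suc m)) evaluate)
      where
      k = + suc m
      y+z : ∀ y i z → z ≡ y + (i + i + 0ℤ) → y + i ≡ k → y + z ≡ k + k
      y+z y i z refl π≡ = trans (solve 2 (λ y i → y :+ (y :+ (i :+ i :+ con 0ℤ)) := y :+ i :+ (y :+ i)) refl y i) (cong₂ _+_ π≡ π≡)
      recover : ∀ y i z → z ≡ y + (i + i + 0ℤ) → y + i ≡ k → (k - y , (y , k + k - y)) ≡ (i , (y , z))
      recover y i z z≡ π≡ = form-≡ (trans (cong (_- y) (sym π≡)) (i+j-i≡j y i)) refl
        (trans (cong (_- y) (sym (y+z y i z z≡ π≡))) (i+j-i≡j y z))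
      Q : ℤ → ℤ
      Q y = - ((1ℤ - + 2 * o k) * k * (y - o y))
      o-2k-y : ∀ y → o (k + k - y) ≡ o y
      o-2k-y y = trans (o-- (k + k) y) (trans (cong (_⊻ o y) (o-double k)) (solve 1 (λ t → xorᵖ (con 0ℤ) t := t) refl (o y)))
      step : ∀ y → R (k - y , (y , k + k - y)) ≡ Q (1ℤ + y) - Q y
      step y rewrite o-2k-y y | o-- k y | o-suc y = go (o-01 y) (o k) k y
        where
        go : ∀ {s} → s ≡ 0ℤ ⊎ s ≡ 1ℤ → ∀ r k y → (1ℤ - + 2 * (r ⊻ s)) * ρ s s (k - y + (k - y) + 0ℤ) y (k + k - y)
          ≡ - ((1ℤ - + 2 * r) * k * (1ℤ + y - (1ℤ - s))) - - ((1ℤ - + 2 * r) * k * (y - s))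
        go (inj₁ refl) = solve 3 (λ r k y → let s = con 0ℤ in Rᵖ (xorᵖ r s) s s (k :- y) y (k :+ k :- y)
          := :- ((con 1ℤ :- con (+ 2) :* r) :* k :* (con 1ℤ :+ y :- (con 1ℤ :- s))) :- :- ((con 1ℤ :- con (+ 2) :* r) :* k :* (y :- s))) refl
        go (inj₂ refl) = solve 3 (λ r k y → let s = con 1ℤ in Rᵖ (xorᵖ r s) s s (k :- y) y (k :+ k :- y)
          := :- ((con 1ℤ :- con (+ 2) :* r) :* k :* (con 1ℤ :+ y :- (con 1ℤ :- s))) :- :- ((con 1ℤ :- con (+ 2) :* r) :* k :* (y :- s))) refl
      evaluate : Q (k + k) - Q 1ℤ ≡ - ((1ℤ - + 2 * o k) * k * (k + k))
      evaluate rewrite o-double k = solve 2 (λ r k → :- ((con 1ℤ :- con (+ 2) :* r) :* k :* (k :+ k :- con 0ℤ)) :- :- ((con 1ℤ :- con (+ 2) :* r) :* k :* (con 1ℤ :- con 1ℤ))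
        := :- ((con 1ℤ :- con (+ 2) :* r) :* k :* (k :+ k))) refl (o k) k

    G : ℤ → ℤ
    G k = - (+ n * (1ℤ - + 2 * o k))

    fibre-positive : ∀ m → + suc m * + suc m ≡ + n → fibre (+ suc m) + fibre -[1+ m ] ≡ G (+ suc m) + G -[1+ m ]
    fibre-positive m eq = trans (cong₂ _+_ (fibre-value {m} eq) (no-fibre { -[1+ m ]} λ ())) (balance (+ suc m) eq)
      where
      balance : ∀ k → k * k ≡ + n → - ((1ℤ - + 2 * o k) * k * (k + k)) + 0ℤ ≡ G k + G (- k)
      balance k eq = trans (solve 2 (λ r k → :- ((con 1ℤ :- con (+ 2) :* r) :* k :* (k :+ k)) :+ con 0ℤ
        := :- (k :* k :* (con 1ℤ :- con (+ 2) :* r)) :+ :- (k :* k :* (con 1ℤ :- con (+ 2) :* r))) refl (o k) k)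
        (cong₂ (λ N t → - (N * (1ℤ - + 2 * o k)) + - (N * (1ℤ - + 2 * t))) eq (sym (o-neg k)))

    -- The positive root carries the whole contribution -2k²(-1)^k and the negative root none,
    -- whereas θ counts both equally. Hence the comparison is made only for the pair k, -k.
    fibre-symmetric : ∀ {k} → k * k ≡ + n → fibre k + fibre (- k) ≡ G k + G (- k)
    fibre-symmetric {+ zero}   refl = cong₂ _+_ (no-fibre {0ℤ} λ { (ℤ.+<+ ()) }) (no-fibre {0ℤ} λ { (ℤ.+<+ ()) })
    fibre-symmetric {+ suc m}  eq = fibre-positive m eq
    fibre-symmetric { -[1+ m ]} eq = trans (ℤ.+-comm (fibre -[1+ m ]) (fibre (+ suc m)))
      (trans (fibre-positive m eq) (ℤ.+-comm (G (+ suc m)) (G -[1+ m ])))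

    boundary : sumOver diagonal R ≡ - (+ n * θ n)
    boundary = begin
      sumOver diagonal R
        ≡⟨ sum-fibre ℤ._≟_ π (enum-roots-n .unique) diagonal
             (λ m → enum-roots-n .complete (π-sound (enum-diagonal .sound m))) R ⟩
      sumOver roots fibre
        ≡⟨ sum-symmetrize enum-roots-n -_ (λ {k} eq → trans (solve 1 (λ k → (:- k) :* (:- k) := k :* k) refl k) eq)
             (λ {k} _ → ℤ.neg-involutive k) (λ {k} eq → fibre-symmetric {k} eq) ⟩
      sumOver roots G
        ≡⟨ sum-neg roots _ ⟩
      - sumOver roots (λ k → + n * (1ℤ - + 2 * o k))
        ≡⟨ cong -_ (sum-* roots (+ n) _) ⟩
      - (+ n * θ n) ∎
      where
      open ≡-Reasoning
      enum-roots-n : Enumerates (λ i → i * i ≡ + n) roots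
      enum-roots-n = enum-roots ℕ.≤-refl
      π-sound : ∀ {f} → IsForm 0ℤ (+ n) f × proj₂ (proj₂ f) ≡ f₁₁ 0ℤ f → π f * π f ≡ + n
      π-sound {i , (y , z)} ((_ , _ , eq) , refl) = trans
        (solve 2 (λ i y → (y :+ i) :* (y :+ i) := i :* (i :+ con 0ℤ) :+ y :* (y :+ (i :+ i :+ con 0ℤ))) refl i y) eq

    D-θ : D θ n ≡ - + 2 * (θ ⊛ E s₁) n
    D-θ = begin
      + n * θ n                   ≡⟨ ℤ.neg-involutive (+ n * θ n) ⟨
      - - (+ n * θ n)             ≡⟨ cong -_ boundary ⟨
      - sumOver diagonal R        ≡⟨ cong -_ (river enum-forms {R} anti-left anti-right) ⟨
      - sumOver forms R           ≡⟨ cong -_ (symmetrized enum-forms {R} {H} (λ {f} → R+Rʳ {f})) ⟩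
      - (+ 2 * sumOver forms H)   ≡⟨ cong (λ z → - (+ 2 * z)) θ⊛s₁ ⟨
      - (+ 2 * (θ ⊛ E s₁) n)      ≡⟨ ℤ.neg-distribˡ-* (+ 2) _ ⟩
      - + 2 * (θ ⊛ E s₁) n        ∎
      where open ≡-Reasoning

open ThetaSeries

-- The logarithmic derivative of ψ.

module PsiSeries where

  open import Data.Integer using (_+_; _*_; _-_; -_)
  open +-*-Solver using (solve; _:+_; _:*_; _:-_; :-_; con; _:=_; Polynomial)
  open Enumerates

  half-even : ∀ n → parityℕ n ≡ 0ℤ → ℕ.⌊ n /2⌋ ℕ.+ ℕ.⌊ n /2⌋ ≡ n
  half-even 0             _  = refl
  half-even (suc (suc n)) eq = cong suc (trans (ℕ.+-suc ℕ.⌊ n /2⌋ ℕ.⌊ n /2⌋) (cong suc (half-even n eq)))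

  half : ℤ → ℤ
  half z = + ℕ.⌊ ℤ.∣ z ∣ /2⌋

  half-+ : ∀ {z} → Pos z → o z ≡ 0ℤ → half z + half z ≡ z
  half-+ {+ n} _ eq = cong +_ (half-even n eq)

  half-double : ∀ {e} → Pos e → half (e + e) ≡ e
  half-double {+ n} _ = cong +_ (sym (ℕ.n≡⌊n+n/2⌋ n))

  pos-half : ∀ {z} → Pos z → o z ≡ 0ℤ → Pos (half z)
  pos-half {+ suc zero}    _ ()
  pos-half {+ suc (suc n)} _ _ = ℤ.+<+ (s≤s z≤n)
  pos-half {+ zero} (ℤ.+<+ ())

  even-part : ∀ {t} → t ≡ 0ℤ ⊎ t ≡ 1ℤ → ¬ (t ≡ 0ℤ) → ∀ c → (1ℤ - t) * c ≡ 0ℤ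
  even-part (inj₁ refl) ne c = contradiction refl ne
  even-part (inj₂ refl) ne c = refl

  -- The bijection (d , e) ↦ (2d , e/2) from divisor pairs with e even to those with d even.
  halving : ∀ (f : ℤ → ℤ) n → E (λ d e → (1ℤ - o e) * f (d + d)) n ≡ E (λ d e → (1ℤ - o d) * f d) n
  halving f n = begin
    E (λ d e → (1ℤ - o e) * f (d + d)) n
      ≡⟨ drop-odd proj₂ (λ d → f (d + d)) ⟩
    sumOver (filter (λ (d , e) → o e ℤ.≟ 0ℤ) (divisorPairs n)) (λ (d , e) → (1ℤ - o e) * f (d + d))
      ≡⟨ sum-bij (enum-filter pairs-n (λ (d , e) → o e ℤ.≟ 0ℤ)) (enum-filter pairs-n (λ (d , e) → o d ℤ.≟ 0ℤ))
           (λ (d , e) → d + d , half e) (λ (d , e) → half d , e + e)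
           (λ { {d , e} ((d>0 , e>0 , eq) , ev) → (pos-+ d>0 d>0 , pos-half e>0 ev ,
                trans (trans (solve 2 (λ d h → (d :+ d) :* h := d :* (h :+ h)) refl d (half e)) (cong (d *_) (half-+ e>0 ev))) eq) , o-double d })
           (λ { {d , e} ((d>0 , e>0 , eq) , ev) → (pos-half d>0 ev , pos-+ e>0 e>0 ,
                trans (trans (solve 2 (λ h e → h :* (e :+ e) := (h :+ h) :* e) refl (half d) e) (cong (_* e) (half-+ d>0 ev))) eq) , o-double e })
           (λ { ((d>0 , e>0 , _) , ev) → cong₂ _,_ (half-double d>0) (half-+ e>0 ev) })
           (λ { ((d>0 , e>0 , _) , ev) → cong₂ _,_ (half-+ d>0 ev) (half-double e>0) })
           (λ { {d , e} (_ , ev) → cong (λ t → (1ℤ - t) * f (d + d)) (trans ev (sym (o-double d))) }) ⟩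
    sumOver (filter (λ (d , e) → o d ℤ.≟ 0ℤ) (divisorPairs n)) (λ (d , e) → (1ℤ - o d) * f d)
      ≡⟨ drop-odd proj₁ f ⟨
    E (λ d e → (1ℤ - o d) * f d) n ∎
    where
    open ≡-Reasoning
    pairs-n : Enumerates (IsDivisorPair n) (divisorPairs n)
    pairs-n = enum-divisorPairs ℕ.≤-refl
    drop-odd : ∀ (p : ℤ × ℤ → ℤ) (g : ℤ → ℤ) → sumOver (divisorPairs n) (λ q → (1ℤ - o (p q)) * g (proj₁ q)) ≡
      sumOver (filter (λ q → o (p q) ℤ.≟ 0ℤ) (divisorPairs n)) (λ q → (1ℤ - o (p q)) * g (proj₁ q))
    drop-odd p g = trans (sum-split (λ q → o (p q) ℤ.≟ 0ℤ) (divisorPairs n) _)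
      (trans (cong (_+_ (sumOver (filter (λ q → o (p q) ℤ.≟ 0ℤ) (divisorPairs n)) (λ q → (1ℤ - o (p q)) * g (proj₁ q))))
        (sum-zero (filter (λ q → ¬? (o (p q) ℤ.≟ 0ℤ)) (divisorPairs n)) (λ {q} m →
          even-part (o-01 (p q)) (proj₂ (∈-filter⁻ (λ q → ¬? (o (p q) ℤ.≟ 0ℤ)) {xs = divisorPairs n} m)) (g (proj₁ q)))))
        (ℤ.+-identityʳ _))

  triangle : ℕ → ℕ
  triangle t = (t ℕ.* suc t) ℕ./ 2

  triangle-sum : ℕ → ℕ
  triangle-sum zero    = 0
  triangle-sum (suc t) = suc t ℕ.+ triangle-sum t

  triangle-sum-double : ∀ t → + t * (+ t + 1ℤ) ≡ + (triangle-sum t ℕ.* 2)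
  triangle-sum-double zero    = refl
  triangle-sum-double (suc t) = begin
    (1ℤ + + t) * (1ℤ + + t + 1ℤ)          ≡⟨ solve 1 (λ t → (con 1ℤ :+ t) :* (con 1ℤ :+ t :+ con 1ℤ) := (con 1ℤ :+ t) :* con (+ 2) :+ t :* (t :+ con 1ℤ)) refl (+ t) ⟩
    + suc t * + 2 + + t * (+ t + 1ℤ)      ≡⟨ cong₂ _+_ (sym (ℤ.pos-* (suc t) 2)) (triangle-sum-double t) ⟩
    + (suc t ℕ.* 2) + + (triangle-sum t ℕ.* 2) ≡⟨ ℤ.pos-+ (suc t ℕ.* 2) (triangle-sum t ℕ.* 2) ⟨
    + (suc t ℕ.* 2 ℕ.+ triangle-sum t ℕ.* 2)   ≡⟨ cong +_ (ℕ.*-distribʳ-+ 2 (suc t) (triangle-sum t)) ⟨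
    + (triangle-sum (suc t) ℕ.* 2) ∎
    where open ≡-Reasoning

  triangle≡sum : ∀ t → triangle t ≡ triangle-sum t
  triangle≡sum t = trans (cong (ℕ._/ 2) (ℤ.+-injective (trans (ℤ.pos-* t (suc t))
    (trans (cong (+ t *_) (ℤ.+-comm 1ℤ (+ t))) (triangle-sum-double t))))) (m*n/n≡m (triangle-sum t) 2)

  triangle-double : ∀ t → + t * (+ t + 1ℤ) ≡ + triangle t + + triangle t
  triangle-double t = trans (triangle-sum-double t) (trans (ℤ.pos-* (triangle-sum t) 2)
    (trans (solve 1 (λ x → x :* con (+ 2) := x :+ x) refl (+ triangle-sum t)) (cong (λ x → + x + + x) (sym (triangle≡sum t)))))

  t≤triangle : ∀ t → t ℕ.≤ triangle t
  t≤triangle t = subst (t ℕ.≤_) (sym (triangle≡sum t)) (bound t)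
    where
    bound : ∀ t → t ℕ.≤ triangle-sum t
    bound zero    = z≤n
    bound (suc t) = ℕ.m≤m+n (suc t) (triangle-sum t)

  double-injective : ∀ {m n} → + m + + m ≡ + n + + n → m ≡ n
  double-injective {m} {n} eq = ℤ.+-injective (2*-cancel (trans (solve 1 (λ x → con (+ 2) :* x := x :+ x) refl (+ m))
    (trans eq (solve 1 (λ x → x :+ x := con (+ 2) :* x) refl (+ n)))))

  enum-triangles : ∀ {m M} → m ℕ.≤ M →
    Enumerates (λ k → + k * (+ k + 1ℤ) ≡ + m + + m) (filter (λ k → triangle k ℕ.≟ m) (upTo (suc M)))
  enum-triangles {m} {M} m≤M .unique = Unique.filter⁺ (λ k → triangle k ℕ.≟ m) (Unique.upTo⁺ (suc M))
  enum-triangles {m} {M} m≤M .sound {k} k∈ =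
    trans (triangle-double k) (cong (λ x → + x + + x) (proj₂ (∈-filter⁻ (λ k → triangle k ℕ.≟ m) {xs = upTo (suc M)} k∈)))
  enum-triangles {m} {M} m≤M .complete {k} eq =
    let tri≡m = double-injective (trans (sym (triangle-double k)) eq) in
    ∈-filter⁺ (λ k → triangle k ℕ.≟ m) (∈-upTo⁺ (s≤s (ℕ.≤-trans (t≤triangle k) (ℕ.≤-trans (ℕ.≤-reflexive tri≡m) m≤M)))) tri≡m

  ψ : Series
  ψ m = gf triangle (λ _ → 1ℤ) (upTo (suc m)) m

  s₁⁻ : ℤ → ℤ → ℤ
  s₁⁻ d e = (+ 2 * o d - 1ℤ) * d

  module PsiDerivative (m : ℕ) where

    -- Twice the exponent, so that triangular numbers become i(i+1) and the form i(i+1) + yz has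
    -- integral coefficients.
    N : ℤ
    N = + m + + m

    -- One more than 2m, because i = -1 has i(i+1) = 0 and yet absolute value 1.
    box : ℕ
    box = suc (m ℕ.+ m)

    forms : List Form
    forms = filter (λ (i , (y , z)) → i * (i + 1ℤ) + y * z ℤ.≟ N) (cartesianProduct (intRange box) (pairs box))

    pronic : ∀ i → ∃ λ a → i * (i + 1ℤ) ≡ + a × ℤ.∣ i ∣ ℕ.≤ suc a
    pronic (+ n)          = n ℕ.* (n ℕ.+ 1) , sym (ℤ.pos-* n (n ℕ.+ 1)) , ℕ.m≤n⇒m≤1+n (ℕ.≤-trans (ℕ.≤-reflexive (sym (ℕ.*-identityʳ n))) (ℕ.*-monoʳ-≤ n (ℕ.m≤n+m 1 n)))
    pronic -[1+ zero ]    = 0 , refl , ℕ.≤-refl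
    pronic -[1+ suc n ]   = suc (suc n) ℕ.* suc n , refl , ℕ.m≤n⇒m≤1+n (ℕ.m≤m*n (suc (suc n)) (suc n))

    enum-forms : Enumerates (IsForm 1ℤ N) forms
    enum-forms = enum-⇔
      (λ { ((_ , ((y>0 , _) , (z>0 , _))) , eq) → y>0 , z>0 , eq })
      (λ { {i , (y , z)} (y>0 , z>0 , eq) →
           let a , pr , i≤ = pronic i
               sum≡N = ℤ.+-injective (trans (ℤ.pos-+ a (area (y , z))) (trans (cong₂ _+_ (sym pr) (area-pos y>0 z>0)) eq))
               yz≤N = subst (ℤ._≤ + box) (area-pos y>0 z>0) (ℤ.+≤+ (ℕ.m≤n⇒m≤1+n (subst (area (y , z) ℕ.≤_) sum≡N (ℕ.m≤n+m (area (y , z)) a))))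
           in (ℕ.≤-trans i≤ (s≤s (subst (a ℕ.≤_) sum≡N (ℕ.m≤m+n a (area (y , z))))) ,
               ((y>0 , ℤ.≤-trans (proj₁ (pos-≤-product y>0 z>0)) yz≤N) , (z>0 , ℤ.≤-trans (proj₂ (pos-≤-product y>0 z>0)) yz≤N))) , eq })
      (enum-filter (enum-× (enum-intRange box) (enum-× (enum-posRange box) (enum-posRange box))) (λ (i , (y , z)) → i * (i + 1ℤ) + y * z ℤ.≟ N))

    H : Form → ℤ
    H (i , (y , z)) = (1ℤ - o z) * s₁⁻ y z

    TriForm : Set
    TriForm = ℕ × (ℤ × ℤ)

    IsTriForm : TriForm → Set
    IsTriForm (k , (d , e)) = Pos d × Pos e × + k * (+ k + 1ℤ) + d * (e + e) ≡ N

    triForms : List TriForm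
    triForms = filter (λ (k , p) → triangle k ℕ.+ area p ℕ.≟ m) (cartesianProduct (upTo (suc m)) (pairs m))

    enum-upTo : ∀ M → Enumerates (λ k → k ℕ.≤ M) (upTo (suc M))
    enum-upTo M .unique       = Unique.upTo⁺ (suc M)
    enum-upTo M .sound k∈     = ℕ.s≤s⁻¹ (∈-upTo⁻ k∈)
    enum-upTo M .complete k≤M = ∈-upTo⁺ (s≤s k≤M)

    enum-triForms : Enumerates IsTriForm triForms
    enum-triForms = enum-⇔
      (λ { {k , (d , e)} ((_ , ((d>0 , _) , (e>0 , _))) , eq) → d>0 , e>0 , trans (sym (total {k} d>0 e>0)) (cong (λ x → + x + + x) eq) })
      (λ { {k , (d , e)} (d>0 , e>0 , eq) →
           let sum≡m = double-injective (trans (total {k} d>0 e>0) eq)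
               de≤m = subst (ℤ._≤ + m) (area-pos d>0 e>0) (ℤ.+≤+ (subst (area (d , e) ℕ.≤_) sum≡m (ℕ.m≤n+m (area (d , e)) (triangle k))))
           in (ℕ.≤-trans (t≤triangle k) (subst (triangle k ℕ.≤_) sum≡m (ℕ.m≤m+n (triangle k) (area (d , e)))) ,
               ((d>0 , ℤ.≤-trans (proj₁ (pos-≤-product d>0 e>0)) de≤m) , (e>0 , ℤ.≤-trans (proj₂ (pos-≤-product d>0 e>0)) de≤m))) , sum≡m })
      (enum-filter (enum-× (enum-upTo m) (enum-× (enum-posRange m) (enum-posRange m))) (λ (k , p) → triangle k ℕ.+ area p ℕ.≟ m))
      where
      total : ∀ {k d e} → Pos d → Pos e → + (triangle k ℕ.+ area (d , e)) + + (triangle k ℕ.+ area (d , e)) ≡ + k * (+ k + 1ℤ) + d * (e + e)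
      total {k} {d} {e} d>0 e>0 = begin
        + (triangle k ℕ.+ area (d , e)) + + (triangle k ℕ.+ area (d , e))
          ≡⟨ cong (λ x → x + x) (trans (ℤ.pos-+ (triangle k) (area (d , e))) (cong (_+_ (+ triangle k)) (area-pos d>0 e>0))) ⟩
        (+ triangle k + d * e) + (+ triangle k + d * e)
          ≡⟨ solve 3 (λ t d e → (t :+ d :* e) :+ (t :+ d :* e) := (t :+ t) :+ d :* (e :+ e)) refl (+ triangle k) d e ⟩
        (+ triangle k + + triangle k) + d * (e + e)
          ≡⟨ cong (_+ d * (e + e)) (sym (triangle-double k)) ⟩
        + k * (+ k + 1ℤ) + d * (e + e) ∎
        where open ≡-Reasoning

    ψ⊛s₁⁻ : (ψ ⊛ E s₁⁻) m ≡ sumOver triForms (λ (k , (d , e)) → 1ℤ * s₁⁻ d e)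
    ψ⊛s₁⁻ = trans (⊛-cong-≤ {ψ} {gf triangle (λ _ → 1ℤ) (upTo (suc m))} m
        (λ {j} j≤m → sum-enum (enum-triangles {j} {j} ℕ.≤-refl) (enum-triangles {j} {m} j≤m) (λ _ → refl)) (E-box s₁⁻))
      (sym (gf-product _,_ {triangle} {area} (λ _ _ → refl) {λ _ → 1ℤ} {λ (d , e) → s₁⁻ d e} (λ _ _ → refl) (upTo (suc m)) (pairs m) m))

    -- H keeps only even z = 2e, which turns i(i+1) + yz = 2m into a triangular number plus de = m.
    -- The factor 2 arises since i and -1-i give the same triangular number while ψ counts only i ≥
    -- 0.
    sum-H : sumOver forms H ≡ + 2 * (ψ ⊛ E s₁⁻) m
    sum-H = begin
      sumOver forms H
        ≡⟨ sum-split nonneg? forms H ⟩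
      sumOver (filter nonneg? forms) H + sumOver (filter (¬? ∘ nonneg?) forms) H
        ≡⟨ cong (_+_ (sumOver (filter nonneg? forms) H)) negative ⟩
      sumOver (filter nonneg? forms) H + sumOver (filter nonneg? forms) H
        ≡⟨ cong (λ x → x + x) nonnegative ⟩
      (ψ ⊛ E s₁⁻) m + (ψ ⊛ E s₁⁻) m
        ≡⟨ solve 1 (λ x → x :+ x := con (+ 2) :* x) refl ((ψ ⊛ E s₁⁻) m) ⟩
      + 2 * (ψ ⊛ E s₁⁻) m ∎
      where
      open ≡-Reasoning
      nonneg? : Decidable (λ (f : Form) → 0ℤ ℤ.≤ proj₁ f)
      nonneg? (i , _) = 0ℤ ℤ.≤? i
      even? : Decidable (λ (f : Form) → o (proj₂ (proj₂ f)) ≡ 0ℤ)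
      even? (i , (y , z)) = o z ℤ.≟ 0ℤ
      flip⁻ : ∀ i → ¬ 0ℤ ℤ.≤ i → 0ℤ ℤ.≤ - (i + 1ℤ)
      flip⁻ (+ n)          i<0 = contradiction (ℤ.+≤+ z≤n) i<0
      flip⁻ -[1+ zero ]    _   = ℤ.+≤+ z≤n
      flip⁻ -[1+ suc n ]   _   = ℤ.+≤+ z≤n
      flip⁺ : ∀ i → 0ℤ ℤ.≤ i → ¬ 0ℤ ℤ.≤ - (i + 1ℤ)
      flip⁺ (+ n) _ rewrite ℕ.+-comm n 1 = λ ()
      negative : sumOver (filter (¬? ∘ nonneg?) forms) H ≡ sumOver (filter nonneg? forms) H
      negative = sum-bij (enum-filter enum-forms (¬? ∘ nonneg?)) (enum-filter enum-forms nonneg?) (reflect 1ℤ) (reflect 1ℤ)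
        (λ { {f@(i , _)} (p , i<0) → reflect-pres {1ℤ} {N} {f} p , flip⁻ i i<0 })
        (λ { {f@(i , _)} (p , 0≤i) → reflect-pres {1ℤ} {N} {f} p , flip⁺ i 0≤i })
        (λ {f} _ → reflect-inv f) (λ {f} _ → reflect-inv f) (λ _ → refl)
      nonnegative : sumOver (filter nonneg? forms) H ≡ (ψ ⊛ E s₁⁻) m
      nonnegative = begin
        sumOver (filter nonneg? forms) H
          ≡⟨ sum-split even? (filter nonneg? forms) H ⟩
        sumOver (filter even? (filter nonneg? forms)) H + sumOver (filter (¬? ∘ even?) (filter nonneg? forms)) H
          ≡⟨ cong (_+_ (sumOver (filter even? (filter nonneg? forms)) H)) (sum-zero (filter (¬? ∘ even?) (filter nonneg? forms))
               (λ { {i , (y , z)} f∈ → even-part (o-01 z) (proj₂ (∈-filter⁻ (¬? ∘ even?) {xs = filter nonneg? forms} f∈)) (s₁⁻ y z) })) ⟩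
        sumOver (filter even? (filter nonneg? forms)) H + 0ℤ
          ≡⟨ ℤ.+-identityʳ _ ⟩
        sumOver (filter even? (filter nonneg? forms)) H
          ≡⟨ sum-bij (enum-filter (enum-filter enum-forms nonneg?) even?) enum-triForms
               (λ (i , (y , z)) → ℤ.∣ i ∣ , (y , half z))
               (λ (k , (d , e)) → + k , (d , e + e))
               (λ { {i , (y , z)} (((y>0 , z>0 , eq) , 0≤i) , ev) → y>0 , pos-half z>0 ev ,
                    trans (cong₂ (λ a b → a * (a + 1ℤ) + y * b) (ℤ.0≤i⇒+∣i∣≡i 0≤i) (half-+ z>0 ev)) eq })
               (λ { {k , (d , e)} (d>0 , e>0 , eq) → ((d>0 , pos-+ e>0 e>0 , eq) , ℤ.+≤+ z≤n) , o-double e })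
               (λ { {i , (y , z)} (((y>0 , z>0 , eq) , 0≤i) , ev) → form-≡ (ℤ.0≤i⇒+∣i∣≡i 0≤i) refl (half-+ z>0 ev) })
               (λ { {k , (d , e)} (d>0 , e>0 , eq) → cong (λ x → k , (d , x)) (half-double e>0) })
               (λ { {i , (y , z)} (_ , ev) → cong (λ t → (1ℤ - t) * s₁⁻ y z) ev }) ⟩
        sumOver triForms (λ (k , (d , e)) → 1ℤ * s₁⁻ d e)
          ≡⟨ ψ⊛s₁⁻ ⟨
        (ψ ⊛ E s₁⁻) m ∎

    -- With an odd middle coefficient x, either exactly two of f(1,0), f(1,1), f(0,1) are even or
    -- none is. Up to sign this is the difference of the two even values, and zero if there are
    -- none; the signs are chosen so that both river steps reverse it.
    ρ : ℤ → ℤ → ℤ → ℤ → ℤ → ℤ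
    ρ s t x y z = s * (1ℤ - t) * (y + x) + (1ℤ - s) * t * (z - x) - (1ℤ - s) * (1ℤ - t) * (y + z)

    R : Form → ℤ
    R (i , (y , z)) = ρ (o y) (o z) (i + i + 1ℤ) y z

    private
      Rᵖ : ∀ {m} → (s t i y z : Polynomial m) → Polynomial m
      Rᵖ s t i y z = s :* (con 1ℤ :- t) :* (y :+ (i :+ i :+ con 1ℤ)) :+ (con 1ℤ :- s) :* t :* (z :- (i :+ i :+ con 1ℤ))
        :- (con 1ℤ :- s) :* (con 1ℤ :- t) :* (y :+ z)

      Lᵖ : ∀ {m} → (s t i y z : Polynomial m) → Polynomial m
      Lᵖ s t i y z = Rᵖ (xorᵖ (xorᵖ s (con 1ℤ)) t) t (z :- i :- con 1ℤ) (y :+ (i :+ i :+ con 1ℤ) :- z) z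

      Kᵖ : ∀ {m} → (s t i y z : Polynomial m) → Polynomial m
      Kᵖ s t i y z = Rᵖ s (xorᵖ t (xorᵖ s (con 1ℤ))) (:- (i :+ y :+ con 1ℤ)) y (z :- (y :+ (i :+ i :+ con 1ℤ)))

    anti-left : ∀ f → R (left 1ℤ f) ≡ - R f
    anti-left (i , (y , z)) rewrite o-f₁₁-z 1ℤ i y z = go (o-01 y) (o-01 z) i y z
      where
      go : ∀ {s t} → s ≡ 0ℤ ⊎ s ≡ 1ℤ → t ≡ 0ℤ ⊎ t ≡ 1ℤ → ∀ i y z →
        ρ ((s ⊻ 1ℤ) ⊻ t) t (z - i - 1ℤ + (z - i - 1ℤ) + 1ℤ) (y + (i + i + 1ℤ) - z) z ≡ - ρ s t (i + i + 1ℤ) y z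
      go (inj₁ refl) (inj₁ refl) = solve 3 (λ i y z → let s = con 0ℤ; t = con 0ℤ in Lᵖ s t i y z := :- Rᵖ s t i y z) refl
      go (inj₁ refl) (inj₂ refl) = solve 3 (λ i y z → let s = con 0ℤ; t = con 1ℤ in Lᵖ s t i y z := :- Rᵖ s t i y z) refl
      go (inj₂ refl) (inj₁ refl) = solve 3 (λ i y z → let s = con 1ℤ; t = con 0ℤ in Lᵖ s t i y z := :- Rᵖ s t i y z) refl
      go (inj₂ refl) (inj₂ refl) = solve 3 (λ i y z → let s = con 1ℤ; t = con 1ℤ in Lᵖ s t i y z := :- Rᵖ s t i y z) refl

    anti-right : ∀ f → R (right 1ℤ f) ≡ - R f
    anti-right (i , (y , z)) rewrite o-z-f₁₁ 1ℤ i y z = go (o-01 y) (o-01 z) i y z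
      where
      go : ∀ {s t} → s ≡ 0ℤ ⊎ s ≡ 1ℤ → t ≡ 0ℤ ⊎ t ≡ 1ℤ → ∀ i y z →
        ρ s (t ⊻ (s ⊻ 1ℤ)) (- (i + y + 1ℤ) + - (i + y + 1ℤ) + 1ℤ) y (z - (y + (i + i + 1ℤ))) ≡ - ρ s t (i + i + 1ℤ) y z
      go (inj₁ refl) (inj₁ refl) = solve 3 (λ i y z → let s = con 0ℤ; t = con 0ℤ in Kᵖ s t i y z := :- Rᵖ s t i y z) refl
      go (inj₁ refl) (inj₂ refl) = solve 3 (λ i y z → let s = con 0ℤ; t = con 1ℤ in Kᵖ s t i y z := :- Rᵖ s t i y z) refl
      go (inj₂ refl) (inj₁ refl) = solve 3 (λ i y z → let s = con 1ℤ; t = con 0ℤ in Kᵖ s t i y z := :- Rᵖ s t i y z) refl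
      go (inj₂ refl) (inj₂ refl) = solve 3 (λ i y z → let s = con 1ℤ; t = con 1ℤ in Kᵖ s t i y z := :- Rᵖ s t i y z) refl

    R+Rʳ : ∀ {f} → IsForm 1ℤ N f → R f + R (reflect 1ℤ f) ≡ + 2 * (H f + H (swap-form f))
    R+Rʳ {i , (y , z)} _ = solve 5 (λ s t i y z → Rᵖ s t i y z :+ Rᵖ s t (:- (i :+ con 1ℤ)) y z
      := con (+ 2) :* ((con 1ℤ :- t) :* ((con (+ 2) :* s :- con 1ℤ) :* y) :+ (con 1ℤ :- s) :* ((con (+ 2) :* t :- con 1ℤ) :* z))) refl (o y) (o z) i y z

    diagonal : List Form
    diagonal = filter (λ f@(i , (y , z)) → z ℤ.≟ f₁₁ 1ℤ f) forms

    enum-diagonal : Enumerates (λ f@(i , (y , z)) → IsForm 1ℤ N f × z ≡ f₁₁ 1ℤ f) diagonal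
    enum-diagonal = enum-filter enum-forms _

    π : Form → ℕ
    π (i , (y , z)) = ℤ.∣ y + i ∣

    indices : List ℕ
    indices = filter (λ k → triangle k ℕ.≟ m) (upTo (suc m))

    enum-indices : Enumerates (λ k → + k * (+ k + 1ℤ) ≡ N) indices
    enum-indices = enum-triangles {m} {m} ℕ.≤-refl

    -- On the diagonal y + z = 2(y+i) + 1 is positive, which forces y + i ≥ 0. Unlike for θ, no
    -- second sign has to be averaged over.
    abs-index : ∀ {i y z} → Pos y → Pos z → z ≡ y + (i + i + 1ℤ) → + ℤ.∣ y + i ∣ ≡ y + i
    abs-index {i} {y} {z} y>0 z>0 refl = nonneg (y + i) (subst Pos
      (solve 2 (λ y i → y :+ (y :+ (i :+ i :+ con 1ℤ)) := (y :+ i) :+ (y :+ i) :+ con 1ℤ) refl y i) (pos-+ y>0 z>0))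
      where
      nonneg : ∀ w → Pos (w + w + 1ℤ) → + ℤ.∣ w ∣ ≡ w
      nonneg (+ n)     _ = refl
      nonneg -[1+ n ] ()

    -- Here y ranges over 1, ..., 2k with z = 2k + 1 - y. Even y contribute y and odd y contribute
    -- z, which is then even; each kind adds up to k(k+1).
    fibre-value : ∀ {k} → + k * (+ k + 1ℤ) ≡ N → sumOver (filter (λ f → π f ℕ.≟ k) diagonal) R ≡ + 2 * N
    fibre-value {k} eq = trans (sum-bij (enum-filter enum-diagonal _) (enum-posRange (k ℕ.+ k))
        (λ (i , (y , z)) → y)
        (λ y → + k - y , (y , c - y))
        (λ { {i , (y , z)} (((y>0 , z>0 , _) , z≡) , π≡) → y>0 , ℤ.i<j⇒i≤pred[j] {y} {c} (<-by z>0 (sym (y+z {i} y>0 z>0 z≡ π≡))) })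
        (λ { {y} (y>0 , y≤) → ((y>0 , pos-- {c} (ℤ.i≤pred[j]⇒i<j y≤) ,
             trans (solve 2 (λ k y → (k :- y) :* (k :- y :+ con 1ℤ) :+ y :* (con 1ℤ :+ (k :+ k) :- y) := k :* (k :+ con 1ℤ)) refl (+ k) y) eq) ,
             solve 2 (λ k y → con 1ℤ :+ (k :+ k) :- y := y :+ (k :- y :+ (k :- y) :+ con 1ℤ)) refl (+ k) y) , cong ℤ.∣_∣ (i+[j-i]≡j y (+ k)) })
        (λ { {i , (y , z)} (((y>0 , z>0 , _) , z≡) , π≡) → recover y>0 z>0 z≡ π≡ })
        (λ _ → refl)
        (λ { {i , (y , z)} (((y>0 , z>0 , _) , z≡) , π≡) → cong R (sym (recover y>0 z>0 z≡ π≡)) }))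
      (trans (telescope Q step (k ℕ.+ k)) (trans evaluate (cong (+ 2 *_) eq)))
      where
      c = + suc (k ℕ.+ k)
      y+i≡k : ∀ {i y z} → Pos y → Pos z → z ≡ y + (i + i + 1ℤ) → ℤ.∣ y + i ∣ ≡ k → y + i ≡ + k
      y+i≡k y>0 z>0 z≡ π≡ = trans (sym (abs-index y>0 z>0 z≡)) (cong +_ π≡)
      y+z : ∀ {i y z} → Pos y → Pos z → z ≡ y + (i + i + 1ℤ) → ℤ.∣ y + i ∣ ≡ k → y + z ≡ c
      y+z {i} {y} {z} y>0 z>0 z≡ π≡ = trans (cong (_+_ y) z≡)
        (trans (solve 2 (λ y i → y :+ (y :+ (i :+ i :+ con 1ℤ)) := con 1ℤ :+ ((y :+ i) :+ (y :+ i))) refl y i)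
          (cong (λ w → 1ℤ + (w + w)) (y+i≡k {i} y>0 z>0 z≡ π≡)))
      recover : ∀ {i y z} → Pos y → Pos z → z ≡ y + (i + i + 1ℤ) → ℤ.∣ y + i ∣ ≡ k → (+ k - y , (y , c - y)) ≡ (i , (y , z))
      recover {i} {y} {z} y>0 z>0 z≡ π≡ = form-≡ (trans (cong (_- y) (sym (y+i≡k {i} y>0 z>0 z≡ π≡))) (i+j-i≡j y i)) refl
        (trans (cong (_- y) (sym (y+z {i} y>0 z>0 z≡ π≡))) (i+j-i≡j y z))
      Q : ℤ → ℤ
      -- At odd y only the even numbers below y have been passed on either side, so the running sum
      -- is quadratic only through k; the linear shape in y comes from pairing an odd y with its
      -- successor, which together contribute 2k + 2.
      Q y = o y * ((y - 1ℤ) * (+ k + 1ℤ)) + (1ℤ - o y) * (y * + k)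
      o-c : o c ≡ 1ℤ
      o-c = trans (o-suc (+ k + + k)) (cong (_-_ 1ℤ) (o-double (+ k)))
      step : ∀ y → R (+ k - y , (y , c - y)) ≡ Q (1ℤ + y) - Q y
      step y rewrite o-- c y | o-c | o-suc y = go (o-01 y) (+ k) y
        where
        go : ∀ {s} → s ≡ 0ℤ ⊎ s ≡ 1ℤ → ∀ k y → ρ s (1ℤ ⊻ s) (k - y + (k - y) + 1ℤ) y (1ℤ + (k + k) - y)
          ≡ ((1ℤ - s) * ((1ℤ + y - 1ℤ) * (k + 1ℤ)) + (1ℤ - (1ℤ - s)) * ((1ℤ + y) * k)) - (s * ((y - 1ℤ) * (k + 1ℤ)) + (1ℤ - s) * (y * k))
        go (inj₁ refl) = solve 2 (λ k y → let s = con 0ℤ in Rᵖ s (xorᵖ (con 1ℤ) s) (k :- y) y (con 1ℤ :+ (k :+ k) :- y)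
          := ((con 1ℤ :- s) :* ((con 1ℤ :+ y :- con 1ℤ) :* (k :+ con 1ℤ)) :+ (con 1ℤ :- (con 1ℤ :- s)) :* ((con 1ℤ :+ y) :* k)) :- (s :* ((y :- con 1ℤ) :* (k :+ con 1ℤ)) :+ (con 1ℤ :- s) :* (y :* k))) refl
        go (inj₂ refl) = solve 2 (λ k y → let s = con 1ℤ in Rᵖ s (xorᵖ (con 1ℤ) s) (k :- y) y (con 1ℤ :+ (k :+ k) :- y)
          := ((con 1ℤ :- s) :* ((con 1ℤ :+ y :- con 1ℤ) :* (k :+ con 1ℤ)) :+ (con 1ℤ :- (con 1ℤ :- s)) :* ((con 1ℤ :+ y) :* k)) :- (s :* ((y :- con 1ℤ) :* (k :+ con 1ℤ)) :+ (con 1ℤ :- s) :* (y :* k))) refl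
      evaluate : Q c - Q 1ℤ ≡ + 2 * (+ k * (+ k + 1ℤ))
      evaluate rewrite o-c = solve 1 (λ k → let Q′ = λ y → con 1ℤ :* ((y :- con 1ℤ) :* (k :+ con 1ℤ)) :+ (con 1ℤ :- con 1ℤ) :* (y :* k) in
        Q′ (con 1ℤ :+ (k :+ k)) :- Q′ (con 1ℤ) := con (+ 2) :* (k :* (k :+ con 1ℤ))) refl (+ k)

    boundary : sumOver diagonal R ≡ + 4 * (+ m * ψ m)
    boundary = begin
      sumOver diagonal R
        ≡⟨ sum-fibre ℕ._≟_ π (enum-indices .unique) diagonal (λ f∈ → enum-indices .complete (π-sound (enum-diagonal .sound f∈))) R ⟩
      sumOver indices (λ k → sumOver (filter (λ f → π f ℕ.≟ k) diagonal) R)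
        ≡⟨ sum-cong indices (λ {k} k∈ → trans (fibre-value {k} (enum-indices .sound k∈)) (sym (ℤ.*-identityʳ (+ 2 * N)))) ⟩
      sumOver indices (λ _ → + 2 * N * 1ℤ)
        ≡⟨ sum-* indices (+ 2 * N) (λ _ → 1ℤ) ⟩
      + 2 * N * ψ m
        ≡⟨ solve 2 (λ m p → con (+ 2) :* (m :+ m) :* p := con (+ 4) :* (m :* p)) refl (+ m) (ψ m) ⟩
      + 4 * (+ m * ψ m) ∎
      where
      open ≡-Reasoning
      π-sound : ∀ {f} → IsForm 1ℤ N f × proj₂ (proj₂ f) ≡ f₁₁ 1ℤ f → + π f * (+ π f + 1ℤ) ≡ N
      π-sound {i , (y , z)} ((y>0 , z>0 , eq) , z≡) = trans (cong (λ w → w * (w + 1ℤ)) (abs-index {i} y>0 z>0 z≡))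
        (trans (solve 2 (λ i y → (y :+ i) :* (y :+ i :+ con 1ℤ) := i :* (i :+ con 1ℤ) :+ y :* (y :+ (i :+ i :+ con 1ℤ))) refl i y)
          (trans (cong (λ w → i * (i + 1ℤ) + y * w) (sym z≡)) eq))

    D-ψ : D ψ m ≡ (ψ ⊛ E s₁⁻) m
    D-ψ = ℤ.*-cancelˡ-≡ (+ 4) (D ψ m) ((ψ ⊛ E s₁⁻) m) (begin
      + 4 * (+ m * ψ m)             ≡⟨ boundary ⟨
      sumOver diagonal R            ≡⟨ river enum-forms {R} anti-left anti-right ⟨
      sumOver forms R               ≡⟨ symmetrized enum-forms {R} {H} (λ {f} → R+Rʳ {f}) ⟩
      + 2 * sumOver forms H         ≡⟨ cong (+ 2 *_) sum-H ⟩
      + 2 * (+ 2 * (ψ ⊛ E s₁⁻) m)   ≡⟨ solve 1 (λ x → con (+ 2) :* (con (+ 2) :* x) := con (+ 4) :* x) refl ((ψ ⊛ E s₁⁻) m) ⟩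
      + 4 * (ψ ⊛ E s₁⁻) m           ∎)
      where open ≡-Reasoning

open PsiSeries

-- Eighth powers of θ and ψ, and the identity for sixteen squares over the integers.

module SixteenSquares where

  open import Data.Integer using (_+_; _*_; _-_; -_)
  open +-*-Solver using (solve; _:+_; _:*_; _:-_; :-_; con; _:=_; Polynomial)
  open Enumerates

  star : ∀ (f : ℤ → ℤ) n → E (λ d e → f d - + 2 * ((1ℤ - o e) * f (d + d))) n ≡ E (λ d e → (+ 2 * o d - 1ℤ) * f d) n
  star f n = begin
    E (λ d e → f d - + 2 * ((1ℤ - o e) * f (d + d))) n
      ≡⟨ E-sub (λ d _ → f d) (λ d e → + 2 * ((1ℤ - o e) * f (d + d))) n ⟨
    E (λ d _ → f d) n - E (λ d e → + 2 * ((1ℤ - o e) * f (d + d))) n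
      ≡⟨ cong (_-_ (E (λ d _ → f d) n)) (trans (E-* (+ 2) (λ d e → (1ℤ - o e) * f (d + d)) n)
           (trans (cong (+ 2 *_) (halving f n)) (sym (E-* (+ 2) (λ d e → (1ℤ - o d) * f d) n)))) ⟩
    E (λ d _ → f d) n - E (λ d e → + 2 * ((1ℤ - o d) * f d)) n
      ≡⟨ E-sub (λ d _ → f d) (λ d e → + 2 * ((1ℤ - o d) * f d)) n ⟩
    E (λ d e → f d - + 2 * ((1ℤ - o d) * f d)) n
      ≡⟨ E-cong (λ {d} _ _ → solve 2 (λ t c → c :- con (+ 2) :* ((con 1ℤ :- t) :* c) := (con (+ 2) :* t :- con 1ℤ) :* c) refl (o d) (f d)) n ⟩
    E (λ d e → (+ 2 * o d - 1ℤ) * f d) n ∎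
    where open ≡-Reasoning

  s₁*-star : ∀ n → E s₁* n ≡ E s₁⁻ n
  s₁*-star n = trans (E-cong (λ {d} {e} _ _ → solve 2 (λ t d → (con (+ 4) :* t :- con (+ 3)) :* d
    := d :- con (+ 2) :* ((con 1ℤ :- t) :* (d :+ d))) refl (o e) d) n) (star id n)

  s₃*-star : ∀ n → E s₃* n ≡ E (λ d e → (+ 2 * o d - 1ℤ) * cube d) n
  s₃*-star n = trans (E-cong (λ {d} {e} _ _ → solve 2 (λ t d → (con (+ 16) :* t :- con (+ 15)) :* (d :* d :* d)
    := d :* d :* d :- con (+ 2) :* ((con 1ℤ :- t) :* ((d :+ d) :* (d :+ d) :* (d :+ d)))) refl (o e) d) n) (star cube n)

  s₇*-star : ∀ n → E s₇* n ≡ E (λ d e → (+ 2 * o d - 1ℤ) * seventh d) n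
  s₇*-star n = trans (E-cong (λ {d} {e} _ _ → pointwise (o-01 e) d) n) (star seventh n)
    where
    pointwise : ∀ {t} → t ≡ 0ℤ ⊎ t ≡ 1ℤ → ∀ d → (1ℤ - + 256 * (1ℤ - t)) * seventh d ≡ seventh d - + 2 * ((1ℤ - t) * seventh (d + d))
    pointwise (inj₁ refl) = solve 1 (λ d → let e = d :+ d; t = con 0ℤ in (con 1ℤ :- con (+ 256) :* (con 1ℤ :- t)) :* (d :* d :* d :* (d :* d :* d) :* d)
      := d :* d :* d :* (d :* d :* d) :* d :- con (+ 2) :* ((con 1ℤ :- t) :* (e :* e :* e :* (e :* e :* e) :* e))) refl
    pointwise (inj₂ refl) d = solve 2 (λ c e → (con 1ℤ :- con (+ 256) :* (con 1ℤ :- con 1ℤ)) :* c := c :- con (+ 2) :* ((con 1ℤ :- con 1ℤ) :* e)) refl (seventh d) (seventh (d + d))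

  -- The tail of `E s₃` divides off the factor q. Its derivation then loses exactly one copy of the
  -- series, which cancels the first term of `E-s₃` and leaves the equation of ψ⁸.
  ψ⁸ : ∀ n → power ψ 8 n ≡ E s₃ (suc n)
  ψ⁸ = D-unique {power ψ 8} {tail (E s₃)} {E s₁*} (+ 8) refl refl (D-power {ψ} {E s₁*} Dψ 8) DT
    where
    open ≡-Reasoning
    Dψ : ∀ n → D ψ n ≡ (E s₁* ⊛ ψ) n
    Dψ n = trans (PsiDerivative.D-ψ n) (trans (⊛-comm ψ (E s₁⁻) n) (⊛-cong {g = ψ} (λ j → sym (s₁*-star j)) (λ _ → refl) n))
    DT : ∀ n → D (tail (E s₃)) n ≡ + 8 * (E s₁* ⊛ tail (E s₃)) n
    DT n = begin
      + n * E s₃ (suc n)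
        ≡⟨ solve 2 (λ n t → n :* t := (con 1ℤ :+ n) :* t :- t) refl (+ n) (E s₃ (suc n)) ⟩
      + suc n * E s₃ (suc n) - E s₃ (suc n)
        ≡⟨ cong (_- E s₃ (suc n)) (E-s₃ (suc n)) ⟩
      E s₃ (suc n) + + 8 * (E s₁* ⊛ E s₃) (suc n) - E s₃ (suc n)
        ≡⟨ i+j-i≡j (E s₃ (suc n)) _ ⟩
      + 8 * (E s₁* ⊛ E s₃) (suc n)
        ≡⟨ cong (+ 8 *_) (⊛-sucʳ (E s₁*) (E s₃) n) ⟩
      + 8 * (E s₁* (suc n) * 0ℤ + (E s₁* ⊛ tail (E s₃)) n)
        ≡⟨ cong (λ z → + 8 * (z + (E s₁* ⊛ tail (E s₃)) n)) (ℤ.*-zeroʳ (E s₁* (suc n))) ⟩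
      + 8 * (0ℤ + (E s₁* ⊛ tail (E s₃)) n)
        ≡⟨ cong (+ 8 *_) (ℤ.+-identityˡ _) ⟩
      + 8 * (E s₁* ⊛ tail (E s₃)) n ∎

  -- The Eisenstein series of weight four that equals θ⁸; up to the factor -16 its coefficients are
  -- σ₃*, the value at 0 included.
  Eis : Series
  Eis = one ⊕ (- + 16 · E s₃*)

  ⊛-Eis : ∀ f n → (f ⊛ Eis) n ≡ f n + - + 16 * (f ⊛ E s₃*) n
  ⊛-Eis f n = trans (⊛-distribˡ f one (- + 16 · E s₃*) n)
    (cong₂ _+_ (trans (⊛-comm f one n) (⊛-identityˡ f n)) (⊛-scaleʳ (- + 16) f (E s₃*) n))

  θ⁸ : ∀ n → power θ 8 n ≡ Eis n
  θ⁸ = D-unique {power θ 8} {Eis} { - + 2 · E s₁} (+ 8) refl refl (D-power {θ} { - + 2 · E s₁} Dθ 8) DA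
    where
    open ≡-Reasoning
    Dθ : ∀ n → D θ n ≡ ((- + 2 · E s₁) ⊛ θ) n
    Dθ n = trans (ThetaDerivative.D-θ n) (trans (cong (- + 2 *_) (⊛-comm θ (E s₁) n)) (sym (⊛-scaleˡ (- + 2) (E s₁) θ n)))
    n*one : ∀ n → + n * one n ≡ 0ℤ
    n*one zero    = refl
    n*one (suc n) = ℤ.*-zeroʳ (+ suc n)
    DA : ∀ n → D Eis n ≡ + 8 * ((- + 2 · E s₁) ⊛ Eis) n
    DA n = begin
      + n * (one n + - + 16 * E s₃* n)
        ≡⟨ solve 3 (λ n u s → n :* (u :+ con (- + 16) :* s) := n :* u :+ con (- + 16) :* (n :* s)) refl (+ n) (one n) (E s₃* n) ⟩
      + n * one n + - + 16 * (+ n * E s₃* n)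
        ≡⟨ cong₂ (λ x y → x + - + 16 * y) (n*one n) (E-s₃* n) ⟩
      0ℤ + - + 16 * (E s₁ n - + 16 * (E s₁ ⊛ E s₃*) n)
        ≡⟨ solve 2 (λ s c → con 0ℤ :+ con (- + 16) :* (s :- con (+ 16) :* c) := con (+ 8) :* (con (- + 2) :* (s :+ con (- + 16) :* c))) refl (E s₁ n) ((E s₁ ⊛ E s₃*) n) ⟩
      + 8 * (- + 2 * (E s₁ n + - + 16 * (E s₁ ⊛ E s₃*) n))
        ≡⟨ cong (λ z → + 8 * (- + 2 * z)) (sym (⊛-Eis (E s₁) n)) ⟩
      + 8 * (- + 2 * (E s₁ ⊛ Eis) n)
        ≡⟨ cong (+ 8 *_) (sym (⊛-scaleˡ (- + 2) (E s₁) Eis n)) ⟩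
      + 8 * ((- + 2 · E s₁) ⊛ Eis) n ∎

  sign-parity : ∀ n → (- 1ℤ) ℤ.^ n ≡ 1ℤ - + 2 * parityℕ n
  sign-parity zero    = refl
  sign-parity (suc n) = trans (cong (- 1ℤ *_) (sign-parity n))
    (trans (solve 1 (λ t → con (- 1ℤ) :* (con 1ℤ :- con (+ 2) :* t) := con 1ℤ :- con (+ 2) :* (con 1ℤ :- t)) refl (parityℕ n))
      (cong (λ t → 1ℤ - + 2 * t) (sym (parityℕ-suc n))))

  sign-square : ∀ n → (- 1ℤ) ℤ.^ n * (- 1ℤ) ℤ.^ n ≡ 1ℤ
  sign-square zero    = refl
  sign-square (suc n) = trans (solve 1 (λ s → con (- 1ℤ) :* s :* (con (- 1ℤ) :* s) := s :* s) refl ((- 1ℤ) ℤ.^ n)) (sign-square n)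

  sumSqℤ-weight : ∀ {s} (v : Vec ℤ s) → sumSqℤ v ≡ + weightSum sq v
  sumSqℤ-weight []      = refl
  sumSqℤ-weight (i ∷ v) = trans (cong₂ _+_ (sym (+sq i)) (sumSqℤ-weight v)) (sym (ℤ.pos-+ (sq i) (weightSum sq v)))

  r-power : ∀ s n → + r s n ≡ power (gf sq (λ _ → 1ℤ) (intRange n)) s n
  r-power s n = begin
    + r s n
      ≡⟨ cong (λ l → + length l) (filter-≐ (λ v → sumSqℤ v ℤ.≟ + n) (λ v → weightSum sq v ℕ.≟ n)
           ((λ {v} eq → ℤ.+-injective (trans (sym (sumSqℤ-weight v)) eq)) , (λ {v} eq → trans (sumSqℤ-weight v) (cong +_ eq)))
           (tuples s (intRange n))) ⟩
    + length (filter (λ v → weightSum sq v ℕ.≟ n) (tuples s (intRange n)))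
      ≡⟨ length-as-sum (filter (λ v → weightSum sq v ℕ.≟ n) (tuples s (intRange n))) ⟩
    gf (weightSum sq) (λ _ → 1ℤ) (tuples s (intRange n)) n
      ≡⟨ gf-tuples sq s (intRange n) n ⟩
    power (gf sq (λ _ → 1ℤ) (intRange n)) s n ∎
    where open ≡-Reasoning

  -- Since i² and i have the same parity, q ↦ -q turns q^{i²} into (-1)^i q^{i²}. The bound j ≤ n
  -- appears because the box on the left is fixed at n.
  twist-squares : ∀ n {j} → j ℕ.≤ n → twist (gf sq (λ _ → 1ℤ) (intRange n)) j ≡ θ j
  twist-squares n {j} j≤n = trans (sym (sum-* (filter (λ i → sq i ℕ.≟ j) (intRange n)) ((- 1ℤ) ℤ.^ j) (λ _ → 1ℤ)))
    (sum-enum (enum-roots {j} {n} j≤n) (enum-roots {j} {j} ℕ.≤-refl) (λ {i} eq → trans (ℤ.*-identityʳ _)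
      (trans (sign-parity j) (cong (λ t → 1ℤ - + 2 * t) (trans (cong o (sym eq)) (trans (o-* i i) (idempotent (o-01 i))))))))
    where
    idempotent : ∀ {t} → t ≡ 0ℤ ⊎ t ≡ 1ℤ → t * t ≡ t
    idempotent (inj₁ refl) = refl
    idempotent (inj₂ refl) = refl

  r₁₆ : ∀ n → (- 1ℤ) ℤ.^ n * + r 16 n ≡ (Eis ⊛ Eis) n
  r₁₆ n = begin
    (- 1ℤ) ℤ.^ n * + r 16 n                              ≡⟨ cong ((- 1ℤ) ℤ.^ n *_) (r-power 16 n) ⟩
    twist (power (gf sq (λ _ → 1ℤ) (intRange n)) 16) n   ≡⟨ twist-power (gf sq (λ _ → 1ℤ) (intRange n)) 16 n ⟩
    power (twist (gf sq (λ _ → 1ℤ) (intRange n))) 16 n   ≡⟨ power-cong-≤ 16 n (twist-squares n) ⟩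
    power θ 16 n                                         ≡⟨ power-+ θ 8 8 n ⟩
    (power θ 8 ⊛ power θ 8) n                            ≡⟨ ⊛-cong θ⁸ θ⁸ n ⟩
    (Eis ⊛ Eis) n                                            ∎
    where open ≡-Reasoning

  δ₈-E : ∀ n → + δ₈ n ≡ E s₃ (suc n)
  δ₈-E n = begin
    + δ₈ n
      ≡⟨ length-as-sum (filter (λ v → weightSum triangle v ℕ.≟ n) (tuples 8 (upTo (suc n)))) ⟩
    gf (weightSum triangle) (λ _ → 1ℤ) (tuples 8 (upTo (suc n))) n
      ≡⟨ gf-tuples triangle 8 (upTo (suc n)) n ⟩
    power (gf triangle (λ _ → 1ℤ) (upTo (suc n))) 8 n
      ≡⟨ power-cong-≤ 8 n (λ {j} j≤n → sum-enum (enum-triangles {j} {n} j≤n) (enum-triangles {j} {j} ℕ.≤-refl) (λ _ → refl)) ⟩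
    power ψ 8 n
      ≡⟨ ψ⁸ n ⟩
    E s₃ (suc n) ∎
    where open ≡-Reasoning

  -- The value at divisor 0 is a filler that makes the map total; it is applied only to positive
  -- divisors.
  quotient : ℕ → ℕ → ℕ
  quotient n zero    = 0
  quotient n (suc d) = n ℕ./ suc d

  enum-divisors : ∀ n → Enumerates (λ d → (∃ λ k → d ≡ suc k) × d ∣ suc n) (divisors (suc n))
  enum-divisors n .unique = Unique.filter⁺ (_∣? suc n) (Unique.applyUpTo⁺₁ suc (suc n) (λ i<j _ eq → ℕ.<⇒≢ i<j (ℕ.suc-injective eq)))
  enum-divisors n .sound {d} d∈ with ∈-filter⁻ (_∣? suc n) {xs = applyUpTo suc (suc n)} d∈
  ... | d∈′ , d∣n with ∈-applyUpTo⁻ suc d∈′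
  ...   | k , _ , eq = (k , eq) , d∣n
  enum-divisors n .complete {.(suc k)} ((k , refl) , d∣n) =
    ∈-filter⁺ (_∣? suc n) (∈-applyUpTo⁺ suc (∣⇒≤ d∣n)) d∣n

  -- A divisor d corresponds to the pair (d , n/d), and -(-1)^d is 2·o(d) - 1.
  σ*-E : ∀ s n → σ* s (suc n) ≡ E (λ d e → (+ 2 * o d - 1ℤ) * + (ℤ.∣ d ∣ ℕ.^ s)) (suc n)
  σ*-E s n = begin
    - foldr _+_ 0ℤ (map term (divisors (suc n)))          ≡⟨ cong -_ (foldr-map (divisors (suc n))) ⟩
    - sumOver (divisors (suc n)) term                     ≡⟨ sum-neg (divisors (suc n)) term ⟨
    sumOver (divisors (suc n)) (λ d → - term d)
      ≡⟨ sum-bij (enum-divisors n) (enum-divisorPairs {suc n} ℕ.≤-refl)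
           (λ d → + d , + quotient (suc n) d) (λ (d , e) → ℤ.∣ d ∣)
           (λ { ((k , refl) , d∣n) → ℤ.+<+ (s≤s z≤n) , pos-quotient k d∣n ,
                trans (sym (ℤ.pos-* (suc k) (suc n ℕ./ suc k))) (cong +_ (trans (ℕ.*-comm (suc k) (suc n ℕ./ suc k)) (m/n*n≡m d∣n))) })
           (λ { {+ suc k , + e} (_ , _ , eq) → (k , refl) ,
                divides e (ℤ.+-injective (trans (sym eq) (trans (sym (ℤ.pos-* (suc k) e)) (cong +_ (ℕ.*-comm (suc k) e)))))
              ; {+ zero , _} (ℤ.+<+ () , _) })
           (λ _ → refl)
           (λ { {+ suc k , + e} (_ , _ , eq) → cong (λ q → + suc k , + q)
                (trans (cong (ℕ._/ suc k) (ℤ.+-injective (trans (sym eq) (trans (sym (ℤ.pos-* (suc k) e)) (cong +_ (ℕ.*-comm (suc k) e))))))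
                  (m*n/n≡m e (suc k)))
              ; {+ zero , _} (ℤ.+<+ () , _) })
           (λ {d} _ → trans (cong (λ x → - (x * + (d ℕ.^ s))) (sign-parity d))
             (solve 2 (λ t c → :- ((con 1ℤ :- con (+ 2) :* t) :* c) := (con (+ 2) :* t :- con 1ℤ) :* c) refl (parityℕ d) (+ (d ℕ.^ s)))) ⟩
    E (λ d e → (+ 2 * o d - 1ℤ) * + (ℤ.∣ d ∣ ℕ.^ s)) (suc n) ∎
    where
    open ≡-Reasoning
    term : ℕ → ℤ
    term d = (- 1ℤ) ℤ.^ d * + (d ℕ.^ s)
    foldr-map : ∀ ds → foldr _+_ 0ℤ (map term ds) ≡ sumOver ds term
    foldr-map []       = refl
    foldr-map (d ∷ ds) = cong (_+_ (term d)) (foldr-map ds)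
    pos-quotient : ∀ k → suc k ∣ suc n → Pos (+ (suc n ℕ./ suc k))
    pos-quotient k d∣n with suc n ℕ./ suc k in eq
    ... | zero  = contradiction (trans (sym (m/n*n≡m d∣n)) (cong (ℕ._* suc k) eq)) λ ()
    ... | suc _ = ℤ.+<+ (s≤s z≤n)

  pos-^ : ∀ m s → + (m ℕ.^ s) ≡ (+ m) ℤ.^ s
  pos-^ m zero    = refl
  pos-^ m (suc s) = trans (ℤ.pos-* m (m ℕ.^ s)) (cong (+ m *_) (pos-^ m s))

  σ*₃-E : ∀ n → σ* 3 (suc n) ≡ E s₃* (suc n)
  σ*₃-E n = trans (σ*-E 3 n) (trans (E-cong (λ { {+ d} _ _ → cong ((+ 2 * o (+ d) - 1ℤ) *_)
    (trans (pos-^ d 3) (solve 1 (λ d → d :* (d :* (d :* con 1ℤ)) := d :* d :* d) refl (+ d))) }) (suc n)) (sym (s₃*-star (suc n))))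

  σ*₇-E : ∀ n → σ* 7 (suc n) ≡ E s₇* (suc n)
  σ*₇-E n = trans (σ*-E 7 n) (trans (E-cong (λ { {+ d} _ _ → cong ((+ 2 * o (+ d) - 1ℤ) *_)
    (trans (pos-^ d 7) (solve 1 (λ d → d :* (d :* (d :* (d :* (d :* (d :* (d :* con 1ℤ)))))) := d :* d :* d :* (d :* d :* d) :* d) refl (+ d))) }) (suc n)) (sym (s₇*-star (suc n))))

  sixteen-squares : ∀ n → + 17 * ((- 1ℤ) ℤ.^ suc n * + r 16 (suc n)) ≡ + 32 * (- + 16 * (Eis ⊛ (λ j → + δ₈ j)) n - σ* 7 (suc n))
  sixteen-squares n = begin
    + 17 * ((- 1ℤ) ℤ.^ suc n * + r 16 (suc n))
      ≡⟨ cong (+ 17 *_) (trans (r₁₆ (suc n)) (trans (⊛-Eis Eis (suc n)) (cong (λ z → Eis (suc n) + - + 16 * z)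
           (trans (⊛-comm Eis S (suc n)) (⊛-Eis S (suc n)))))) ⟩
    + 17 * (0ℤ + - + 16 * S (suc n) + - + 16 * (S (suc n) + - + 16 * (S ⊛ S) (suc n)))
      -- Uses 17·256 = 32·136 and 17·32 = 32·17: the factor 32 splits off and the left side of
      -- `eisenstein` appears.
      ≡⟨ solve 2 (λ s c → con (+ 17) :* (con 0ℤ :+ con (- + 16) :* s :+ con (- + 16) :* (s :+ con (- + 16) :* c))
           := con (+ 32) :* (con (+ 136) :* c :- con (+ 17) :* s)) refl (S (suc n)) ((S ⊛ S) (suc n)) ⟩
    + 32 * (+ 136 * (S ⊛ S) (suc n) - + 17 * S (suc n))
      ≡⟨ cong (+ 32 *_) (rearrange (+ 136 * (S ⊛ S) (suc n)) (+ 17 * S (suc n)) (+ 256) ((S ⊛ T) (suc n)) (+ 16) (T (suc n)) (E s₇* (suc n)) (eisenstein (suc n))) ⟩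
    + 32 * (+ 256 * (S ⊛ T) (suc n) - + 16 * T (suc n) - E s₇* (suc n))
      ≡⟨ cong (+ 32 *_) (cong₂ _-_ product (sym (σ*₇-E n))) ⟩
    + 32 * (- + 16 * (Eis ⊛ (λ j → + δ₈ j)) n - σ* 7 (suc n)) ∎
    where
    open ≡-Reasoning
    S T : Series
    S = E s₃*
    T = E s₃
    rearrange : ∀ a b c d e f g → a - c * d + e * f ≡ b - g → a - b ≡ c * d - e * f - g
    rearrange a b c d e f g eq = begin
      a - b                                          ≡⟨ solve 4 (λ a b x y → a :- b := (a :- x :+ y) :+ (x :- y) :- b) refl a b (c * d) (e * f) ⟩
      (a - c * d + e * f) + (c * d - e * f) - b      ≡⟨ cong (λ z → z + (c * d - e * f) - b) eq ⟩
      (b - g) + (c * d - e * f) - b                  ≡⟨ solve 3 (λ b g x → (b :- g) :+ x :- b := x :- g) refl b g (c * d - e * f) ⟩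
      c * d - e * f - g                              ∎
    product : + 256 * (S ⊛ T) (suc n) - + 16 * T (suc n) ≡ - + 16 * (Eis ⊛ (λ j → + δ₈ j)) n
    product = begin
      + 256 * (S ⊛ T) (suc n) - + 16 * T (suc n)
        ≡⟨ cong (λ z → + 256 * z - + 16 * T (suc n)) (⊛-comm S T (suc n)) ⟩
      + 256 * (T ⊛ S) (suc n) - + 16 * T (suc n)
        ≡⟨ solve 2 (λ c t → con (+ 256) :* c :- con (+ 16) :* t := con (- + 16) :* (t :+ con (- + 16) :* c)) refl ((T ⊛ S) (suc n)) (T (suc n)) ⟩
      - + 16 * (T (suc n) + - + 16 * (T ⊛ S) (suc n))
        ≡⟨ cong (- + 16 *_) (sym (⊛-Eis T (suc n))) ⟩
      -- T has no constant term, so its convolution at n+1 is one of its tail at n. This is the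
      -- shift n-j-1 of the theorem.
      - + 16 * (0ℤ * Eis (suc n) + (tail T ⊛ Eis) n)
        ≡⟨ cong (- + 16 *_) (trans (ℤ.+-identityˡ _) (⊛-comm (tail T) Eis n)) ⟩
      - + 16 * (Eis ⊛ tail T) n
        ≡⟨ cong (- + 16 *_) (⊛-cong {Eis} (λ _ → refl) (λ j → sym (δ₈-E j)) n) ⟩
      - + 16 * (Eis ⊛ (λ j → + δ₈ j)) n ∎

open SixteenSquares

-- Transfer of the integer identity to the rationals.

open import Data.Nat using (ℕ; _≤_; _∸_)
open import Data.Integer using (+_) renaming (-_ to -ℤ_; _^_ to _^ℤ_)
open import Data.Rational using (ℚ; _+_; _-_; _*_; _/_)
open import Relation.Binary.PropositionalEquality using (_≡_)
open import Data.Integer using () renaming (_+_ to _+ℤ_; _*_ to _*ℤ_)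
open import Data.Rational using (0ℚ; 1ℚ; -_; toℚᵘ)
import Data.Rational.Properties as ℚ
import Data.Rational.Solver as ℚSolver
open ℚSolver.+-*-Solver using (solve; _:+_; _:*_; _:-_; :-_; con; _:=_)
open import Data.Rational.Unnormalised using (mkℚᵘ; _≃_; *≡*)
import Data.Rational.Unnormalised.Properties as ℚᵘ

ι : ℤ → ℚ
ι i = i / 1

toℚᵘ-ι : ∀ i → toℚᵘ (ι i) ≃ mkℚᵘ i 0
toℚᵘ-ι i = ℚ.toℚᵘ-fromℚᵘ (mkℚᵘ i 0)

ι-+ : ∀ i j → ι (i +ℤ j) ≡ ι i + ι j
ι-+ i j = ℚ.toℚᵘ-injective (ℚᵘ.≃-trans (toℚᵘ-ι (i +ℤ j)) (ℚᵘ.≃-trans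
  (*≡* (cong (_*ℤ + 1) (sym (cong₂ _+ℤ_ (ℤ.*-identityʳ i) (ℤ.*-identityʳ j)))))
  (ℚᵘ.≃-sym (ℚᵘ.≃-trans (ℚ.toℚᵘ-homo-+ (ι i) (ι j)) (ℚᵘ.+-cong (toℚᵘ-ι i) (toℚᵘ-ι j))))))

ι-* : ∀ i j → ι (i *ℤ j) ≡ ι i * ι j
ι-* i j = ℚ.toℚᵘ-injective (ℚᵘ.≃-trans (toℚᵘ-ι (i *ℤ j)) (ℚᵘ.≃-trans
  (*≡* refl)
  (ℚᵘ.≃-sym (ℚᵘ.≃-trans (ℚ.toℚᵘ-homo-* (ι i) (ι j)) (ℚᵘ.*-cong (toℚᵘ-ι i) (toℚᵘ-ι j))))))

ι-neg : ∀ i → ι (-ℤ i) ≡ - ι i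
ι-neg i = begin
  ι (-ℤ i)              ≡⟨ cong ι (ℤ.-1*i≡-i i) ⟨
  ι (-ℤ (+ 1) *ℤ i)     ≡⟨ ι-* (-ℤ (+ 1)) i ⟩
  - 1ℚ * ι i            ≡⟨ solve 1 (λ x → con (- 1ℚ) :* x := :- x) refl (ι i) ⟩
  - ι i                 ∎
  where open ≡-Reasoning

Σ<-cong : ∀ n {f g} → (∀ j → f j ≡ g j) → Σ< n f ≡ Σ< n g
Σ<-cong zero    eq = refl
Σ<-cong (suc n) eq = cong₂ _+_ (Σ<-cong n eq) (eq n)

Σ<-* : ∀ n c f → Σ< n (λ j → c * f j) ≡ c * Σ< n f
Σ<-* zero    c f = sym (ℚ.*-zeroʳ c)
Σ<-* (suc n) c f = trans (cong (_+ c * f n) (Σ<-* n c f)) (sym (ℚ.*-distribˡ-+ c (Σ< n f) (f n)))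

Σ<-head : ∀ n f → Σ< (suc n) f ≡ f 0 + Σ< n (f ∘ suc)
Σ<-head zero    f = ℚ.+-comm 0ℚ (f 0)
Σ<-head (suc n) f = trans (cong (_+ f (suc n)) (Σ<-head n f)) (ℚ.+-assoc (f 0) (Σ< n (f ∘ suc)) (f (suc n)))

-- `Σ<` adds its last term while `⊛` splits off its first, so the induction goes through `Σ<-head`.
Σ<-⊛ : ∀ n f g → Σ< (suc n) (λ j → ι (f j) * ι (g (suc n ∸ j ∸ 1))) ≡ ι ((f ⊛ g) n)
Σ<-⊛ zero    f g = trans (ℚ.+-identityˡ (ι (f 0) * ι (g 0))) (sym (ι-* (f 0) (g 0)))
Σ<-⊛ (suc n) f g = begin
  Σ< (suc (suc n)) (λ j → ι (f j) * ι (g (suc (suc n) ∸ j ∸ 1)))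
    ≡⟨ Σ<-head (suc n) (λ j → ι (f j) * ι (g (suc (suc n) ∸ j ∸ 1))) ⟩
  ι (f 0) * ι (g (suc n)) + Σ< (suc n) (λ j → ι (f (suc j)) * ι (g (suc n ∸ j ∸ 1)))
    ≡⟨ cong₂ _+_ (sym (ι-* (f 0) (g (suc n)))) (Σ<-⊛ n (tail f) g) ⟩
  ι (f 0 *ℤ g (suc n)) + ι ((tail f ⊛ g) n)
    ≡⟨ ι-+ (f 0 *ℤ g (suc n)) ((tail f ⊛ g) n) ⟨
  ι ((f ⊛ g) (suc n)) ∎
  where open ≡-Reasoning

-1/16 : ℚ
-1/16 = - (+ 1 / 16)

σ*₃-Eis : ∀ j → σ*₃ j ≡ -1/16 * ι (Eis j)
σ*₃-Eis zero    = refl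
σ*₃-Eis (suc j) = begin
  ι (σ* 3 (suc j))                                  ≡⟨ cong ι (σ*₃-E j) ⟩
  ι (E s₃* (suc j))                                 ≡⟨ solve 1 (λ x → x := con -1/16 :* (con (ι (-ℤ (+ 16))) :* x)) refl (ι (E s₃* (suc j))) ⟩
  -1/16 * (ι (-ℤ (+ 16)) * ι (E s₃* (suc j)))       ≡⟨ cong (-1/16 *_) (ι-* (-ℤ (+ 16)) (E s₃* (suc j))) ⟨
  -1/16 * ι (-ℤ (+ 16) *ℤ E s₃* (suc j))            ≡⟨ cong (λ z → -1/16 * ι z) (ℤ.+-identityˡ (-ℤ (+ 16) *ℤ E s₃* (suc j))) ⟨
  -1/16 * ι (Eis (suc j))                             ∎
  where open ≡-Reasoning

theorem4p15 : (n : ℕ) → 1 ≤ n →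
    (+ r 16 n / 1) ≡ (((-ℤ + 1) ^ℤ n) / 1) * (+ 32 / 17) *
    ((+ 256 / 1) * Σ< n (λ j → σ*₃ j * (+ δ₈ (n ∸ j ∸ 1) / 1)) - (σ* 7 n / 1))
theorem4p15 (suc n) _ = begin
  ι (+ r 16 (suc n))
    ≡⟨ cong ι r≡ ⟩
  ι (ε *ℤ (ε *ℤ + r 16 (suc n)))
    ≡⟨ ι-* ε (ε *ℤ + r 16 (suc n)) ⟩
  ι ε * ι (ε *ℤ + r 16 (suc n))
    -- Inserts 1 = (1/17)·17, so that the integer identity, which is stated with the factor 17, can
    -- be applied.
    ≡⟨ solve 2 (λ s y → s :* y := s :* con (+ 1 / 17) :* (con (ι (+ 17)) :* y)) refl (ι ε) (ι (ε *ℤ + r 16 (suc n))) ⟩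
  ι ε * (+ 1 / 17) * (ι (+ 17) * ι (ε *ℤ + r 16 (suc n)))
    ≡⟨ cong (ι ε * (+ 1 / 17) *_) scaled ⟩
  ι ε * (+ 1 / 17) * (ι (+ 32) * (ι (-ℤ (+ 16)) * ι X - ι σ₇))
    ≡⟨ solve 3 (λ s x y → s :* con (+ 1 / 17) :* (con (ι (+ 32)) :* (con (ι (-ℤ (+ 16))) :* x :- y))
         := s :* con (+ 32 / 17) :* (con (+ 256 / 1) :* (con -1/16 :* x) :- y)) refl (ι ε) (ι X) (ι σ₇) ⟩
  ι ε * (+ 32 / 17) * ((+ 256 / 1) * (-1/16 * ι X) - ι σ₇)
    ≡⟨ cong (λ z → ι ε * (+ 32 / 17) * ((+ 256 / 1) * z - ι σ₇)) (sym convolution) ⟩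
  ι ε * (+ 32 / 17) * ((+ 256 / 1) * Σ< (suc n) (λ j → σ*₃ j * (+ δ₈ (suc n ∸ j ∸ 1) / 1)) - ι σ₇) ∎
  where
  open ≡-Reasoning
  ε X σ₇ : ℤ
  ε = (-ℤ + 1) ^ℤ suc n
  X = (Eis ⊛ (λ j → + δ₈ j)) n
  σ₇ = σ* 7 (suc n)
  r≡ : + r 16 (suc n) ≡ ε *ℤ (ε *ℤ + r 16 (suc n))
  r≡ = sym (trans (sym (ℤ.*-assoc ε ε (+ r 16 (suc n)))) (trans (cong (_*ℤ + r 16 (suc n)) (sign-square (suc n))) (ℤ.*-identityˡ _)))
  scaled : ι (+ 17) * ι (ε *ℤ + r 16 (suc n)) ≡ ι (+ 32) * (ι (-ℤ (+ 16)) * ι X - ι σ₇)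
  scaled = begin
    ι (+ 17) * ι (ε *ℤ + r 16 (suc n))             ≡⟨ ι-* (+ 17) (ε *ℤ + r 16 (suc n)) ⟨
    ι (+ 17 *ℤ (ε *ℤ + r 16 (suc n)))              ≡⟨ cong ι (sixteen-squares n) ⟩
    ι (+ 32 *ℤ (-ℤ (+ 16) *ℤ X +ℤ -ℤ σ₇))          ≡⟨ ι-* (+ 32) (-ℤ (+ 16) *ℤ X +ℤ -ℤ σ₇) ⟩
    ι (+ 32) * ι (-ℤ (+ 16) *ℤ X +ℤ -ℤ σ₇)         ≡⟨ cong (ι (+ 32) *_) (trans (ι-+ (-ℤ (+ 16) *ℤ X) (-ℤ σ₇)) (cong₂ _+_ (ι-* (-ℤ (+ 16)) X) (ι-neg σ₇))) ⟩
    ι (+ 32) * (ι (-ℤ (+ 16)) * ι X - ι σ₇)        ∎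
  convolution : Σ< (suc n) (λ j → σ*₃ j * (+ δ₈ (suc n ∸ j ∸ 1) / 1)) ≡ -1/16 * ι X
  convolution = begin
    Σ< (suc n) (λ j → σ*₃ j * ι (+ δ₈ (suc n ∸ j ∸ 1)))
      ≡⟨ Σ<-cong (suc n) (λ j → trans (cong (_* ι (+ δ₈ (suc n ∸ j ∸ 1))) (σ*₃-Eis j)) (ℚ.*-assoc -1/16 (ι (Eis j)) (ι (+ δ₈ (suc n ∸ j ∸ 1))))) ⟩
    Σ< (suc n) (λ j → -1/16 * (ι (Eis j) * ι (+ δ₈ (suc n ∸ j ∸ 1))))
      ≡⟨ Σ<-* (suc n) -1/16 (λ j → ι (Eis j) * ι (+ δ₈ (suc n ∸ j ∸ 1))) ⟩
    -1/16 * Σ< (suc n) (λ j → ι (Eis j) * ι (+ δ₈ (suc n ∸ j ∸ 1)))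
      ≡⟨ cong (-1/16 *_) (Σ<-⊛ n Eis (λ j → + δ₈ j)) ⟩
    -1/16 * ι X ∎
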